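{- Let $A$ be a finite abelian group that is not isomorphic to the cyclic group $C_4$ of order $4$. Then the lattice $\mathbb{L}(A)$ is eutactic in its real span $\operatorname{span}_{\mathbb{R}}(\mathbb{L}(A))$.
   Context: Let $A$ be a finite abelian group, written multiplicatively, with group rings $\mathbb{Z}A\subset\mathbb{R}A$. Regard $\mathbb{R}A$ as a Euclidean space with $\langle \sum_a x_a a,\sum_a y_a a\rangle=\sum_a x_a y_a$ and $\|x\|=\sqrt{\langle x,x\rangle}$. Let $\Delta A=\{\sum_a r_a a\in\mathbb{Z}A : \sum_a r_a=0\}$ be the augmentation ideal, let $\psi_A\colon\mathbb{Z}A\to A$ be the homomorphism $\psi_A(\sum_a k_a a)=\prod_a a^{k_a}$ (from the additive group of $\mathbb{Z}A$ to $A$), and let $\mathbb{L}(A)=\operatorname{Ker}(\psi_A)\cap\Delta A$. For a Euclidean space $(V,\langle\cdot,\cdot\rangle)$ and $s\in V$, let $\pi_s\colon V\to V$ be $v\mapsto\langle v,s\rangle s$. A finite subset $S\subset V$ is eutactic in $V$ if there are real numbers $r_s>0$ ($s\in S$) with $\operatorname{Id}_V=\sum_{s\in S}r_s\pi_s$. For a lattice $\Lambda\subset V$, $\operatorname{MinDist}(\Lambda)=\min\{\|x\| : x\in\Lambda, x\neq 0\}$ and $\operatorname{MinVecs}(\Lambda)=\{s\in\Lambda : \|s\|=\operatorname{MinDist}(\Lambda)\}$. The lattice $\Lambda$ is eutactic in $V$ if $\operatorname{MinVecs}(\Lambda)$ is eutactic in $V$. For the zero lattice (the case of trivial $A$) use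 the convention $\operatorname{MinVecs}(0)=\emptyset$. -}

module Defs where

open import Level using (Level; _⊔_; suc)
open import Algebra.Bundles using (AbelianGroup; CommutativeRing; RawGroup)
import Algebra.Definitions.RawMonoid as RawMonoidDefinitions
open import Algebra.Morphism.Structures using (module GroupMorphisms)
open import Algebra.Structures using (IsCommutativeRing)
open import Data.Fin.Base using (Fin; toℕ)
import Data.Fin.Properties as Fin
open import Data.Integer.Base as ℤ using (ℤ; +_; -[1+_]; 0ℤ)
import Data.Integer.Properties as ℤ
open import Data.Nat.Base as ℕ using (ℕ; zero; NonZero)
open import Data.Nat.DivMod using (_mod_)
import Data.Nat.Properties as ℕ
open import Data.Nat.Solver using () renaming (module +-*-Solver to ℕ-Solver)
open import Data.Product.Base using (Σ; ∃; _×_; _,_; proj₁; proj₂)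
open import Data.Rational.Base as ℚ
  using (ℚ; 0ℚ; 1ℚ; ½; _+_; _*_; _-_; -_; _≤_; _<_; ∣_∣; _/_; 1/_; ↥_; ↧ₙ_)
import Data.Rational.Properties as ℚ
open import Data.Rational.Solver using () renaming (module +-*-Solver to ℚ-Solver)
import Data.Rational.Unnormalised.Base as ℚᵘ
import Data.Rational.Unnormalised.Properties as ℚᵘ
open import Data.Sum.Base using (inj₁; inj₂)
open import Function.Bundles using (Func; Inverse; _⟨$⟩_)
import Function.Relation.Binary.Setoid.Equality as FuncEquality
open import Relation.Binary.PropositionalEquality
  using (_≡_; refl; sym; trans; cong; cong₂; subst; subst₂; isEquivalence; setoid)
open import Relation.Nullary using (¬_; yes; no)
open import Relation.Nullary.Decidable using (from-yes)
open import Relation.Unary using (Pred; _∈_; _⊆_)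

module RationalLemmas where

  0<½ : 0ℚ < ½
  0<½ = from-yes (0ℚ ℚ.<? ½)

  *-pos : ∀ {p q} → 0ℚ < p → 0ℚ < q → 0ℚ < p * q
  *-pos {p} {q} 0<p 0<q =
    ℚ.positive⁻¹ (p * q) {{ℚ.pos*pos⇒pos p {{ℚ.positive 0<p}} q {{ℚ.positive 0<q}}}}

  half-pos : ∀ {ε} → 0ℚ < ε → 0ℚ < ½ * ε
  half-pos = *-pos 0<½

  halves : ∀ ε → ½ * ε + ½ * ε ≡ ε
  halves = solve 1 (λ ε → con ½ :* ε :+ con ½ :* ε := ε) refl
    where open ℚ-Solver

  *-mono-≤ : ∀ {p q r s} → 0ℚ ≤ p → 0ℚ ≤ s → p ≤ q → r ≤ s → p * r ≤ q * s
  *-mono-≤ {p} {q} {r} {s} 0≤p 0≤s p≤q r≤s =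
    ℚ.≤-trans (ℚ.*-monoˡ-≤-nonNeg p {{ℚ.nonNegative 0≤p}} r≤s)
              (ℚ.*-monoʳ-≤-nonNeg s {{ℚ.nonNegative 0≤s}} p≤q)

  square-cancel-≤ : ∀ {p q} → 0ℚ ≤ q → p * p ≤ q * q → p ≤ q
  square-cancel-≤ {p} {q} 0≤q pp≤qq = ℚ.≮⇒≥ λ q<p →
    let 0<p = ℚ.≤-<-trans 0≤q q<p in
    ℚ.<-irrefl refl (ℚ.≤-<-trans
      (ℚ.≤-trans pp≤qq (ℚ.*-monoˡ-≤-nonNeg q {{ℚ.nonNegative 0≤q}} (ℚ.<⇒≤ q<p)))
      (subst₂ _<_ (ℚ.*-comm p q) refl (ℚ.*-monoʳ-<-pos p {{ℚ.positive 0<p}} q<p)))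

  ∣p-p∣ : ∀ p → ∣ p - p ∣ ≡ 0ℚ
  ∣p-p∣ p = cong ∣_∣ (ℚ.+-inverseʳ p)

  dist-sym : ∀ p q → ∣ p - q ∣ ≡ ∣ q - p ∣
  dist-sym p q = trans (sym (ℚ.∣-p∣≡∣p∣ (p - q))) (cong ∣_∣ lemma)
    where
    lemma : - (p - q) ≡ q - p
    lemma = solve 2 (λ p q → :- (p :- q) := q :- p) refl p q
      where open ℚ-Solver

  dist-triangle : ∀ p q r → ∣ p - r ∣ ≤ ∣ p - q ∣ + ∣ q - r ∣
  dist-triangle p q r = subst (λ t → ∣ t ∣ ≤ ∣ p - q ∣ + ∣ q - r ∣) lemma
    (ℚ.∣p+q∣≤∣p∣+∣q∣ (p - q) (q - r))
    where
    lemma : (p - q) + (q - r) ≡ p - r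
    lemma = solve 3 (λ p q r → (p :- q) :+ (q :- r) := p :- r) refl p q r
      where open ℚ-Solver

  p≤∣p∣ : ∀ p → p ≤ ∣ p ∣
  p≤∣p∣ p with ℚ.≤-total 0ℚ p
  ... | inj₁ 0≤p = ℚ.≤-reflexive (sym (ℚ.0≤p⇒∣p∣≡p 0≤p))
  ... | inj₂ p≤0 = ℚ.≤-trans p≤0 (ℚ.0≤∣p∣ p)

  ∣p∣≤ : ∀ {p q} → p ≤ q → - p ≤ q → ∣ p ∣ ≤ q
  ∣p∣≤ {p} {q} p≤q -p≤q with ℚ.∣p∣≡p∨∣p∣≡-p p
  ... | inj₁ eq = subst (_≤ q) (sym eq) p≤q
  ... | inj₂ eq = subst (_≤ q) (sym eq) -p≤q

  ∣p-q∣≤r⇒p≤q+r : ∀ p q {r} → ∣ p - q ∣ ≤ r → p ≤ q + r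
  ∣p-q∣≤r⇒p≤q+r p q {r} h = subst (_≤ q + r) lemma
    (ℚ.+-monoʳ-≤ q (ℚ.≤-trans (p≤∣p∣ (p - q)) h))
    where
    lemma : q + (p - q) ≡ p
    lemma = solve 2 (λ p q → q :+ (p :- q) := p) refl p q
      where open ℚ-Solver

  p≤q+r⇒p-q≤r : ∀ p q {r} → p ≤ q + r → p - q ≤ r
  p≤q+r⇒p-q≤r p q {r} h = subst (p - q ≤_) lemma (ℚ.+-monoˡ-≤ (- q) h)
    where
    lemma : q + r - q ≡ r
    lemma = solve 2 (λ q r → q :+ r :- q := r) refl q r
      where open ℚ-Solver

  dist≤ : ∀ p q {r} → p ≤ q + r → q ≤ p + r → ∣ p - q ∣ ≤ r
  dist≤ p q {r} p≤ q≤ = ∣p∣≤ (p≤q+r⇒p-q≤r p q p≤)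
    (subst (_≤ r) lemma (p≤q+r⇒p-q≤r q p q≤))
    where
    lemma : q - p ≡ - (p - q)
    lemma = solve 2 (λ p q → q :- p := :- (p :- q)) refl p q
      where open ℚ-Solver

  +-close : ∀ {a b c d ε} → ∣ a - c ∣ ≤ ½ * ε → ∣ b - d ∣ ≤ ½ * ε →
            ∣ (a + b) - (c + d) ∣ ≤ ε
  +-close {a} {b} {c} {d} {ε} h k = subst₂ _≤_ (cong ∣_∣ lemma) (halves ε)
    (ℚ.≤-trans (ℚ.∣p+q∣≤∣p∣+∣q∣ (a - c) (b - d)) (ℚ.+-mono-≤ h k))
    where
    lemma : (a - c) + (b - d) ≡ (a + b) - (c + d)
    lemma = solve 4 (λ a b c d → (a :- c) :+ (b :- d) := (a :+ b) :- (c :+ d)) refl a b c d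
      where open ℚ-Solver

  *-close : ∀ {a b c d B δ ε} → B * δ ≡ ½ * ε → ∣ a ∣ ≤ B → ∣ d ∣ ≤ B →
            ∣ a - c ∣ ≤ δ → ∣ b - d ∣ ≤ δ → ∣ a * b - c * d ∣ ≤ ε
  *-close {a} {b} {c} {d} {B} {δ} {ε} Bδ a≤B d≤B h k =
    subst₂ _≤_ (cong ∣_∣ lemma) (halves ε)
      (ℚ.≤-trans (ℚ.∣p+q∣≤∣p∣+∣q∣ (a * (b - d)) (d * (a - c)))
                 (ℚ.+-mono-≤ (bound a (b - d) a≤B k) (bound d (a - c) d≤B h)))
    where
    lemma : a * (b - d) + d * (a - c) ≡ a * b - c * d
    lemma = solve 4 (λ a b c d → a :* (b :- d) :+ d :* (a :- c) := a :* b :- c :* d) refl a b c d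
      where open ℚ-Solver
    bound : ∀ p q → ∣ p ∣ ≤ B → ∣ q ∣ ≤ δ → ∣ p * q ∣ ≤ ½ * ε
    bound p q p≤ q≤ = subst₂ _≤_ (sym (ℚ.∣p*q∣≡∣p∣*∣q∣ p q)) Bδ
      (*-mono-≤ (ℚ.0≤∣p∣ p) (ℚ.≤-trans (ℚ.0≤∣p∣ q) q≤) p≤ q≤)

  -- A tolerance δ with B * δ ≡ ½ * ε.
  scale : ∀ B ε → 0ℚ < B → 0ℚ < ε → ∃ λ δ → 0ℚ < δ × B * δ ≡ ½ * ε
  scale B ε 0<B 0<ε = 1/ B * (½ * ε) ,
    *-pos (ℚ.positive⁻¹ (1/ B) {{ℚ.1/pos⇒pos B}}) (half-pos 0<ε) ,
    trans (sym (ℚ.*-assoc B (1/ B) (½ * ε)))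
          (trans (cong (_* (½ * ε)) (ℚ.*-inverseʳ B)) (ℚ.*-identityˡ (½ * ε)))
    where instance
      B-pos = ℚ.positive 0<B
      B-nonZero = ℚ.pos⇒nonZero B {{ℚ.positive 0<B}}

open RationalLemmas

------------------------------------------------------------------------
-- Real numbers

-- P holds for all sufficiently large n.
Eventually : Pred ℕ Level.zero → Set
Eventually P = ∃ λ N → ∀ n → N ℕ.≤ n → P n

both : ∀ {P Q R : Pred ℕ Level.zero} → (∀ n → P n → Q n → R n) →
       Eventually P → Eventually Q → Eventually R
both f (M , p) (N , q) = M ℕ.⊔ N , λ n le →
  f n (p n (ℕ.≤-trans (ℕ.m≤m⊔n M N) le)) (q n (ℕ.≤-trans (ℕ.m≤n⊔m M N) le))

always : ∀ {P : Pred ℕ Level.zero} → (∀ n → P n) → Eventually P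
always p = 0 , λ n _ → p n

Cauchy : (ℕ → ℚ) → Set
Cauchy x = ∀ ε → 0ℚ < ε →
  ∃ λ N → ∀ m n → N ℕ.≤ m → N ℕ.≤ n → ∣ x m - x n ∣ ≤ ε

-- Cauchy sequences of rationals.  Equality is _≃_ below, not _≡_.
record ℝ : Set where
  constructor mkℝ
  field
    seq    : ℕ → ℚ
    cauchy : Cauchy seq

open ℝ public

infix 4 _≃_ _≤ᴿ_ _<ᴿ_
infixl 6 _+ᴿ_
infixl 7 _*ᴿ_
infix 8 -ᴿ_

_≃_ : ℝ → ℝ → Set
x ≃ y = ∀ ε → 0ℚ < ε → Eventually λ n → ∣ seq x n - seq y n ∣ ≤ ε

_≤ᴿ_ : ℝ → ℝ → Set
x ≤ᴿ y = ∀ ε → 0ℚ < ε → Eventually λ n → seq x n ≤ seq y n + ε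

_<ᴿ_ : ℝ → ℝ → Set
x <ᴿ y = ∃ λ ε → 0ℚ < ε × Eventually λ n → seq x n + ε ≤ seq y n

abstract
  const-cauchy : ∀ q → Cauchy (λ _ → q)
  const-cauchy q ε 0<ε = 0 , λ _ _ _ _ →
    ℚ.≤-trans (ℚ.≤-reflexive (∣p-p∣ q)) (ℚ.<⇒≤ 0<ε)

fromℚ : ℚ → ℝ
fromℚ q = mkℝ (λ _ → q) (const-cauchy q)

fromℤ : ℤ → ℝ
fromℤ k = fromℚ (k / 1)

0ᴿ 1ᴿ : ℝ
0ᴿ = fromℚ 0ℚ
1ᴿ = fromℚ 1ℚ

abstract
  +-cauchy : ∀ x y → Cauchy (λ n → seq x n + seq y n)
  +-cauchy x y ε 0<ε =
    let (M , p) = cauchy x (½ * ε) (half-pos 0<ε)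
        (N , q) = cauchy y (½ * ε) (half-pos 0<ε)
    in M ℕ.⊔ N , λ m n hm hn →
       +-close {a = seq x m} {seq y m} {seq x n} {seq y n} {ε}
         (p m n (ℕ.m⊔n≤o⇒m≤o M N hm) (ℕ.m⊔n≤o⇒m≤o M N hn))
         (q m n (ℕ.m⊔n≤o⇒n≤o M N hm) (ℕ.m⊔n≤o⇒n≤o M N hn))

_+ᴿ_ : ℝ → ℝ → ℝ
x +ᴿ y = mkℝ (λ n → seq x n + seq y n) (+-cauchy x y)

neg-dist : ∀ p q → ∣ - p - - q ∣ ≡ ∣ p - q ∣
neg-dist p q = trans (cong ∣_∣ (sym (ℚ.neg-distrib-+ p (- q)))) (ℚ.∣-p∣≡∣p∣ (p - q))

abstract
  neg-cauchy : ∀ x → Cauchy (λ n → - seq x n)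
  neg-cauchy x ε 0<ε =
    let (N , p) = cauchy x ε 0<ε
    in N , λ m n hm hn → subst (_≤ ε) (sym (neg-dist (seq x m) (seq x n))) (p m n hm hn)

-ᴿ_ : ℝ → ℝ
-ᴿ x = mkℝ (λ n → - seq x n) (neg-cauchy x)

bounded : ∀ x → ∃ λ B → 0ℚ < B × Eventually λ n → ∣ seq x n ∣ ≤ B
bounded x = ∣ seq x N ∣ + 1ℚ ,
  ℚ.+-mono-≤-< (ℚ.0≤∣p∣ (seq x N)) 0<1 ,
  N , λ n hn → bound (seq x n) (seq x N) (p n N hn ℕ.≤-refl)
  where
  0<1 : 0ℚ < 1ℚ
  0<1 = from-yes (0ℚ ℚ.<? 1ℚ)
  N = proj₁ (cauchy x 1ℚ 0<1)
  p = proj₂ (cauchy x 1ℚ 0<1)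
  bound : ∀ a b → ∣ a - b ∣ ≤ 1ℚ → ∣ a ∣ ≤ ∣ b ∣ + 1ℚ
  bound a b h = subst (_≤ ∣ b ∣ + 1ℚ) (cong ∣_∣ lemma)
    (ℚ.≤-trans (ℚ.∣p+q∣≤∣p∣+∣q∣ b (a - b)) (ℚ.+-monoʳ-≤ ∣ b ∣ h))
    where
    lemma : b + (a - b) ≡ a
    lemma = solve 2 (λ a b → b :+ (a :- b) := a) refl a b
      where open ℚ-Solver

common-bound : ∀ x y → ∃ λ B → 0ℚ < B ×
  (Eventually λ n → ∣ seq x n ∣ ≤ B) × (Eventually λ n → ∣ seq y n ∣ ≤ B)
common-bound x y = combine (bounded x) (bounded y)
  where
  combine : (∃ λ B → 0ℚ < B × Eventually λ n → ∣ seq x n ∣ ≤ B) →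
            (∃ λ B → 0ℚ < B × Eventually λ n → ∣ seq y n ∣ ≤ B) →
            ∃ λ B → 0ℚ < B ×
              (Eventually λ n → ∣ seq x n ∣ ≤ B) × (Eventually λ n → ∣ seq y n ∣ ≤ B)
  combine (B , 0<B , M , p) (C , 0<C , N , q) = B + C , ℚ.+-mono-< 0<B 0<C ,
    (M , λ n h → ℚ.≤-trans (p n h) B≤) , (N , λ n h → ℚ.≤-trans (q n h) C≤)
    where
    B≤ : B ≤ B + C
    B≤ = subst (_≤ B + C) (ℚ.+-identityʳ B) (ℚ.+-monoʳ-≤ B (ℚ.<⇒≤ 0<C))
    C≤ : C ≤ B + C
    C≤ = subst (_≤ B + C) (ℚ.+-identityˡ C) (ℚ.+-monoˡ-≤ C (ℚ.<⇒≤ 0<B))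

abstract
  *-cauchy : ∀ x y → Cauchy (λ n → seq x n * seq y n)
  *-cauchy x y ε 0<ε =
    let (B , 0<B , (K , x≤B) , (L , y≤B)) = common-bound x y
        (δ , 0<δ , Bδ) = scale B ε 0<B 0<ε
        (M , p) = cauchy x δ 0<δ
        (N , q) = cauchy y δ 0<δ
        T = (K ℕ.⊔ L) ℕ.⊔ (M ℕ.⊔ N)
        T≥K = λ {m} (h : T ℕ.≤ m) → ℕ.m⊔n≤o⇒m≤o K L (ℕ.m⊔n≤o⇒m≤o (K ℕ.⊔ L) (M ℕ.⊔ N) h)
        T≥L = λ {m} (h : T ℕ.≤ m) → ℕ.m⊔n≤o⇒n≤o K L (ℕ.m⊔n≤o⇒m≤o (K ℕ.⊔ L) (M ℕ.⊔ N) h)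
        T≥M = λ {m} (h : T ℕ.≤ m) → ℕ.m⊔n≤o⇒m≤o M N (ℕ.m⊔n≤o⇒n≤o (K ℕ.⊔ L) (M ℕ.⊔ N) h)
        T≥N = λ {m} (h : T ℕ.≤ m) → ℕ.m⊔n≤o⇒n≤o M N (ℕ.m⊔n≤o⇒n≤o (K ℕ.⊔ L) (M ℕ.⊔ N) h)
    in T , λ m n hm hn →
       *-close {a = seq x m} {seq y m} {seq x n} {seq y n} Bδ
         (x≤B m (T≥K hm)) (y≤B n (T≥L hn))
         (p m n (T≥M hm) (T≥M hn)) (q m n (T≥N hm) (T≥N hn))

_*ᴿ_ : ℝ → ℝ → ℝ
x *ᴿ y = mkℝ (λ n → seq x n * seq y n) (*-cauchy x y)

abstract
  ≃-pointwise : ∀ {x y} → (∀ n → seq x n ≡ seq y n) → x ≃ y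
  ≃-pointwise {x} {y} eq ε 0<ε = always λ n →
    subst (λ t → ∣ t - seq y n ∣ ≤ ε) (sym (eq n))
      (ℚ.≤-trans (ℚ.≤-reflexive (∣p-p∣ (seq y n))) (ℚ.<⇒≤ 0<ε))

  ≃-refl : ∀ {x} → x ≃ x
  ≃-refl {x} = ≃-pointwise {x} {x} λ _ → refl

  ≃-sym : ∀ {x y} → x ≃ y → y ≃ x
  ≃-sym {x} {y} x≃y ε 0<ε = let (N , p) = x≃y ε 0<ε in
    N , λ n h → subst (_≤ ε) (dist-sym (seq x n) (seq y n)) (p n h)

  ≃-trans : ∀ {x y z} → x ≃ y → y ≃ z → x ≃ z
  ≃-trans {x} {y} {z} x≃y y≃z ε 0<ε =
    both (λ n h k → subst (∣ seq x n - seq z n ∣ ≤_) (halves ε)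
            (ℚ.≤-trans (dist-triangle (seq x n) (seq y n) (seq z n)) (ℚ.+-mono-≤ h k)))
         (x≃y (½ * ε) (half-pos 0<ε)) (y≃z (½ * ε) (half-pos 0<ε))

  +ᴿ-cong : ∀ {x y u v} → x ≃ y → u ≃ v → x +ᴿ u ≃ y +ᴿ v
  +ᴿ-cong {x} {y} {u} {v} x≃y u≃v ε 0<ε =
    both (λ n h k → +-close {a = seq x n} {seq u n} {seq y n} {seq v n} h k)
         (x≃y (½ * ε) (half-pos 0<ε)) (u≃v (½ * ε) (half-pos 0<ε))

  -ᴿ-cong : ∀ {x y} → x ≃ y → -ᴿ x ≃ -ᴿ y
  -ᴿ-cong {x} {y} x≃y ε 0<ε = let (N , p) = x≃y ε 0<ε in
    N , λ n h → subst (_≤ ε) (sym (neg-dist (seq x n) (seq y n))) (p n h)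

  *ᴿ-cong : ∀ {x y u v} → x ≃ y → u ≃ v → x *ᴿ u ≃ y *ᴿ v
  *ᴿ-cong {x} {y} {u} {v} x≃y u≃v ε 0<ε =
    let (B , 0<B , x≤B , v≤B) = common-bound x v
        (δ , 0<δ , Bδ) = scale B ε 0<B 0<ε
    in both (λ n (a , d) (h , k) → *-close {a = seq x n} {seq u n} {seq y n} {seq v n} Bδ a d h k)
         (both (λ _ → _,_) x≤B v≤B)
         (both (λ _ → _,_) (x≃y δ 0<δ) (u≃v δ 0<δ))

  ℝ-isCommutativeRing : IsCommutativeRing _≃_ _+ᴿ_ _*ᴿ_ -ᴿ_ 0ᴿ 1ᴿ
  ℝ-isCommutativeRing = record
    { isRing = record
      { +-isAbelianGroup = record
        { isGroup = record
          { isMonoid = record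
            { isSemigroup = record
              { isMagma = record
                { isEquivalence = record
                  { refl = λ {x} → ≃-refl {x}
                  ; sym = λ {x} {y} → ≃-sym {x} {y}
                  ; trans = λ {x} {y} {z} → ≃-trans {x} {y} {z}
                  }
                ; ∙-cong = λ {x} {y} {u} {v} → +ᴿ-cong {x} {y} {u} {v}
                }
              ; assoc = λ x y z → ≃-pointwise {(x +ᴿ y) +ᴿ z} {x +ᴿ (y +ᴿ z)}
                  λ n → ℚ.+-assoc (seq x n) (seq y n) (seq z n)
              }
            ; identity = (λ x → ≃-pointwise {0ᴿ +ᴿ x} {x} λ n → ℚ.+-identityˡ (seq x n))
                       , (λ x → ≃-pointwise {x +ᴿ 0ᴿ} {x} λ n → ℚ.+-identityʳ (seq x n))
            }
          ; inverse = (λ x → ≃-pointwise { -ᴿ x +ᴿ x} {0ᴿ} λ n → ℚ.+-inverseˡ (seq x n))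
                    , (λ x → ≃-pointwise {x +ᴿ -ᴿ x} {0ᴿ} λ n → ℚ.+-inverseʳ (seq x n))
          ; ⁻¹-cong = λ {x} {y} → -ᴿ-cong {x} {y}
          }
        ; comm = λ x y → ≃-pointwise {x +ᴿ y} {y +ᴿ x} λ n → ℚ.+-comm (seq x n) (seq y n)
        }
      ; *-cong = λ {x} {y} {u} {v} → *ᴿ-cong {x} {y} {u} {v}
      ; *-assoc = λ x y z → ≃-pointwise {(x *ᴿ y) *ᴿ z} {x *ᴿ (y *ᴿ z)}
          λ n → ℚ.*-assoc (seq x n) (seq y n) (seq z n)
      ; *-identity = (λ x → ≃-pointwise {1ᴿ *ᴿ x} {x} λ n → ℚ.*-identityˡ (seq x n))
                   , (λ x → ≃-pointwise {x *ᴿ 1ᴿ} {x} λ n → ℚ.*-identityʳ (seq x n))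
      ; distrib = (λ x y z → ≃-pointwise {x *ᴿ (y +ᴿ z)} {x *ᴿ y +ᴿ x *ᴿ z}
                    λ n → ℚ.*-distribˡ-+ (seq x n) (seq y n) (seq z n))
                , (λ x y z → ≃-pointwise {(y +ᴿ z) *ᴿ x} {y *ᴿ x +ᴿ z *ᴿ x}
                    λ n → ℚ.*-distribʳ-+ (seq x n) (seq y n) (seq z n))
      }
    ; *-comm = λ x y → ≃-pointwise {x *ᴿ y} {y *ᴿ x} λ n → ℚ.*-comm (seq x n) (seq y n)
    }

ℝ-commutativeRing : CommutativeRing Level.zero Level.zero
ℝ-commutativeRing = record
  { Carrier = ℝ
  ; _≈_ = _≃_
  ; _+_ = _+ᴿ_
  ; _*_ = _*ᴿ_
  ; -_ = -ᴿ_
  ; 0# = 0ᴿ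
  ; 1# = 1ᴿ
  ; isCommutativeRing = ℝ-isCommutativeRing
  }

module ℝ-Ring = CommutativeRing ℝ-commutativeRing

------------------------------------------------------------------------
-- Square roots

-- The integer part of √ n.
isqrt : ℕ → ℕ
isqrt zero = zero
isqrt (ℕ.suc n) with ℕ.suc (isqrt n) ℕ.* ℕ.suc (isqrt n) ℕ.≤? ℕ.suc n
... | yes _ = ℕ.suc (isqrt n)
... | no _  = isqrt n

isqrt-≤ : ∀ n → isqrt n ℕ.* isqrt n ℕ.≤ n
isqrt-≤ zero = ℕ.z≤n
isqrt-≤ (ℕ.suc n) with ℕ.suc (isqrt n) ℕ.* ℕ.suc (isqrt n) ℕ.≤? ℕ.suc n
... | yes p = p
... | no _  = ℕ.m≤n⇒m≤1+n (isqrt-≤ n)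

isqrt-> : ∀ n → n ℕ.< ℕ.suc (isqrt n) ℕ.* ℕ.suc (isqrt n)
isqrt-> zero = ℕ.s≤s ℕ.z≤n
isqrt-> (ℕ.suc n) with ℕ.suc (isqrt n) ℕ.* ℕ.suc (isqrt n) ℕ.≤? ℕ.suc n
... | yes _ = ℕ.≤-<-trans (isqrt-> n) (ℕ.*-mono-< (ℕ.n<1+n k) (ℕ.n<1+n k))
  where k = ℕ.suc (isqrt n)
... | no p  = ℕ.≰⇒> p

-- For q = p / d and K = suc n, the denominator d * K gives a lower
-- approximation to √ (max q 0) with error at most 1 / (d * K) ≤ 1 / K.
ℚ-sqrt : ℕ → ℚ → ℚ
ℚ-sqrt n q = + isqrt (ℤ.∣ ↥ (q ℚ.⊔ 0ℚ) ∣ ℕ.* d ℕ.* (K ℕ.* K)) / (d ℕ.* K)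
  where
  d = ↧ₙ (q ℚ.⊔ 0ℚ)
  K = ℕ.suc n

module SqrtLemmas where

  toℚᵘ-/ : ∀ i m .{{_ : NonZero m}} → ℚ.toℚᵘ (i / m) ℚᵘ.≃ i ℚᵘ./ m
  toℚᵘ-/ i m@(ℕ.suc m-1) = ℚ.toℚᵘ-fromℚᵘ (ℚᵘ.mkℚᵘ i m-1)

  /-mono-≤ : ∀ i m j n .{{_ : NonZero m}} .{{_ : NonZero n}} →
             i ℕ.* n ℕ.≤ j ℕ.* m → + i / m ≤ + j / n
  /-mono-≤ i m@(ℕ.suc _) j n@(ℕ.suc _) h = ℚ.toℚᵘ-cancel-≤
    (ℚᵘ.≤-respˡ-≃ (ℚᵘ.≃-sym (toℚᵘ-/ (+ i) m)) (ℚᵘ.≤-respʳ-≃ (ℚᵘ.≃-sym (toℚᵘ-/ (+ j) n))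
      (ℚᵘ.*≤* (subst₂ ℤ._≤_ (ℤ.pos-* i n) (ℤ.pos-* j m) (ℤ.+≤+ h)))))

  /-mono-< : ∀ i m j n .{{_ : NonZero m}} .{{_ : NonZero n}} →
             i ℕ.* n ℕ.< j ℕ.* m → + i / m < + j / n
  /-mono-< i m@(ℕ.suc _) j n@(ℕ.suc _) h = ℚ.toℚᵘ-cancel-<
    (ℚᵘ.<-respˡ-≃ (ℚᵘ.≃-sym (toℚᵘ-/ (+ i) m)) (ℚᵘ.<-respʳ-≃ (ℚᵘ.≃-sym (toℚᵘ-/ (+ j) n))
      (ℚᵘ.*<* (subst₂ ℤ._<_ (ℤ.pos-* i n) (ℤ.pos-* j m) (ℤ.+<+ h)))))

  /-* : ∀ i j m .{{_ : NonZero m}} .{{_ : NonZero (m ℕ.* m)}} →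
        (+ i / m) * (+ j / m) ≡ + (i ℕ.* j) / (m ℕ.* m)
  /-* i j m@(ℕ.suc _) = ℚ.toℚᵘ-injective
    (ℚᵘ.≃-trans (ℚ.toℚᵘ-homo-* (+ i / m) (+ j / m))
    (ℚᵘ.≃-trans (ℚᵘ.*-cong (toℚᵘ-/ (+ i) m) (toℚᵘ-/ (+ j) m))
    (ℚᵘ.≃-trans (ℚᵘ.≃-reflexive (cong (ℚᵘ._/ (m ℕ.* m)) (sym (ℤ.pos-* i j))))
    (ℚᵘ.≃-sym (toℚᵘ-/ (+ (i ℕ.* j)) (m ℕ.* m))))))

  /-+ : ∀ i j m .{{_ : NonZero m}} → + (i ℕ.+ j) / m ≡ + i / m + + j / m
  /-+ i j m@(ℕ.suc m-1) = ℚ.toℚᵘ-injective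
    (ℚᵘ.≃-trans (toℚᵘ-/ (+ (i ℕ.+ j)) m)
    (ℚᵘ.≃-trans (ℚᵘ.*≡* lemma)
    (ℚᵘ.≃-trans (ℚᵘ.≃-sym (ℚᵘ.+-cong (toℚᵘ-/ (+ i) m) (toℚᵘ-/ (+ j) m)))
    (ℚᵘ.≃-sym (ℚ.toℚᵘ-homo-+ (+ i / m) (+ j / m))))))
    where
    open ℕ-Solver
    lemma : + (i ℕ.+ j) ℤ.* + (m ℕ.* m) ≡ (+ i ℤ.* + m ℤ.+ + j ℤ.* + m) ℤ.* + m
    lemma = trans (sym (ℤ.pos-* (i ℕ.+ j) (m ℕ.* m)))
      (trans (cong +_ (solve 3 (λ i j m → (i :+ j) :* (m :* m) := (i :* m :+ j :* m) :* m) refl i j m))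
      (trans (ℤ.pos-* (i ℕ.* m ℕ.+ j ℕ.* m) m)
             (cong (ℤ._* + m) (cong₂ ℤ._+_ (ℤ.pos-* i m) (ℤ.pos-* j m)))))

  0≤/ : ∀ i m .{{_ : NonZero m}} → 0ℚ ≤ + i / m
  0≤/ i m@(ℕ.suc _) = /-mono-≤ 0 1 i m ℕ.z≤n

  0≤q⇒↥ : ∀ q → 0ℚ ≤ q → + ℤ.∣ ↥ q ∣ / ↧ₙ q ≡ q
  0≤q⇒↥ q@record{} 0≤q = trans (cong (_/ ↧ₙ q) eq) (ℚ.↥p/↧p≡p q)
    where
    eq : + ℤ.∣ ↥ q ∣ ≡ ↥ q
    eq = ℤ.0≤i⇒+∣i∣≡i (ℤ.nonNegative⁻¹ (↥ q) {{ℚ.nonNegative 0≤q}})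

  1/suc : ℕ → ℚ
  1/suc n = + 1 / ℕ.suc n

  ℚ-sqrt-nonNeg : ∀ n q → 0ℚ ≤ ℚ-sqrt n q
  ℚ-sqrt-nonNeg n q = 0≤/ (isqrt (ℤ.∣ ↥ (q ℚ.⊔ 0ℚ) ∣ ℕ.* ↧ₙ (q ℚ.⊔ 0ℚ) ℕ.* (K ℕ.* K)))
                          (↧ₙ (q ℚ.⊔ 0ℚ) ℕ.* K)
    where K = ℕ.suc n

  module _ (n : ℕ) (q : ℚ) where
    private
      q⁺ = q ℚ.⊔ 0ℚ
      p = ℤ.∣ ↥ q⁺ ∣
      d = ↧ₙ q⁺
      K = ℕ.suc n
      D = d ℕ.* K
      M = p ℕ.* d ℕ.* (K ℕ.* K)
      k = isqrt M
      q⁺≡ : + p / d ≡ q⁺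
      q⁺≡ = 0≤q⇒↥ q⁺ (ℚ.p≤q⊔p q 0ℚ)
      Md : M ℕ.* d ≡ p ℕ.* (D ℕ.* D)
      Md = solve 3 (λ p d K → p :* d :* (K :* K) :* d := p :* ((d :* K) :* (d :* K))) refl p d K
        where open ℕ-Solver

    ℚ-sqrt-≤ : ℚ-sqrt n q * ℚ-sqrt n q ≤ q⁺
    ℚ-sqrt-≤ = subst₂ _≤_ (sym (/-* k k D)) q⁺≡
      (/-mono-≤ (k ℕ.* k) (D ℕ.* D) p d
        (subst (k ℕ.* k ℕ.* d ℕ.≤_) Md (ℕ.*-monoˡ-≤ d (isqrt-≤ M))))

    private
      step : + ℕ.suc k / D ≤ ℚ-sqrt n q + 1/suc n
      step = subst (_≤ ℚ-sqrt n q + 1/suc n) (sym eq)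
        (ℚ.+-monoʳ-≤ (ℚ-sqrt n q) (/-mono-≤ 1 D 1 K (ℕ.*-monoʳ-≤ 1 (ℕ.m≤n*m K d))))
        where
        eq : + ℕ.suc k / D ≡ + k / D + + 1 / D
        eq = trans (cong (λ t → + t / D) (ℕ.+-comm 1 k)) (/-+ k 1 D)

    <-ℚ-sqrt : q⁺ < (ℚ-sqrt n q + 1/suc n) * (ℚ-sqrt n q + 1/suc n)
    <-ℚ-sqrt = ℚ.<-≤-trans
      (subst₂ _<_ q⁺≡ (sym (/-* (ℕ.suc k) (ℕ.suc k) D))
        (/-mono-< p d (ℕ.suc k ℕ.* ℕ.suc k) (D ℕ.* D)
          (subst (ℕ._< ℕ.suc k ℕ.* ℕ.suc k ℕ.* d) Md (ℕ.*-monoˡ-< d (isqrt-> M)))))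
      (*-mono-≤ 0≤k 0≤t step step)
      where
      0≤k = 0≤/ (ℕ.suc k) D
      0≤t = ℚ.≤-trans 0≤k step

  -- 1 / suc n ≤ δ for n ≥ ↧ₙ δ.
  archimedean : ∀ δ → 0ℚ < δ → Eventually λ n → 1/suc n ≤ δ
  archimedean δ@record{} 0<δ = ↧ₙ δ , λ n h →
    subst (1/suc n ≤_) (0≤q⇒↥ δ (ℚ.<⇒≤ 0<δ))
      (/-mono-≤ 1 (ℕ.suc n) ℤ.∣ ↥ δ ∣ (↧ₙ δ)
        (subst (ℕ._≤ ℤ.∣ ↥ δ ∣ ℕ.* ℕ.suc n) (sym (ℕ.*-identityˡ (↧ₙ δ)))
          (ℕ.≤-trans (ℕ.m≤n⇒m≤1+n h)
            (ℕ.m≤n*m (ℕ.suc n) ℤ.∣ ↥ δ ∣ {{ℚ.pos⇒nonZero δ {{ℚ.positive 0<δ}}}}))))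

  ⊔0-mono : ∀ a b {c} → 0ℚ ≤ c → a ≤ b + c → a ℚ.⊔ 0ℚ ≤ b ℚ.⊔ 0ℚ + c
  ⊔0-mono a b {c} 0≤c h = ℚ.⊔-lub
    (ℚ.≤-trans h (ℚ.+-monoˡ-≤ c (ℚ.p≤p⊔q b 0ℚ)))
    (ℚ.+-mono-≤ (ℚ.p≤q⊔p b 0ℚ) 0≤c)

  -- √ a ≤ √ b + √ (a - b), up to the error of the approximations.
  ℚ-sqrt-close : ∀ m n a b ε → 0ℚ < ε → a ≤ b + (½ * ε) * (½ * ε) → 1/suc n ≤ ½ * ε →
                 ℚ-sqrt m a ≤ ℚ-sqrt n b + ε
  ℚ-sqrt-close m n a b ε 0<ε h k = square-cancel-≤ 0≤t+ε
    (ℚ.≤-trans (ℚ-sqrt-≤ m a)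
    (ℚ.≤-trans (⊔0-mono a b 0≤δδ h)
    (ℚ.≤-trans (ℚ.+-monoˡ-≤ (δ * δ) (ℚ.<⇒≤ (<-ℚ-sqrt n b)))
    (ℚ.≤-trans (ℚ.+-monoˡ-≤ (δ * δ) (*-mono-≤ 0≤t+η 0≤t+δ t+η≤t+δ t+η≤t+δ))
               last))))
    where
    δ = ½ * ε
    t = ℚ-sqrt n b
    0≤δ = ℚ.<⇒≤ (half-pos 0<ε)
    0≤t = ℚ-sqrt-nonNeg n b
    0≤η = 0≤/ 1 (ℕ.suc n)
    0≤t+η = ℚ.+-mono-≤ 0≤t 0≤η
    0≤t+δ = ℚ.+-mono-≤ 0≤t 0≤δ
    0≤t+ε = ℚ.+-mono-≤ 0≤t (ℚ.<⇒≤ 0<ε)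
    t+η≤t+δ = ℚ.+-monoʳ-≤ t k
    0≤δδ : 0ℚ ≤ δ * δ
    0≤δδ = ℚ.<⇒≤ (*-pos (half-pos 0<ε) (half-pos 0<ε))
    extra : 0ℚ ≤ (t + δ) * ε
    extra = subst (_≤ (t + δ) * ε) (ℚ.*-zeroˡ 0ℚ)
      (*-mono-≤ ℚ.≤-refl (ℚ.<⇒≤ 0<ε) 0≤t+δ (ℚ.<⇒≤ 0<ε))
    last : (t + δ) * (t + δ) + δ * δ ≤ (t + ε) * (t + ε)
    last = subst₂ _≤_ (ℚ.+-identityʳ _) eq
      (ℚ.+-monoʳ-≤ ((t + δ) * (t + δ) + δ * δ) extra)
      where
      open ℚ-Solver
      eq : ((t + δ) * (t + δ) + δ * δ) + (t + δ) * ε ≡ (t + ε) * (t + ε)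
      eq = solve 2 (λ t ε → ((t :+ con ½ :* ε) :* (t :+ con ½ :* ε) :+ (con ½ :* ε) :* (con ½ :* ε))
                            :+ (t :+ con ½ :* ε) :* ε := (t :+ ε) :* (t :+ ε)) refl t ε

open SqrtLemmas

abstract
  √-cauchy : ∀ x → Cauchy (λ n → ℚ-sqrt n (seq x n))
  √-cauchy x ε 0<ε =
    let (M , p) = cauchy x ((½ * ε) * (½ * ε)) (*-pos (half-pos 0<ε) (half-pos 0<ε))
        (N , q) = archimedean (½ * ε) (half-pos 0<ε)
    in M ℕ.⊔ N , λ m n hm hn →
       let m≥M = ℕ.m⊔n≤o⇒m≤o M N hm
           n≥M = ℕ.m⊔n≤o⇒m≤o M N hn
       in dist≤ (ℚ-sqrt m (seq x m)) (ℚ-sqrt n (seq x n))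
            (ℚ-sqrt-close m n (seq x m) (seq x n) ε 0<ε
              (∣p-q∣≤r⇒p≤q+r (seq x m) (seq x n) (p m n m≥M n≥M))
              (q n (ℕ.m⊔n≤o⇒n≤o M N hn)))
            (ℚ-sqrt-close n m (seq x n) (seq x m) ε 0<ε
              (∣p-q∣≤r⇒p≤q+r (seq x n) (seq x m) (p n m n≥M m≥M))
              (q m (ℕ.m⊔n≤o⇒n≤o M N hm)))

-- √ x is the square root of max(x, 0).
√ : ℝ → ℝ
√ x = mkℝ (λ n → ℚ-sqrt n (seq x n)) (√-cauchy x)

√-nonNeg : ∀ x → 0ᴿ ≤ᴿ √ x
√-nonNeg x ε 0<ε = always λ n → ℚ.+-mono-≤ (ℚ-sqrt-nonNeg n (seq x n)) (ℚ.<⇒≤ 0<ε)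

√-square : ∀ x → 0ᴿ ≤ᴿ x → √ x *ᴿ √ x ≃ x
√-square x 0≤x ε 0<ε =
  let (B , 0<B , s≤B) = bounded (√ x)
      C = B + B + 1ℚ
      0<C = ℚ.+-mono-< (ℚ.+-mono-< 0<B 0<B) (from-yes (0ℚ ℚ.<? 1ℚ))
      (δ , 0<δ , Cδ) = scale C ε 0<C 0<ε
  in both (λ n s≤ (η≤δ , 0≤) → close n B δ 0<B Cδ s≤ η≤δ 0≤)
       s≤B (both (λ _ → _,_) (archimedean δ 0<δ) (0≤x (½ * ε) (half-pos 0<ε)))
  where
  close : ∀ n B δ → 0ℚ < B → (B + B + 1ℚ) * δ ≡ ½ * ε → ∣ seq (√ x) n ∣ ≤ B →
          1/suc n ≤ δ → 0ℚ ≤ seq x n + ½ * ε → ∣ seq (√ x) n * seq (√ x) n - seq x n ∣ ≤ ε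
  close n B δ 0<B Cδ s≤B η≤δ 0≤ = dist≤ (s * s) q
    (ℚ.≤-trans (ℚ-sqrt-≤ n q)
      (ℚ.≤-trans (ℚ.⊔-lub (ℚ.≤-trans (ℚ.≤-reflexive (sym (ℚ.+-identityʳ q))) (ℚ.+-monoʳ-≤ q 0≤½ε)) 0≤)
                 (ℚ.+-monoʳ-≤ q ½ε≤ε)))
    (ℚ.≤-trans (ℚ.p≤p⊔q q 0ℚ)
      (ℚ.≤-trans (ℚ.<⇒≤ (<-ℚ-sqrt n q))
      (ℚ.≤-trans (ℚ.≤-reflexive expand)
      (ℚ.+-monoʳ-≤ (s * s) (ℚ.≤-trans (ℚ.≤-trans error (ℚ.≤-reflexive Cδ)) ½ε≤ε)))))
    where
    q = seq x n
    s = ℚ-sqrt n q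
    η = 1/suc n
    0≤½ε = ℚ.<⇒≤ (half-pos 0<ε)
    0≤C : 0ℚ ≤ B + B + 1ℚ
    0≤C = ℚ.+-mono-≤ (ℚ.+-mono-≤ (ℚ.<⇒≤ 0<B) (ℚ.<⇒≤ 0<B)) (from-yes (0ℚ ℚ.≤? 1ℚ))
    0≤η = 0≤/ 1 (ℕ.suc n)
    s≤ : s ≤ B
    s≤ = ℚ.≤-trans (p≤∣p∣ s) s≤B
    η≤1 : η ≤ 1ℚ
    η≤1 = /-mono-≤ 1 (ℕ.suc n) 1 1 (ℕ.*-monoʳ-≤ 1 (ℕ.s≤s ℕ.z≤n))
    ½ε≤ε : ½ * ε ≤ ε
    ½ε≤ε = subst₂ _≤_ (ℚ.+-identityʳ (½ * ε)) (halves ε) (ℚ.+-monoʳ-≤ (½ * ε) 0≤½ε)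
    expand : (s + η) * (s + η) ≡ s * s + (s + s + η) * η
    expand = solve 2 (λ s η → (s :+ η) :* (s :+ η) := s :* s :+ (s :+ s :+ η) :* η) refl s η
      where open ℚ-Solver
    0≤s = ℚ-sqrt-nonNeg n q
    error : (s + s + η) * η ≤ (B + B + 1ℚ) * δ
    error = *-mono-≤ (ℚ.+-mono-≤ (ℚ.+-mono-≤ 0≤s 0≤s) 0≤η) (ℚ.≤-trans 0≤η η≤δ)
      (ℚ.+-mono-≤ (ℚ.+-mono-≤ s≤ s≤) η≤1) η≤δ

------------------------------------------------------------------------
-- Finite abelian groups

record FiniteAbelianGroup (c ℓ : Level) : Set (suc (c ⊔ ℓ)) where
  field
    abelianGroup : AbelianGroup c ℓ
    order        : ℕ
    enumeration  : Inverse (setoid (Fin order)) (AbelianGroup.setoid abelianGroup)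

infix 4 _≅_

_≅_ : ∀ {a b c d} → RawGroup a b → RawGroup c d → Set _
G ≅ H = ∃ λ f → GroupMorphisms.IsGroupIsomorphism G H f

private
  _+₄_ : Fin 4 → Fin 4 → Fin 4
  i +₄ j = (toℕ i ℕ.+ toℕ j) mod 4

  -₄_ : Fin 4 → Fin 4
  -₄ i = (4 ℕ.∸ toℕ i) mod 4

-- The integers modulo 4, in additive notation.
C₄ : AbelianGroup Level.zero Level.zero
C₄ = record
  { Carrier = Fin 4
  ; _≈_ = _≡_
  ; _∙_ = _+₄_
  ; ε = Fin.zero
  ; _⁻¹ = -₄_
  ; isAbelianGroup = record
    { isGroup = record
      { isMonoid = record
        { isSemigroup = record
          { isMagma = record { isEquivalence = isEquivalence ; ∙-cong = cong₂ _+₄_ }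
          ; assoc = from-yes (Fin.all? λ i → Fin.all? λ j → Fin.all? λ k →
              ((i +₄ j) +₄ k) Fin.≟ (i +₄ (j +₄ k)))
          }
        ; identity = from-yes (Fin.all? λ i → (Fin.zero +₄ i) Fin.≟ i)
                   , from-yes (Fin.all? λ i → (i +₄ Fin.zero) Fin.≟ i)
        }
      ; inverse = from-yes (Fin.all? λ i → ((-₄ i) +₄ i) Fin.≟ Fin.zero)
                , from-yes (Fin.all? λ i → (i +₄ (-₄ i)) Fin.≟ Fin.zero)
      ; ⁻¹-cong = cong -₄_
      }
    ; comm = from-yes (Fin.all? λ i → Fin.all? λ j → (i +₄ j) Fin.≟ (j +₄ i))
    }
  }

------------------------------------------------------------------------
-- Group rings and lattices in them

module GroupRing {c ℓ} (A : FiniteAbelianGroup c ℓ) where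

  open FiniteAbelianGroup A
  private module A = AbelianGroup abelianGroup

  open RawMonoidDefinitions A.rawMonoid using () renaming (sum to ∏; _×_ to _times_)
  open RawMonoidDefinitions ℤ.+-0-rawMonoid using () renaming (sum to ∑ᶻ)
  open RawMonoidDefinitions ℝ-Ring.+-rawMonoid using () renaming (sum to ∑)
  open import Algebra.Properties.Monoid.Sum ℝ-Ring.+-monoid using (sum-cong-≋)

  -- Since A is finite, group ring elements are functions on A.
  ℤA : Set (c ⊔ ℓ)
  ℤA = Func A.setoid (setoid ℤ)

  ℝA : Set (c ⊔ ℓ)
  ℝA = Func A.setoid ℝ-Ring.setoid

  open FuncEquality A.setoid ℝ-Ring.setoid public using () renaming (_≈_ to _≈ᵛ_)

  -- Sums and products over A are taken along the enumeration.
  element : Fin order → A.Carrier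
  element = Inverse.to enumeration

  ι : ℤA → ℝA
  ι x = record
    { to = λ a → fromℤ (x ⟨$⟩ a)
    ; cong = λ a≈b → ℝ-Ring.reflexive (cong fromℤ (Func.cong x a≈b))
    }

  infixr 7 _•_

  0ᵛ : ℝA
  0ᵛ = record { to = λ _ → 0ᴿ ; cong = λ _ → ℝ-Ring.refl {0ᴿ} }

  _•_ : ℝ → ℝA → ℝA
  r • v = record
    { to = λ a → r *ᴿ (v ⟨$⟩ a)
    ; cong = λ {a} {b} a≈b →
        *ᴿ-cong {r} {r} {v ⟨$⟩ a} {v ⟨$⟩ b} (≃-refl {r}) (Func.cong v a≈b)
    }

  ∑ᵛ : ∀ {n} → (Fin n → ℝA) → ℝA
  ∑ᵛ vs = record
    { to = λ a → ∑ λ i → vs i ⟨$⟩ a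
    ; cong = λ {a} {b} a≈b →
        sum-cong-≋ {_} {λ i → vs i ⟨$⟩ a} {λ i → vs i ⟨$⟩ b} λ i → Func.cong (vs i) a≈b
    }

  ⟨_,_⟩ : ℝA → ℝA → ℝ
  ⟨ x , y ⟩ = ∑ λ i → (x ⟨$⟩ element i) *ᴿ (y ⟨$⟩ element i)

  ∥_∥ : ℝA → ℝ
  ∥ x ∥ = √ ⟨ x , x ⟩

  π : ℝA → ℝA → ℝA
  π s v = ⟨ v , s ⟩ • s

  Span : ∀ {p} → Pred ℝA p → Pred ℝA (c ⊔ ℓ ⊔ p)
  Span Λ v = ∃ λ n → Σ (Fin n → ℝ) λ r → Σ (Fin n → ℝA) λ l →
    (∀ i → l i ∈ Λ) × v ≈ᵛ ∑ᵛ (λ i → r i • l i)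

  record FiniteSubset {p} (S : Pred ℝA p) : Set (c ⊔ ℓ ⊔ p) where
    field
      size      : ℕ
      point     : Fin size → ℝA
      point∈S   : ∀ i → point i ∈ S
      distinct  : ∀ i j → point i ≈ᵛ point j → i ≡ j
      exhausted : ∀ {s} → s ∈ S → ∃ λ i → s ≈ᵛ point i

  -- V is meant to be a linear subspace of ℝA, with the induced inner product.
  record IsEutactic {p q} (V : Pred ℝA p) (S : Pred ℝA q) : Set (c ⊔ ℓ ⊔ p ⊔ q) where
    field
      S⊆V          : S ⊆ V
      finiteSubset : FiniteSubset S
    open FiniteSubset finiteSubset
    field
      r        : Fin size → ℝ
      positive : ∀ i → 0ᴿ <ᴿ r i
      identity : ∀ {v} → v ∈ V → v ≈ᵛ ∑ᵛ (λ i → r i • π (point i) v)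

  IsMinDist : ∀ {p} → Pred ℝA p → ℝ → Set (c ⊔ ℓ ⊔ p)
  IsMinDist Λ d = (∃ λ x → x ∈ Λ × ¬ (x ≈ᵛ 0ᵛ) × ∥ x ∥ ≃ d) ×
                  (∀ {x} → x ∈ Λ → ¬ (x ≈ᵛ 0ᵛ) → d ≤ᴿ ∥ x ∥)

  -- Empty for the zero lattice, which has no minimal distance.
  MinVecs : ∀ {p} → Pred ℝA p → Pred ℝA (c ⊔ ℓ ⊔ p)
  MinVecs Λ s = s ∈ Λ × ∃ λ d → IsMinDist Λ d × ∥ s ∥ ≃ d

  IsEutacticLattice : ∀ {p q} → Pred ℝA p → Pred ℝA q → Set (c ⊔ ℓ ⊔ p ⊔ q)
  IsEutacticLattice V Λ = IsEutactic V (MinVecs Λ)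

  _^_ : A.Carrier → ℤ → A.Carrier
  a ^ (+ n)    = n times a
  a ^ -[1+ n ] = (ℕ.suc n times a) A.⁻¹

  ψ : ℤA → A.Carrier
  ψ k = ∏ λ i → element i ^ (k ⟨$⟩ element i)

  Ker-ψ : Pred ℤA ℓ
  Ker-ψ k = ψ k A.≈ A.ε

  ΔA : Pred ℤA Level.zero
  ΔA r = ∑ᶻ (λ i → r ⟨$⟩ element i) ≡ 0ℤ

  -- The image of Ker ψ ∩ ΔA under the inclusion of ℤA in ℝA.
  𝕃 : Pred ℝA (c ⊔ ℓ)
  𝕃 v = ∃ λ k → k ∈ Ker-ψ × k ∈ ΔA × v ≈ᵛ ι k

{-# OPTIONS --safe #-}
module Submission where

-- Let n = |A| ≥ 4.  The nonzero vectors of norm² less than 4 and coordinate sum 0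
-- in ℤA are the differences a − b, which are not in 𝕃(A), so the shortest vectors
-- of 𝕃(A) are the parallelograms s = a + b − c − d with ab = cd and a, b, c, d
-- distinct.  It suffices to find weights w(s) > 0 for which the off-diagonal
-- entries of M = Σ w(s) s sᵀ are one and the same negative number: as each s has
-- sum 0, M is then a positive multiple of the projection onto the vectors of sum
-- 0.  The entry of M at g ≠ h is the weight of the s with g and h on the same side
-- minus that of the s with g and h on opposite sides; for constant weights it
-- depends on whether g² = h² and on the number ρ(gh) of square roots of gh, and ρ
-- takes only the values 0 and t = ρ(1).  If all y² = 1 then the entry is already
-- constant.  Otherwise 2t ≤ n, and the weights
--   w(s) = (n − 2)(n − t + ρ(ab)) − n ([a² = c²] + [a² = d²])
-- make it constant.  They are positive for n ≥ 5, because t ≥ 4 when both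
-- brackets are 1.  For n = 4 the group is cyclic.  For n ≤ 3 the shortest vectors
-- have repeated entries, and everything is a finite computation.

open import Level using (Level; 0ℓ; _⊔_)
open import Algebra.Bundles
  using (AbelianGroup; CommutativeRing; Group; module AbelianGroup; module CommutativeRing)
import Algebra.Properties.AbelianGroup
import Algebra.Properties.CommutativeMonoid.Sum
import Algebra.Properties.CommutativeSemigroup
import Algebra.Properties.Group
import Algebra.Properties.Monoid.Mult
import Algebra.Properties.Semiring.Sum
import Algebra.Solver.CommutativeMonoid
open import Algebra.Structures using (IsAbelianGroup)
open import Data.Bool.Base using (true; false; if_then_else_)
open import Data.Fin using (#_)
open import Data.Fin.Base using (Fin; zero; suc; toℕ; _↑ˡ_; _↑ʳ_; combine; remQuot; punchOut)
open import Data.Fin.Patterns using (0F; 1F; 2F; 3F)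
import Data.Fin.Permutation as Perm
open import Data.Fin.Properties
  using (_≟_; all?; any?; ¬∀⟶∃¬; injective⇒≤; punchOut-injective; toℕ-fromℕ<; remQuot-combine)
open import Data.Integer.Base
  using (ℤ; +_; -[1+_]; 0ℤ; 1ℤ; -1ℤ; _+_; _*_; _-_; -_; _⊖_; _≤_; _<_; +≤+; +<+; -≤-;
         nonNegative; positive)
import Data.Integer.Properties as ℤ
open import Data.Integer.Tactic.RingSolver using (solve-∀)
open import Data.Nat.Base as ℕ using (ℕ)
open import Data.Nat.DivMod using (_mod_; _%_; _/_; m%n<n; m≡m%n+[m/n]*n)
import Data.Nat.Properties as ℕ
open import Data.Product.Base using (∃; _×_; _,_; proj₁; proj₂)
open import Data.Rational.Base as ℚ using (ℚ; 0ℚ; 1ℚ; ½)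
import Data.Rational.Properties as ℚ
import Data.Rational.Unnormalised.Base as ℚᵘ
import Data.Rational.Unnormalised.Properties as ℚᵘ
open import Data.Sum.Base using (_⊎_; inj₁; inj₂)
open import Data.Vec.Base using (Vec; []; _∷_; lookup; tabulate)
open import Data.Vec.Properties using (lookup∘tabulate)
open import Function.Base using (_∘_)
open import Function.Bundles using (Func; Inverse; _⟨$⟩_)
open import Relation.Binary.PropositionalEquality as ≡
  using (_≡_; _≗_; refl; sym; trans; cong; cong₂; subst; subst₂; module ≡-Reasoning)
import Relation.Binary.Reasoning.Setoid
open import Relation.Nullary using (¬_; Dec; yes; no; does; contradiction)
open import Relation.Nullary.Decidable
  using (map′; from-yes; dec-true; dec-false; ¬?; _→-dec_; _×-dec_; _⊎-dec_)
open import Relation.Unary using (_∈_)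
open import Defs

open Algebra.Properties.Semiring.Sum (CommutativeRing.semiring ℤ.+-*-commutativeRing)
  using (sum; sum-cong-≗; ∑-distrib-+; ∑-comm; ∑-permute; *-distribˡ-sum; sum-replicate-zero)
open RationalLemmas using (halves; half-pos; 0<½; scale; p≤∣p∣; ∣p-q∣≤r⇒p≤q+r)
open SqrtLemmas using (toℚᵘ-/; ℚ-sqrt-close; ℚ-sqrt-nonNeg; archimedean)
open ≡-Reasoning

-- The weights come from a linear system. Put ρ = ρ(gh) and τ = [g² = h²]. For weights x₀ + x₁ ρ(ab)
-- - x₂ ([a² = c²] + [a² = d²]) summed over ordered quadruples, the entry at g ≠ h reduces by ρ² =
-- tρ and τ² = τ to a constant plus 4(x₁(n - t) - x₀) ρ plus 8((n - 2)x₂ - x₀ - x₁t) τ. Both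
-- coefficients vanish exactly when (x₀, x₁, x₂) is proportional to ((n - 2)(n - t), n - 2, n), and
-- the constant is then -C with C = 4n(n - 2)(n - t - 2). For C₄, where n = 4 and t = 2, this is 0,
-- as it must be: the four shortest vectors span a plane, while the lattice has rank 3. Ordered
-- quadruples name each vector several times, whereas eutaxy speaks of distinct vectors, so equal
-- ones are merged and their weights added. Up to that point everything is integer arithmetic on the
-- index set of A, where equality and order are decidable; real numbers enter only in comparing
-- norms and in the final expansion, which is proved for all vectors of coordinate sum 0, among
-- which lies the span.

private variable
  n : ℕ
  ℓ ℓ′ : Level

-- Vectors with integer coordinates

δ : Fin n → Fin n → ℤ
δ i j = if does (i ≟ j) then 1ℤ else 0ℤ

δ-≡ : {i j : Fin n} → i ≡ j → δ i j ≡ 1ℤ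
δ-≡ {i = i} {j} i≡j = cong (if_then 1ℤ else 0ℤ) (dec-true (i ≟ j) i≡j)

δ-≢ : {i j : Fin n} → ¬ i ≡ j → δ i j ≡ 0ℤ
δ-≢ {i = i} {j} i≢j = cong (if_then 1ℤ else 0ℤ) (dec-false (i ≟ j) i≢j)

δ-iff : ∀ {m n} {i j : Fin m} {k l : Fin n} → (i ≡ j → k ≡ l) → (k ≡ l → i ≡ j) → δ i j ≡ δ k l
δ-iff {i = i} {j} f g with i ≟ j
... | yes i≡j = sym (δ-≡ (f i≡j))
... | no  i≢j = sym (δ-≢ (i≢j ∘ g))

δ-sym : ∀ (i j : Fin n) → δ i j ≡ δ j i
δ-sym i j = δ-iff {i = i} {j} {j} {i} sym sym

0≤δ : ∀ (i j : Fin n) → 0ℤ ≤ δ i j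
0≤δ i j with i ≟ j
... | yes _ = +≤+ ℕ.z≤n
... | no _  = ℤ.≤-refl

sum-0 : {f : Fin n → ℤ} → (∀ i → f i ≡ 0ℤ) → sum f ≡ 0ℤ
sum-0 {n} eq = trans (sum-cong-≗ eq) (sum-replicate-zero n)

sum-neg : ∀ (f : Fin n → ℤ) → sum (λ i → - f i) ≡ - sum f
sum-neg f = trans (sum-cong-≗ λ i → sym (ℤ.-1*i≡-i (f i)))
  (trans (sym (*-distribˡ-sum -1ℤ f)) (ℤ.-1*i≡-i (sum f)))

sum-- : ∀ (f g : Fin n → ℤ) → sum (λ i → f i - g i) ≡ sum f - sum g
sum-- f g = trans (∑-distrib-+ f (-_ ∘ g)) (cong (λ s → sum f + s) (sum-neg g))

sum-const : ∀ n c → sum {n} (λ _ → c) ≡ + n * c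
sum-const ℕ.zero c = sym (ℤ.*-zeroˡ c)
sum-const (ℕ.suc n) c = trans (cong (λ s → c + s) (sum-const n c)) (sym (ℤ.suc-* (+ n) c))

sum-δ : ∀ a (f : Fin n → ℤ) → sum (λ i → δ a i * f i) ≡ f a
sum-δ zero f = trans (cong₂ _+_ (ℤ.*-identityˡ (f zero)) (sum-0 λ i → ℤ.*-zeroˡ (f (suc i))))
  (ℤ.+-identityʳ (f zero))
sum-δ (suc a) f = trans (cong₂ _+_ (ℤ.*-zeroˡ (f zero)) (sum-δ a (f ∘ suc)))
  (ℤ.+-identityˡ (f (suc a)))

sum-δ′ : ∀ a (f : Fin n → ℤ) → sum (λ i → δ i a * f i) ≡ f a
sum-δ′ a f = trans (sum-cong-≗ λ i → cong (_* f i) (δ-sym i a)) (sum-δ a f)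

sum-δ-1 : ∀ (a : Fin n) → sum (δ a) ≡ 1ℤ
sum-δ-1 a = trans (sum-cong-≗ λ i → sym (ℤ.*-identityʳ (δ a i))) (sum-δ a (λ _ → 1ℤ))

sum-≤ : {f g : Fin n → ℤ} → (∀ i → f i ≤ g i) → sum f ≤ sum g
sum-≤ {ℕ.zero}  f≤g = ℤ.≤-refl
sum-≤ {ℕ.suc n} f≤g = ℤ.+-mono-≤ (f≤g zero) (sum-≤ (f≤g ∘ suc))

0≤sum : {f : Fin n → ℤ} → (∀ i → 0ℤ ≤ f i) → 0ℤ ≤ sum f
0≤sum {n} {f} 0≤f = subst (_≤ sum f) (sum-replicate-zero n) (sum-≤ 0≤f)

term≤sum : {f : Fin n → ℤ} → (∀ i → 0ℤ ≤ f i) → ∀ i → f i ≤ sum f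
term≤sum {f = f} 0≤f i = subst (_≤ sum f) (sum-δ i f) (sum-≤ le)
  where
  le : ∀ j → δ i j * f j ≤ f j
  le j with i ≟ j
  ... | yes _ = ℤ.≤-reflexive (ℤ.*-identityˡ (f j))
  ... | no _  = subst (_≤ f j) (sym (ℤ.*-zeroˡ (f j))) (0≤f j)

0≤sum≡0⇒0 : {f : Fin n → ℤ} → (∀ i → 0ℤ ≤ f i) → sum f ≤ 0ℤ → ∀ i → f i ≡ 0ℤ
0≤sum≡0⇒0 0≤f s≤0 i = ℤ.≤-antisym (ℤ.≤-trans (term≤sum 0≤f i) s≤0) (0≤f i)

⟪_,_⟫ : (Fin n → ℤ) → (Fin n → ℤ) → ℤ
⟪ k , l ⟫ = sum λ i → k i * l i

normSq : (Fin n → ℤ) → ℤ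
normSq k = ⟪ k , k ⟫

0≤i*i : ∀ i → 0ℤ ≤ i * i
0≤i*i (+ i) = subst (0ℤ ≤_) (ℤ.pos-* i i) (+≤+ ℕ.z≤n)
0≤i*i -[1+ i ] = +≤+ ℕ.z≤n

i*i≡0⇒i≡0 : ∀ i → i * i ≡ 0ℤ → i ≡ 0ℤ
i*i≡0⇒i≡0 i eq with ℤ.i*j≡0⇒i≡0∨j≡0 i eq
... | inj₁ p = p
... | inj₂ p = p

0≤normSq : ∀ (k : Fin n → ℤ) → 0ℤ ≤ normSq k
0≤normSq k = 0≤sum λ i → 0≤i*i (k i)

normSq-cong : {k l : Fin n → ℤ} → k ≗ l → normSq k ≡ normSq l
normSq-cong k≗l = sum-cong-≗ λ i → cong₂ _*_ (k≗l i) (k≗l i)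

normSq≤0⇒0 : ∀ {k : Fin n → ℤ} → normSq k ≤ 0ℤ → ∀ i → k i ≡ 0ℤ
normSq≤0⇒0 {k = k} le i = i*i≡0⇒i≡0 (k i) (0≤sum≡0⇒0 (λ i → 0≤i*i (k i)) le i)

-- The vector a + b − c − d, which lies in 𝕃 if and only if a b = c d.
quad : Fin n → Fin n → Fin n → Fin n → Fin n → ℤ
quad a b c d i = δ a i + δ b i - δ c i - δ d i

⟪quad,⟫ : ∀ (a b c d : Fin n) f → ⟪ quad a b c d , f ⟫ ≡ f a + f b - f c - f d
⟪quad,⟫ a b c d f = begin
  sum (λ i → quad a b c d i * f i)
    ≡⟨ sum-cong-≗ (λ i → expand (δ a i) (δ b i) (δ c i) (δ d i) (f i)) ⟩
  sum (λ i → δ a i * f i + δ b i * f i - δ c i * f i - δ d i * f i)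
    ≡⟨ trans (sum-- (λ i → δ a i * f i + δ b i * f i - δ c i * f i) (λ i → δ d i * f i))
         (cong (_- _) (trans (sum-- (λ i → δ a i * f i + δ b i * f i) (λ i → δ c i * f i))
           (cong (_- _) (∑-distrib-+ (λ i → δ a i * f i) (λ i → δ b i * f i))))) ⟩
  sum (λ i → δ a i * f i) + sum (λ i → δ b i * f i) - sum (λ i → δ c i * f i) - sum (λ i → δ d i * f i)
    ≡⟨ cong₂ _-_ (cong₂ _-_ (cong₂ _+_ (sum-δ a f) (sum-δ b f)) (sum-δ c f)) (sum-δ d f) ⟩
  f a + f b - f c - f d ∎
  where
  expand : ∀ x y z w u → (x + y - z - w) * u ≡ x * u + y * u - z * u - w * u
  expand = solve-∀

⟪⟫-sym : ∀ (k l : Fin n → ℤ) → ⟪ k , l ⟫ ≡ ⟪ l , k ⟫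
⟪⟫-sym k l = sum-cong-≗ λ i → ℤ.*-comm (k i) (l i)

sum-quad : ∀ (a b c d : Fin n) → sum (quad a b c d) ≡ 0ℤ
sum-quad a b c d = trans (sum-cong-≗ λ i → sym (ℤ.*-identityʳ (quad a b c d i)))
  (⟪quad,⟫ a b c d (λ _ → 1ℤ))

normSq-quad : ∀ {a b c d : Fin n} → ¬ a ≡ b → ¬ c ≡ d → ¬ a ≡ c → ¬ a ≡ d → ¬ b ≡ c → ¬ b ≡ d →
              normSq (quad a b c d) ≡ + 4
normSq-quad {a = a} {b} {c} {d} a≢b c≢d a≢c a≢d b≢c b≢d =
  trans (⟪quad,⟫ a b c d (quad a b c d)) (cong₂ _-_ (cong₂ _-_ (cong₂ _+_
    (eval (δ-≡ {i = a} refl) (δ-≢ (a≢b ∘ sym)) (δ-≢ (a≢c ∘ sym)) (δ-≢ (a≢d ∘ sym)))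
    (eval (δ-≢ a≢b) (δ-≡ {i = b} refl) (δ-≢ (b≢c ∘ sym)) (δ-≢ (b≢d ∘ sym))))
    (eval (δ-≢ a≢c) (δ-≢ b≢c) (δ-≡ {i = c} refl) (δ-≢ (c≢d ∘ sym))))
    (eval (δ-≢ a≢d) (δ-≢ b≢d) (δ-≢ c≢d) (δ-≡ {i = d} refl)))
  where
  eval : ∀ {x y z w x′ y′ z′ w′} → x ≡ x′ → y ≡ y′ → z ≡ z′ → w ≡ w′ →
         x + y - z - w ≡ x′ + y′ - z′ - w′
  eval refl refl refl refl = refl

positive-entry : ∀ (k : Fin n → ℤ) → sum k ≡ 0ℤ → ¬ (∀ i → k i ≡ 0ℤ) → ∃ λ a → 1ℤ ≤ k a
positive-entry {n} k Σk≡0 k≢0 with any? (λ i → 1ℤ ℤ.≤? k i)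
... | yes p = p
... | no ¬p = contradiction k≡0 k≢0
  where
  k≤0 : ∀ i → k i ≤ 0ℤ
  k≤0 i = ℤ.≮⇒≥ λ 0<k → ¬p (i , ℤ.i<j⇒suc[i]≤j 0<k)
  k≡0 : ∀ i → k i ≡ 0ℤ
  k≡0 i = ℤ.neg-injective (0≤sum≡0⇒0 {f = λ j → - k j} (λ j → ℤ.neg-mono-≤ (k≤0 j))
    (ℤ.≤-reflexive (trans (sum-neg k) (cong -_ Σk≡0))) i)

negative-entry : ∀ (k : Fin n → ℤ) → sum k ≡ 0ℤ → ¬ (∀ i → k i ≡ 0ℤ) → ∃ λ c → k c ≤ -1ℤ
negative-entry k Σk≡0 k≢0 =
  let (c , 1≤-k) = positive-entry (λ i → - k i) (trans (sum-neg k) (cong -_ Σk≡0))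
                     (λ -k≡0 → k≢0 λ i → ℤ.neg-injective (-k≡0 i))
  in c , subst (_≤ -1ℤ) (ℤ.neg-involutive (k c)) (ℤ.neg-mono-≤ 1≤-k)

-- Descent on integer vectors of sum zero

record Step (k : Fin n → ℤ) : Set where
  field
    a c   : Fin n
    a≢c   : ¬ a ≡ c
    1≤ka  : 1ℤ ≤ k a
    kc≤-1 : k c ≤ -1ℤ
    rest  : Fin n → ℤ
    split : ∀ i → k i ≡ rest i + (δ a i - δ c i)
    Σrest : sum rest ≡ 0ℤ
    drop  : normSq rest + + 2 ≤ normSq k

-- Subtracting e_a - e_c changes the squared norm by 2 - 2(k_a - k_c). Since k_a ≥ 1 and k_c ≤ -1,
-- this is at most -2.
step : ∀ (k : Fin n → ℤ) → sum k ≡ 0ℤ → ¬ (∀ i → k i ≡ 0ℤ) → Step k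
step {n} k Σk≡0 k≢0 = record
  { a = a ; c = c ; a≢c = a≢c ; 1≤ka = 1≤ka ; kc≤-1 = kc≤-1
  ; rest = rest
  ; split = λ i → split (k i) (δ a i) (δ c i)
  ; Σrest = trans Σrest (cong₂ _-_ Σk≡0
      (trans (sum-- (δ a) (δ c)) (cong₂ _-_ (sum-δ-1 a) (sum-δ-1 c))))
  ; drop = drop
  }
  where
  a = proj₁ (positive-entry k Σk≡0 k≢0)
  1≤ka = proj₂ (positive-entry k Σk≡0 k≢0)
  c = proj₁ (negative-entry k Σk≡0 k≢0)
  kc≤-1 = proj₂ (negative-entry k Σk≡0 k≢0)
  a≢c : ¬ a ≡ c
  a≢c a≡c = contradiction (ℤ.≤-trans 1≤ka (subst (λ i → k i ≤ -1ℤ) (sym a≡c) kc≤-1)) λ ()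
  rest : Fin n → ℤ
  rest i = k i - (δ a i - δ c i)
  split : ∀ x y z → x ≡ x - (y - z) + (y - z)
  split = solve-∀
  Σrest = sum-- k (λ i → δ a i - δ c i)
  ⟪rest,⟫ : ∀ f → ⟪ rest , f ⟫ ≡ ⟪ k , f ⟫ - (f a - f c)
  ⟪rest,⟫ f = begin
    sum (λ i → rest i * f i)                             ≡⟨ sum-cong-≗ (λ i → expand (k i) (δ a i) (δ c i) (f i)) ⟩
    sum (λ i → k i * f i - (δ a i * f i - δ c i * f i))  ≡⟨ sum-- (λ i → k i * f i) _ ⟩
    ⟪ k , f ⟫ - sum (λ i → δ a i * f i - δ c i * f i)    ≡⟨ cong (λ s → ⟪ k , f ⟫ - s) (sum-- (λ i → δ a i * f i) _) ⟩
    ⟪ k , f ⟫ - (sum (λ i → δ a i * f i) - sum (λ i → δ c i * f i))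
      ≡⟨ cong (λ s → ⟪ k , f ⟫ - s) (cong₂ _-_ (sum-δ a f) (sum-δ c f)) ⟩
    ⟪ k , f ⟫ - (f a - f c)                              ∎
    where
    expand : ∀ x y z u → (x - (y - z)) * u ≡ x * u - (y * u - z * u)
    expand = solve-∀
  norm : normSq rest + + 2 ≡ normSq k + (1ℤ - k a + (1ℤ - k a) + (k c + 1ℤ + (k c + 1ℤ)))
  norm = begin
    ⟪ rest , rest ⟫ + + 2
      ≡⟨ cong (_+ + 2) (⟪rest,⟫ rest) ⟩
    ⟪ k , rest ⟫ - (rest a - rest c) + + 2
      ≡⟨ cong₂ (λ s t → s - t + + 2) (trans (⟪⟫-sym k rest) (⟪rest,⟫ k))
           (cong₂ (λ s t → k a - s - (k c - t))
             (cong₂ _-_ (δ-≡ {i = a} refl) (δ-≢ (a≢c ∘ sym)))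
             (cong₂ _-_ (δ-≢ a≢c) (δ-≡ {i = c} refl))) ⟩
    normSq k - (k a - k c) - (k a - (1ℤ - 0ℤ) - (k c - (0ℤ - 1ℤ))) + + 2
      ≡⟨ collect (normSq k) (k a) (k c) ⟩
    normSq k + (1ℤ - k a + (1ℤ - k a) + (k c + 1ℤ + (k c + 1ℤ))) ∎
    where
    collect : ∀ N x y → N - (x - y) - (x - (1ℤ - 0ℤ) - (y - (0ℤ - 1ℤ))) + + 2 ≡
                        N + (1ℤ - x + (1ℤ - x) + (y + 1ℤ + (y + 1ℤ)))
    collect = solve-∀
  drop : normSq rest + + 2 ≤ normSq k
  drop = subst₂ _≤_ (sym norm) (ℤ.+-identityʳ (normSq k)) (ℤ.+-monoʳ-≤ (normSq k)
    (ℤ.+-mono-≤ (ℤ.+-mono-≤ 1-ka≤0 1-ka≤0) (ℤ.+-mono-≤ kc+1≤0 kc+1≤0)))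
    where
    1-ka≤0 : 1ℤ - k a ≤ 0ℤ
    1-ka≤0 = ℤ.i≤j⇒i-j≤0 1≤ka
    kc+1≤0 : k c + 1ℤ ≤ 0ℤ
    kc+1≤0 = ℤ.+-monoˡ-≤ 1ℤ kc≤-1

two-entries≤normSq : ∀ (v : Fin n → ℤ) {k l} → ¬ k ≡ l → v k * v k + v l * v l ≤ normSq v
two-entries≤normSq v {k} {l} k≢l = subst (_≤ normSq v)
  (trans (∑-distrib-+ (λ i → δ k i * (v i * v i)) _)
    (cong₂ _+_ (sum-δ k λ i → v i * v i) (sum-δ l λ i → v i * v i)))
  (sum-≤ le)
  where
  le : ∀ i → δ k i * (v i * v i) + δ l i * (v i * v i) ≤ v i * v i
  le i with k ≟ i | l ≟ i
  ... | yes refl | yes refl = contradiction refl k≢l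
  ... | yes _ | no _  = ℤ.≤-reflexive (trans (ℤ.+-identityʳ _) (ℤ.*-identityˡ (v i * v i)))
  ... | no _  | yes _ = ℤ.≤-reflexive (trans (ℤ.+-identityˡ _) (ℤ.*-identityˡ (v i * v i)))
  ... | no _  | no _  = 0≤i*i (v i)

-- The distinct vectors among those of positive weight, each with its total weight.

record Distinct {m} (w : Fin m → ℤ) (k : Fin m → Fin n → ℤ) : Set where
  field
    size     : ℕ
    weight   : Fin size → ℤ
    point    : Fin size → Fin n → ℤ
    0<weight : ∀ i → 0ℤ < weight i
    origin   : ∀ i → ∃ λ j → 0ℤ < w j × point i ≗ k j
    distinct : ∀ i j → point i ≗ point j → i ≡ j
    covers   : ∀ j → 0ℤ < w j → ∃ λ i → k j ≗ point i
    kernel   : ∀ g h → sum (λ i → weight i * (point i g * point i h)) ≡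
                       sum (λ j → w j * (k j g * k j h))

private
  add : ∀ {m} → Fin m → ℤ → (Fin m → ℤ) → Fin m → ℤ
  add i x f j = f j + δ i j * x

  sum-add : ∀ {m} (i : Fin m) x f (F : Fin m → ℤ) →
            sum (λ j → add i x f j * F j) ≡ x * F i + sum (λ j → f j * F j)
  sum-add i x f F = begin
    sum (λ j → add i x f j * F j)                          ≡⟨ sum-cong-≗ (λ j → expand (f j) (δ i j) x (F j)) ⟩
    sum (λ j → δ i j * (x * F j) + f j * F j)              ≡⟨ ∑-distrib-+ (λ j → δ i j * (x * F j)) _ ⟩
    sum (λ j → δ i j * (x * F j)) + sum (λ j → f j * F j)  ≡⟨ cong (_+ _) (sum-δ i λ j → x * F j) ⟩
    x * F i + sum (λ j → f j * F j)                        ∎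
    where
    expand : ∀ f d x F → (f + d * x) * F ≡ d * (x * F) + f * F
    expand = solve-∀

-- Adding up the weights of equal vectors leaves Σ w k kᵀ unchanged. Vectors of weight 0 are
-- dropped, so every vector that remains has a positive coefficient.
distinct-points : ∀ {m} (w : Fin m → ℤ) (k : Fin m → Fin n → ℤ) →
                  (∀ j → w j ≡ 0ℤ ⊎ 0ℤ < w j) → Distinct w k
distinct-points {m = ℕ.zero} w k w≥0 = record
  { size = 0 ; weight = λ () ; point = λ () ; 0<weight = λ () ; origin = λ ()
  ; distinct = λ () ; covers = λ () ; kernel = λ _ _ → refl }
distinct-points {n} {m = ℕ.suc m} w k w≥0 = extend (w≥0 zero)
  where
  open Distinct (distinct-points (w ∘ suc) (k ∘ suc) (w≥0 ∘ suc))
  origin′ : ∀ i → ∃ λ j → 0ℤ < w j × point i ≗ k j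
  origin′ i = let (j , 0<w , eq) = origin i in suc j , 0<w , eq
  extend : w zero ≡ 0ℤ ⊎ 0ℤ < w zero → Distinct w k
  extend (inj₁ w₀≡0) = record
    { size = size ; weight = weight ; point = point ; 0<weight = 0<weight
    ; origin = origin′
    ; distinct = distinct
    ; covers = λ { zero 0<w → contradiction 0<w (ℤ.<-irrefl (sym w₀≡0)) ; (suc j) 0<w → covers j 0<w }
    ; kernel = λ g h → trans (kernel g h) (trans (sym (ℤ.+-identityˡ _))
        (cong (λ x → x * (k zero g * k zero h) + sum (λ j → w (suc j) * (k (suc j) g * k (suc j) h)))
              (sym w₀≡0)))
    }
  extend (inj₂ 0<w₀) with any? (λ i → all? λ g → k zero g ℤ.≟ point i g)
  ... | yes (i , k≗p) = record
    { size = size ; weight = add i (w zero) weight ; point = point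
    ; 0<weight = λ j → ℤ.+-mono-<-≤ (0<weight j) (subst (_≤ δ i j * w zero) (ℤ.*-zeroˡ (w zero))
          (ℤ.*-monoʳ-≤-nonNeg (w zero) {{nonNegative (ℤ.<⇒≤ 0<w₀)}} (0≤δ i j)))
    ; origin = origin′
    ; distinct = distinct
    ; covers = λ { zero _ → i , k≗p ; (suc j) 0<w → covers j 0<w }
    ; kernel = λ g h → trans (sum-add i (w zero) weight (λ j → point j g * point j h))
        (cong₂ _+_ (cong (w zero *_) (cong₂ _*_ (sym (k≗p g)) (sym (k≗p h)))) (kernel g h))
    }
  ... | no new = record
    { size = ℕ.suc size ; weight = weight′ ; point = point′
    ; 0<weight = λ { zero → 0<w₀ ; (suc j) → 0<weight j }
    ; origin = λ { zero → zero , 0<w₀ , (λ _ → refl) ; (suc i) → origin′ i }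
    ; distinct = distinct′
    ; covers = λ { zero _ → zero , (λ _ → refl)
                 ; (suc j) 0<w → let (i , eq) = covers j 0<w in suc i , eq }
    ; kernel = λ g h → cong (λ s → w zero * (k zero g * k zero h) + s) (kernel g h)
    }
    where
    weight′ : Fin (ℕ.suc size) → ℤ
    weight′ zero    = w zero
    weight′ (suc i) = weight i
    point′ : Fin (ℕ.suc size) → Fin n → ℤ
    point′ zero    = k zero
    point′ (suc i) = point i
    distinct′ : ∀ i j → point′ i ≗ point′ j → i ≡ j
    distinct′ zero    zero    _  = refl
    distinct′ zero    (suc j) eq = contradiction (j , eq) new
    distinct′ (suc i) zero    eq = contradiction (i , sym ∘ eq) new
    distinct′ (suc i) (suc j) eq = cong suc (distinct i j eq)

-- Sums over quadruples

sum-↑ : ∀ m {n} (f : Fin (m ℕ.+ n) → ℤ) →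
        sum f ≡ sum (λ i → f (i ↑ˡ n)) + sum (λ j → f (m ↑ʳ j))
sum-↑ ℕ.zero    f = sym (ℤ.+-identityˡ _)
sum-↑ (ℕ.suc m) f = trans (cong (λ s → f zero + s) (sum-↑ m (f ∘ suc))) (sym (ℤ.+-assoc (f zero) _ _))

sum-combine : ∀ m {n} (f : Fin (m ℕ.* n) → ℤ) → sum f ≡ sum (λ i → sum λ j → f (combine {m} {n} i j))
sum-combine ℕ.zero        f = refl
sum-combine (ℕ.suc m) {n} f = trans (sum-↑ n f) (cong (λ s → sum (λ j → f (j ↑ˡ (m ℕ.* n))) + s) (sum-combine m _))

sum⁴ : (Fin n → Fin n → Fin n → Fin n → ℤ) → ℤ
sum⁴ f = sum λ a → sum λ b → sum λ c → sum λ d → f a b c d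

private
  sum³ : (Fin n → Fin n → Fin n → ℤ) → ℤ
  sum³ f = sum λ a → sum λ b → sum λ c → f a b c

  sum³-cong : {f g : Fin n → Fin n → Fin n → ℤ} → (∀ a b c → f a b c ≡ g a b c) → sum³ f ≡ sum³ g
  sum³-cong eq = sum-cong-≗ λ a → sum-cong-≗ λ b → sum-cong-≗ λ c → eq a b c

  sum³-- : ∀ (f g : Fin n → Fin n → Fin n → ℤ) → sum³ (λ a b c → f a b c - g a b c) ≡ sum³ f - sum³ g
  sum³-- f g = trans (sum-cong-≗ λ a → trans (sum-cong-≗ λ b → sum-- (f a b) (g a b))
    (sum-- (λ b → sum (f a b)) _)) (sum-- (λ a → sum λ b → sum (f a b)) _)

  *-distribˡ-sum² : ∀ x (f : Fin n → Fin n → ℤ) →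
                    sum (λ a → sum λ b → x * f a b) ≡ x * sum (λ a → sum (f a))
  *-distribˡ-sum² x f = trans (sum-cong-≗ λ a → sym (*-distribˡ-sum x (f a)))
    (sym (*-distribˡ-sum x (λ a → sum (f a))))

  sum³-δ₁ : ∀ g (f : Fin n → Fin n → Fin n → ℤ) →
            sum³ (λ a b c → δ a g * f a b c) ≡ sum (λ b → sum λ c → f g b c)
  sum³-δ₁ g f = trans (sum-cong-≗ λ a → *-distribˡ-sum² (δ a g) (f a))
    (sum-δ′ g (λ a → sum λ b → sum λ c → f a b c))

  sum³-δ₂ : ∀ g (f : Fin n → Fin n → Fin n → ℤ) →
            sum³ (λ a b c → δ b g * f a b c) ≡ sum (λ a → sum λ c → f a g c)
  sum³-δ₂ g f = sum-cong-≗ λ a →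
    trans (sum-cong-≗ λ b → sym (*-distribˡ-sum (δ b g) (f a b))) (sum-δ′ g (λ b → sum (f a b)))

  sum³-δ₃ : ∀ g (f : Fin n → Fin n → Fin n → ℤ) →
            sum³ (λ a b c → δ c g * f a b c) ≡ sum (λ a → sum λ b → f a b g)
  sum³-δ₃ g f = sum-cong-≗ λ a → sum-cong-≗ λ b → sum-δ′ g (f a b)

  sum⁴-cong : {f g : Fin n → Fin n → Fin n → Fin n → ℤ} →
              (∀ a b c d → f a b c d ≡ g a b c d) → sum⁴ f ≡ sum⁴ g
  sum⁴-cong eq = sum-cong-≗ λ a → sum³-cong (eq a)

  sum⁴-- : ∀ (f g : Fin n → Fin n → Fin n → Fin n → ℤ) →
           sum⁴ (λ a b c d → f a b c d - g a b c d) ≡ sum⁴ f - sum⁴ g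
  sum⁴-- f g = trans (sum-cong-≗ λ a → sum³-- (f a) (g a)) (sum-- (λ a → sum³ (f a)) _)

  sum⁴-+ : ∀ (f g : Fin n → Fin n → Fin n → Fin n → ℤ) →
           sum⁴ (λ a b c d → f a b c d + g a b c d) ≡ sum⁴ f + sum⁴ g
  sum⁴-+ f g = trans (sum-cong-≗ λ a → trans (sum-cong-≗ λ b → trans (sum-cong-≗ λ c →
    ∑-distrib-+ (f a b c) (g a b c)) (∑-distrib-+ (λ c → sum (f a b c)) _))
    (∑-distrib-+ (λ b → sum λ c → sum (f a b c)) _)) (∑-distrib-+ (λ a → sum³ (f a)) _)

  sum⁴-δ₁ : ∀ g (f : Fin n → Fin n → Fin n → Fin n → ℤ) →
            sum⁴ (λ a b c d → δ a g * f a b c d) ≡ sum³ (f g)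
  sum⁴-δ₁ g f = trans (sum-cong-≗ λ a →
      trans (sum-cong-≗ λ b → *-distribˡ-sum² (δ a g) (f a b))
        (sym (*-distribˡ-sum (δ a g) (λ b → sum λ c → sum (f a b c)))))
    (sum-δ′ g (λ a → sum³ (f a)))

  sum⁴-swap : ∀ (f : Fin n → Fin n → Fin n → Fin n → ℤ) → sum⁴ f ≡ sum⁴ (λ a b c d → f b a c d)
  sum⁴-swap f = ∑-comm λ a b → sum λ c → sum (f a b c)

  sum⁴-rotate : ∀ (f : Fin n → Fin n → Fin n → Fin n → ℤ) → sum⁴ f ≡ sum⁴ (λ a b c d → f c d a b)
  sum⁴-rotate f = begin
    (sum λ a → sum λ b → sum λ c → sum λ d → f a b c d)
      ≡⟨ (sum-cong-≗ λ a → ∑-comm λ b c → sum λ d → f a b c d) ⟩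
    (sum λ a → sum λ c → sum λ b → sum λ d → f a b c d)
      ≡⟨ (∑-comm λ a c → sum λ b → sum λ d → f a b c d) ⟩
    (sum λ c → sum λ a → sum λ b → sum λ d → f a b c d)
      ≡⟨ (sum-cong-≗ λ c → sum-cong-≗ λ a → ∑-comm λ b d → f a b c d) ⟩
    (sum λ c → sum λ a → sum λ d → sum λ b → f a b c d)
      ≡⟨ (sum-cong-≗ λ c → ∑-comm λ a d → sum λ b → f a b c d) ⟩
    (sum λ c → sum λ d → sum λ a → sum λ b → f a b c d) ∎

-- An off-diagonal entry as same-side weight minus opposite-side weight

module _ (W : Fin n → Fin n → Fin n → Fin n → ℤ)
  (W-swapˡ  : ∀ a b c d → W b a c d ≡ W a b c d)
  (W-swapʳ  : ∀ a b c d → W a b d c ≡ W a b c d)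
  (W-rotate : ∀ a b c d → W c d a b ≡ W a b c d)
  {g h : Fin n} (g≢h : ¬ g ≡ h) where

  private
    F : Fin n → Fin n → Fin n → Fin n → ℤ
    F a b c d = W a b c d * quad a b c d h

    F-swapˡ : ∀ a b c d → F b a c d ≡ F a b c d
    F-swapˡ a b c d = cong₂ _*_ (W-swapˡ a b c d)
      (cong (λ s → s - δ c h - δ d h) (ℤ.+-comm (δ b h) (δ a h)))

    F-rotate : ∀ a b c d → F c d a b ≡ - F a b c d
    F-rotate a b c d = trans (cong (_* quad c d a b h) (W-rotate a b c d))
      (negate (W a b c d) (δ a h) (δ b h) (δ c h) (δ d h))
      where
      negate : ∀ w a b c d → w * (c + d - a - b) ≡ - (w * (a + b - c - d))
      negate = solve-∀

    S₁ = sum⁴ λ a b c d → δ a g * F a b c d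
    S₂ = sum⁴ λ a b c d → δ b g * F a b c d

    S₂≡S₁ : S₂ ≡ S₁
    S₂≡S₁ = trans (sum⁴-swap λ a b c d → δ b g * F a b c d)
      (sum⁴-cong λ a b c d → cong (δ a g *_) (F-swapˡ a b c d))

    S₃≡-S₁ : sum⁴ (λ a b c d → δ c g * F a b c d) ≡ - S₁
    S₃≡-S₁ = trans (sum⁴-rotate λ a b c d → δ c g * F a b c d)
      (trans (sum⁴-cong λ a b c d → trans (cong (δ a g *_) (F-rotate a b c d)) (neg (δ a g) (F a b c d)))
      (trans (sum⁴-- (λ _ _ _ _ → 0ℤ) (λ a b c d → δ a g * F a b c d))
        (trans (cong (_- S₁) zero⁴) (ℤ.+-identityˡ (- S₁)))))
      where
      neg : ∀ x y → x * - y ≡ 0ℤ - x * y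
      neg = solve-∀
      zero⁴ : sum⁴ {n} (λ _ _ _ _ → 0ℤ) ≡ 0ℤ
      zero⁴ = sum-0 {n} λ _ → sum-0 {n} λ _ → sum-0 {n} λ _ → sum-0 {n} λ _ → refl

    S₄≡-S₁ : sum⁴ (λ a b c d → δ d g * F a b c d) ≡ - S₁
    S₄≡-S₁ = trans (sum⁴-rotate λ a b c d → δ d g * F a b c d)
      (trans (sum⁴-swap λ a b c d → δ b g * F c d a b)
      (trans (sum⁴-cong λ a b c d → cong (δ a g *_) (trans (F-rotate b a c d)
                (trans (cong -_ (F-swapˡ a b c d)) (sym (F-rotate a b c d)))))
      (trans (sym (sum⁴-rotate λ a b c d → δ c g * F a b c d)) S₃≡-S₁)))

    same opposite : ℤ
    same     = sum λ c → sum λ d → W g h c d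
    opposite = sum λ b → sum λ d → W g b h d

    S₁≡ : S₁ ≡ same - opposite - opposite
    S₁≡ = begin
      S₁                                                    ≡⟨ sum⁴-δ₁ g F ⟩
      sum³ (F g)                                            ≡⟨ sum³-cong (λ b c d → trans
        (cong (λ t → W g b c d * (t + δ b h - δ c h - δ d h)) (δ-≢ g≢h))
        (expand (W g b c d) (δ b h) (δ c h) (δ d h))) ⟩
      sum³ (λ b c d → δ b h * W g b c d - δ c h * W g b c d - δ d h * W g b c d)
        ≡⟨ trans (sum³-- (λ b c d → δ b h * W g b c d - δ c h * W g b c d) _)
             (cong (_- sum³ (λ b c d → δ d h * W g b c d)) (sum³-- (λ b c d → δ b h * W g b c d) _)) ⟩
      sum³ (λ b c d → δ b h * W g b c d) - sum³ (λ b c d → δ c h * W g b c d)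
        - sum³ (λ b c d → δ d h * W g b c d)
        ≡⟨ cong₂ _-_ (cong₂ _-_ (sum³-δ₁ h (W g)) (sum³-δ₂ h (W g)))
             (trans (sum³-δ₃ h (W g)) (sum-cong-≗ λ b → sum-cong-≗ λ c → W-swapʳ g b h c)) ⟩
      same - opposite - opposite                            ∎
      where
      expand : ∀ w b c d → w * (0ℤ + b - c - d) ≡ b * w - c * w - d * w
      expand = solve-∀

  -- By the symmetries of `W`, each of the four positions in which g can stand contributes the same
  -- amount, hence the factor 4. Once a = g ≠ h, the entry at h is 1 if b = h and -1 if c = h or d =
  -- h, and the last two cases carry equal weight.
  quad-kernel : sum⁴ (λ a b c d → W a b c d * (quad a b c d g * quad a b c d h)) ≡
                + 4 * (sum (λ c → sum λ d → W g h c d) - + 2 * sum (λ b → sum λ d → W g b h d))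
  quad-kernel = begin
    sum⁴ (λ a b c d → W a b c d * (quad a b c d g * quad a b c d h))
      ≡⟨ sum⁴-cong (λ a b c d → expand (W a b c d) (δ a g) (δ b g) (δ c g) (δ d g) (quad a b c d h)) ⟩
    sum⁴ (λ a b c d → δ a g * F a b c d + δ b g * F a b c d - δ c g * F a b c d - δ d g * F a b c d)
      ≡⟨ trans (sum⁴-- (λ a b c d → δ a g * F a b c d + δ b g * F a b c d - δ c g * F a b c d) _)
          (cong₂ _-_ (trans (sum⁴-- (λ a b c d → δ a g * F a b c d + δ b g * F a b c d) _)
            (cong₂ _-_ (trans (sum⁴-+ (λ a b c d → δ a g * F a b c d) _) (cong (λ s → S₁ + s) S₂≡S₁))
              S₃≡-S₁)) S₄≡-S₁) ⟩
    S₁ + S₁ - - S₁ - - S₁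
      ≡⟨ cong (λ s → s + s - - s - - s) S₁≡ ⟩
    same - opposite - opposite + (same - opposite - opposite)
      - - (same - opposite - opposite) - - (same - opposite - opposite)
      ≡⟨ collect same opposite ⟩
    + 4 * (same - + 2 * opposite) ∎
    where
    expand : ∀ w a b c d q → w * ((a + b - c - d) * q) ≡ a * (w * q) + b * (w * q) - c * (w * q) - d * (w * q)
    expand = solve-∀
    collect : ∀ s o → s - o - o + (s - o - o) - - (s - o - o) - - (s - o - o) ≡ + 4 * (s - + 2 * o)
    collect = solve-∀

-- Parallelograms in a finite abelian group

δ*δ≡0 : ∀ {m n} {i j : Fin m} {k l : Fin n} → ¬ (i ≡ j × k ≡ l) → δ i j * δ k l ≡ 0ℤ
δ*δ≡0 {i = i} {j} {k} {l} ¬both with i ≟ j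
... | no  _   = ℤ.*-zeroˡ (δ k l)
... | yes i≡j = trans (ℤ.*-identityˡ (δ k l)) (δ-≢ λ k≡l → ¬both (i≡j , k≡l))

module FinGroup {n} {_∙_ : Fin n → Fin n → Fin n} {ε : Fin n} {_⁻¹ : Fin n → Fin n}
  (isAbelianGroup : IsAbelianGroup _≡_ _∙_ ε _⁻¹) where

  group : AbelianGroup 0ℓ 0ℓ
  group = record { isAbelianGroup = isAbelianGroup }

  open AbelianGroup group using (comm; identityˡ; identityʳ; monoid)
  open Group (AbelianGroup.group group) using (_\\_)
  open Algebra.Properties.Group (AbelianGroup.group group)
    using (∙-cancelˡ; ∙-cancelʳ; \\-leftDividesˡ; \\-leftDividesʳ)
  open Algebra.Properties.CommutativeSemigroup (AbelianGroup.commutativeSemigroup group)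
    using (interchange)
  open Algebra.Properties.CommutativeMonoid.Sum (AbelianGroup.commutativeMonoid group)
    using () renaming (sum to ∏; ∑-permute to ∏-permute; ∑-distrib-+ to ∏-distrib; sum-replicate to ∏-replicate)
  open Algebra.Properties.Monoid.Mult monoid using () renaming (_×_ to _times_)

  infix 30 _²

  _² : Fin n → Fin n
  x ² = x ∙ x

  translation : Fin n → Perm.Permutation n n
  translation h = Perm.permutation (h ∙_) (h \\_) (\\-leftDividesˡ h) (\\-leftDividesʳ h)

  -- Multiplication by x permutes the group, so ∏ a = ∏ (x a) = xⁿ ∏ a.
  exponent : ∀ x → n times x ≡ ε
  exponent x = ∙-cancelʳ (∏ λ a → a) (n times x) ε (begin
    (n times x) ∙ ∏ (λ a → a)      ≡⟨ cong (_∙ _) (∏-replicate n {x}) ⟨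
    ∏ {n} (λ _ → x) ∙ ∏ (λ a → a)  ≡⟨ ∏-distrib (λ _ → x) (λ a → a) ⟨
    ∏ (λ a → x ∙ a)                ≡⟨ ∏-permute (λ a → a) (translation x) ⟨
    ∏ (λ a → a)                    ≡⟨ identityˡ _ ⟨
    ε ∙ ∏ (λ a → a)                ∎)

  roots : Fin n → ℤ
  roots p = sum λ x → δ p (x ²)

  t : ℤ
  t = roots ε

  0≤roots : ∀ p → 0ℤ ≤ roots p
  0≤roots p = 0≤sum λ x → 0≤δ p (x ²)

  -- Multiplication by h carries the square roots of ε bijectively to those of h².
  roots-square : ∀ h → roots (h ²) ≡ t
  roots-square h = trans (∑-permute (λ x → δ (h ²) (x ²)) (translation h)) (sum-cong-≗ λ x →
    δ-iff {i = h ²} {(h ∙ x) ²} {ε} {x ²}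
      (λ eq → ∙-cancelˡ (h ²) ε (x ²) (trans (identityʳ (h ²)) (trans eq (interchange h x h x))))
      (λ eq → trans (sym (identityʳ (h ²))) (trans (cong (h ² ∙_) eq) (sym (interchange h x h x)))))

  -- An element with a square root is a square, so `roots p` is 0 or `t`. This form makes the
  -- quadratic term of the kernel linear without a case distinction.
  roots-idem : ∀ p → roots p * roots p ≡ t * roots p
  roots-idem p with any? (λ x → p ≟ x ²)
  ... | yes (x , refl) = cong (_* roots p) (roots-square x)
  ... | no ¬p = trans (cong (roots p *_) 0≡) (trans (ℤ.*-zeroʳ (roots p))
                  (sym (trans (cong (t *_) 0≡) (ℤ.*-zeroʳ t))))
    where
    0≡ : roots p ≡ 0ℤ
    0≡ = sum-0 λ x → δ-≢ λ eq → ¬p (x , eq)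

  -- Each x is a square root of exactly one element, and d ↦ hd only reorders the elements.
  sum-roots : ∀ h → sum (λ d → roots (h ∙ d)) ≡ + n
  sum-roots h = begin
    sum (λ d → roots (h ∙ d))                 ≡⟨ ∑-permute roots (translation h) ⟨
    sum (λ d → sum λ x → δ d (x ²))           ≡⟨ ∑-comm (λ d x → δ d (x ²)) ⟩
    sum (λ x → sum λ d → δ d (x ²))           ≡⟨ sum-cong-≗ (λ x →
      trans (sum-cong-≗ λ d → δ-sym d (x ²)) (sum-δ-1 (x ²))) ⟩
    sum {n} (λ x → 1ℤ)                        ≡⟨ trans (sum-const n 1ℤ) (ℤ.*-identityʳ (+ n)) ⟩
    + n                                       ∎

  module _ {a b c d} (ab≡cd : a ∙ b ≡ c ∙ d) where

    a≡c⇒b≡d : a ≡ c → b ≡ d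
    a≡c⇒b≡d refl = ∙-cancelˡ a b d ab≡cd

    a≡d⇒b≡c : a ≡ d → b ≡ c
    a≡d⇒b≡c refl = ∙-cancelˡ a b c (trans ab≡cd (comm c a))

    b≡c⇒a≡d : b ≡ c → a ≡ d
    b≡c⇒a≡d refl = ∙-cancelʳ b a d (trans ab≡cd (comm b d))

    b≡d⇒a≡c : b ≡ d → a ≡ c
    b≡d⇒a≡c refl = ∙-cancelʳ b a c ab≡cd

  -- Squaring is an endomorphism of an abelian group. The four cancellation lemmas above therefore
  -- also apply to the squares of a, b, c, d, which gives the symmetries of the brackets in the
  -- weights.
  square-eq : ∀ {a b c d} → a ∙ b ≡ c ∙ d → a ² ∙ b ² ≡ c ² ∙ d ²
  square-eq {a} {b} {c} {d} eq =
    trans (interchange a a b b) (trans (cong₂ _∙_ eq eq) (interchange c d c d))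

  -- Weights on parallelograms and the entry they produce at g ≠ h

  module Weights (x₀ x₁ x₂ : ℤ) where

    -- a ² ≡ c ² says that the side a / c of the parallelogram a, c, b, d is an involution.
    valid weight W : Fin n → Fin n → Fin n → Fin n → ℤ
    valid a b c d = (1ℤ - δ a b) * ((1ℤ - δ c d) * ((1ℤ - δ a c) * (1ℤ - δ a d)))
    weight a b c d = x₀ + x₁ * roots (a ∙ b) - x₂ * (δ (a ²) (c ²) + δ (a ²) (d ²))
    W a b c d = δ (a ∙ b) (c ∙ d) * (valid a b c d * weight a b c d)

    private
      -- Some symmetries of `valid` and `weight` hold only where ab = cd. Elsewhere the leading δ
      -- makes both sides 0, so the factors have to be compared only under that equation.
      W-≡ : ∀ {a b c d a′ b′ c′ d′} → (a ∙ b ≡ c ∙ d → a′ ∙ b′ ≡ c′ ∙ d′) →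
            (a′ ∙ b′ ≡ c′ ∙ d′ → a ∙ b ≡ c ∙ d) →
            (a ∙ b ≡ c ∙ d → valid a b c d ≡ valid a′ b′ c′ d′) →
            (a ∙ b ≡ c ∙ d → weight a b c d ≡ weight a′ b′ c′ d′) →
            W a b c d ≡ W a′ b′ c′ d′
      W-≡ {a} {b} {c} {d} {a′} {b′} {c′} {d′} f g v w with a ∙ b ≟ c ∙ d
      ... | yes eq = cong₂ _*_ (sym (δ-≡ (f eq))) (cong₂ _*_ (v eq) (w eq))
      ... | no neq = trans (ℤ.*-zeroˡ (valid a b c d * weight a b c d))
        (sym (trans (cong (_* (valid a′ b′ c′ d′ * weight a′ b′ c′ d′)) (δ-≢ (neq ∘ g)))
          (ℤ.*-zeroˡ (valid a′ b′ c′ d′ * weight a′ b′ c′ d′))))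

    W-swapʳ : ∀ a b c d → W a b d c ≡ W a b c d
    W-swapʳ a b c d = W-≡ (λ eq → trans eq (comm d c)) (λ eq → trans eq (comm c d))
      (λ _ → cong ((1ℤ - δ a b) *_) (cong₂ _*_ (cong (λ x → 1ℤ - x) (δ-sym d c))
        (ℤ.*-comm (1ℤ - δ a d) (1ℤ - δ a c))))
      (λ _ → cong (λ s → x₀ + x₁ * roots (a ∙ b) - x₂ * s) (ℤ.+-comm (δ (a ²) (d ²)) (δ (a ²) (c ²))))

    W-swapˡ : ∀ a b c d → W b a c d ≡ W a b c d
    W-swapˡ a b c d = W-≡ (trans (comm a b)) (trans (comm b a))
      (λ eq → cong₂ _*_ (cong (λ x → 1ℤ - x) (δ-sym b a)) (cong ((1ℤ - δ c d) *_)
        (trans (cong₂ (λ x y → (1ℤ - x) * (1ℤ - y))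
                 (δ-iff {i = b} {c} {a} {d} (a≡c⇒b≡d eq) (b≡d⇒a≡c eq))
                 (δ-iff {i = b} {d} {a} {c} (a≡d⇒b≡c eq) (b≡c⇒a≡d eq)))
               (ℤ.*-comm (1ℤ - δ a d) (1ℤ - δ a c)))))
      (λ eq → let eq² = square-eq eq in
        cong₂ (λ p s → x₀ + x₁ * roots p - x₂ * s) (comm b a)
          (trans (cong₂ _+_
                   (δ-iff {i = b ²} {c ²} {a ²} {d ²} (a≡c⇒b≡d eq²) (b≡d⇒a≡c eq²))
                   (δ-iff {i = b ²} {d ²} {a ²} {c ²} (a≡d⇒b≡c eq²) (b≡c⇒a≡d eq²)))
                 (ℤ.+-comm (δ (a ²) (d ²)) (δ (a ²) (c ²)))))

    W-rotate : ∀ a b c d → W c d a b ≡ W a b c d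
    W-rotate a b c d = W-≡ sym sym
      (λ eq → trans (exchange (δ c d) (δ a b) ((1ℤ - δ c a) * (1ℤ - δ c b)))
        (cong (λ x → (1ℤ - δ a b) * ((1ℤ - δ c d) * x)) (cong₂ (λ x y → (1ℤ - x) * (1ℤ - y))
          (δ-sym c a)
          (δ-iff {i = c} {b} {a} {d} (λ c≡b → sym (a≡d⇒b≡c eq c≡b)) (λ a≡d → b≡c⇒a≡d eq (sym a≡d))))))
      (λ eq → let eq² = square-eq eq in
        cong₂ (λ p s → x₀ + x₁ * roots p - x₂ * s) eq (cong₂ _+_
          (δ-sym (c ²) (a ²))
          (δ-iff {i = c ²} {b ²} {a ²} {d ²} (λ c≡b → sym (a≡d⇒b≡c eq² c≡b)) (λ a≡d → b≡c⇒a≡d eq² (sym a≡d)))))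
      where
      exchange : ∀ x y z → (1ℤ - x) * ((1ℤ - y) * z) ≡ (1ℤ - y) * ((1ℤ - x) * z)
      exchange = solve-∀

    private
      sum-linear : ∀ (f g : Fin n → ℤ) x y z → (sum λ d → x + y * f d - z * g d) ≡ + n * x + y * sum f - z * sum g
      sum-linear f g x y z = trans (sum-- (λ d → x + y * f d) (λ d → z * g d))
        (cong₂ _-_ (trans (∑-distrib-+ (λ _ → x) (λ d → y * f d))
            (cong₂ _+_ (sum-const n x) (sym (*-distribˡ-sum y f))))
          (sym (*-distribˡ-sum z g)))

    module _ {g h : Fin n} (g≢h : ¬ g ≡ h) where

      private
        τ ρ : ℤ
        τ = δ (g ²) (h ²)
        ρ = roots (g ∙ h)

        -- The value of d at which the solution b of gb = hd degenerates to b = g.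
        e : Fin n
        e = h \\ g ²

        he≡g² : h ∙ e ≡ g ²
        he≡g² = \\-leftDividesˡ h (g ²)

        w : Fin n → ℤ
        w d = x₀ + x₁ * roots (h ∙ d) - x₂ * (τ + δ (g ²) (d ²))

        -- Inclusion-exclusion over the degenerate values d = h, d = g and d = e. They are pairwise
        -- different, except that e = h exactly when g² = h²; the last term with `τ` corrects for
        -- that coincidence.
        opposite-term : ∀ d → valid g (g \\ (h ∙ d)) h d * weight g (g \\ (h ∙ d)) h d ≡
                              w d - δ h d * w d - δ g d * w d - δ e d * w d + τ * (δ h d * w d)
        opposite-term d = begin
          valid g b h d * weight g b h d
            ≡⟨ cong₂ _*_
                 (cong₂ (λ x y → (1ℤ - x) * ((1ℤ - δ h d) * ((1ℤ - y) * (1ℤ - δ g d))))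
                   (δ-iff {i = g} {b} {e} {d} g≡b⇒e≡d e≡d⇒g≡b) (δ-≢ g≢h))
                 (cong (λ p → x₀ + x₁ * roots p - x₂ * (τ + δ (g ²) (d ²))) gb≡hd) ⟩
          (1ℤ - E) * ((1ℤ - H) * ((1ℤ - 0ℤ) * (1ℤ - G))) * w d
            ≡⟨ expand E H G (w d) ⟩
          (1ℤ - H - G - E + E * H + E * G * (1ℤ - H) + H * G) * w d
            ≡⟨ cong (_* w d) (cong₂ _+_ (cong₂ _+_ (cong (λ s → 1ℤ - H - G - E + s) EH)
                 (cong (_* (1ℤ - H)) EG)) HG) ⟩
          (1ℤ - H - G - E + τ * H + 0ℤ * (1ℤ - H) + 0ℤ) * w d
            ≡⟨ collect E H G τ (w d) ⟩
          w d - H * w d - G * w d - E * w d + τ * (H * w d) ∎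
          where
          E = δ e d
          H = δ h d
          G = δ g d
          b = g \\ (h ∙ d)
          gb≡hd : g ∙ b ≡ h ∙ d
          gb≡hd = \\-leftDividesˡ g (h ∙ d)
          g≡b⇒e≡d : g ≡ b → e ≡ d
          g≡b⇒e≡d g≡b = ∙-cancelˡ h e d (trans he≡g² (trans (cong (g ∙_) g≡b) gb≡hd))
          e≡d⇒g≡b : e ≡ d → g ≡ b
          e≡d⇒g≡b e≡d = ∙-cancelˡ g g b (trans (sym he≡g²) (trans (cong (h ∙_) e≡d) (sym gb≡hd)))
          EG : E * G ≡ 0ℤ
          EG = δ*δ≡0 {i = e} {d} {g} {d} λ { (e≡d , refl) →
            g≢h (∙-cancelʳ g g h (trans (sym he≡g²) (cong (h ∙_) e≡d))) }
          HG : H * G ≡ 0ℤ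
          HG = δ*δ≡0 {i = h} {d} {g} {d} λ { (h≡d , g≡d) → g≢h (trans g≡d (sym h≡d)) }
          EH : E * H ≡ τ * H
          EH with h ≟ d
          ... | no  _    = trans (ℤ.*-zeroʳ E) (sym (ℤ.*-zeroʳ τ))
          ... | yes refl = cong (_* 1ℤ) (δ-iff {i = e} {h} {g ²} {h ²}
                  (λ e≡h → trans (sym he≡g²) (cong (h ∙_) e≡h))
                  (λ g²≡h² → ∙-cancelˡ h e h (trans he≡g² g²≡h²)))
          expand : ∀ E H G w → (1ℤ - E) * ((1ℤ - H) * ((1ℤ - 0ℤ) * (1ℤ - G))) * w ≡
                               (1ℤ - H - G - E + E * H + E * G * (1ℤ - H) + H * G) * w
          expand = solve-∀
          collect : ∀ E H G τ w → (1ℤ - H - G - E + τ * H + 0ℤ * (1ℤ - H) + 0ℤ) * w ≡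
                                  w - H * w - G * w - E * w + τ * (H * w)
          collect = solve-∀

        δg²e²≡τ : δ (g ²) (e ²) ≡ τ
        δg²e²≡τ = δ-iff {i = g ²} {e ²} {g ²} {h ²} (λ g²≡e² → sym (b≡d⇒a≡c h²e²≡g²g² (sym g²≡e²)))
          (λ g²≡h² → sym (a≡c⇒b≡d h²e²≡g²g² (sym g²≡h²)))
          where
          h²e²≡g²g² : h ² ∙ e ² ≡ g ² ∙ g ²
          h²e²≡g²g² = square-eq he≡g²

        wh we wg : ℤ
        wh = x₀ + x₁ * t - x₂ * (τ + τ)
        we = x₀ + x₁ * t - x₂ * (τ + τ)
        wg = x₀ + x₁ * ρ - x₂ * (τ + 1ℤ)

      opposite-sum : sum (λ b → sum λ d → W g b h d) ≡
        + n * (x₀ - x₂ * τ) + x₁ * + n - x₂ * t - wh - wg - we + τ * wh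
      opposite-sum = begin
        sum (λ b → sum λ d → W g b h d)
          ≡⟨ ∑-comm (λ b d → W g b h d) ⟩
        sum (λ d → sum λ b → W g b h d)
          ≡⟨ (sum-cong-≗ λ d → trans
               (sum-cong-≗ λ b → cong (_* (valid g b h d * weight g b h d))
                 (δ-iff {i = g ∙ b} {h ∙ d} {b} {g \\ (h ∙ d)}
                   (λ eq → ∙-cancelˡ g b _ (trans eq (sym (\\-leftDividesˡ g (h ∙ d)))))
                   (λ eq → trans (cong (g ∙_) eq) (\\-leftDividesˡ g (h ∙ d)))))
               (sum-δ′ (g \\ (h ∙ d)) λ b → valid g b h d * weight g b h d)) ⟩
        sum (λ d → valid g (g \\ (h ∙ d)) h d * weight g (g \\ (h ∙ d)) h d)
          ≡⟨ sum-cong-≗ opposite-term ⟩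
        sum (λ d → w d - δ h d * w d - δ g d * w d - δ e d * w d + τ * (δ h d * w d))
          ≡⟨ trans (∑-distrib-+ (λ d → w d - δ h d * w d - δ g d * w d - δ e d * w d) _)
              (cong₂ _+_ (trans (sum-- (λ d → w d - δ h d * w d - δ g d * w d) _)
                (cong₂ _-_ (trans (sum-- (λ d → w d - δ h d * w d) _)
                  (cong₂ _-_ (trans (sum-- w _) (cong (λ s → sum w - s) (sum-δ h w))) (sum-δ g w)))
                  (sum-δ e w)))
                (trans (sym (*-distribˡ-sum τ λ d → δ h d * w d)) (cong (τ *_) (sum-δ h w)))) ⟩
        sum w - w h - w g - w e + τ * w h
          ≡⟨ cong₂ _+_ (cong₂ _-_ (cong₂ _-_ (cong₂ _-_ Σw w-h) w-g) w-e) (cong (τ *_) w-h) ⟩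
        + n * (x₀ - x₂ * τ) + x₁ * + n - x₂ * t - wh - wg - we + τ * wh ∎
        where
        w-h : w h ≡ wh
        w-h = cong (λ r → x₀ + x₁ * r - x₂ * (τ + τ)) (roots-square h)
        w-e : w e ≡ we
        w-e = cong₂ (λ r s → x₀ + x₁ * r - x₂ * (τ + s)) (trans (cong roots he≡g²) (roots-square g)) δg²e²≡τ
        w-g : w g ≡ wg
        w-g = cong₂ (λ r s → x₀ + x₁ * roots r - x₂ * (τ + s)) (comm h g) (δ-≡ {i = g ²} refl)
        Σw : sum w ≡ + n * (x₀ - x₂ * τ) + x₁ * + n - x₂ * t
        Σw = trans (sum-cong-≗ λ d → rearrange (roots (h ∙ d)) (δ (g ²) (d ²)) x₀ x₁ x₂ τ)
          (trans (sum-linear (λ d → roots (h ∙ d)) (λ d → δ (g ²) (d ²)) (x₀ - x₂ * τ) x₁ x₂)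
            (cong₂ (λ r s → + n * (x₀ - x₂ * τ) + x₁ * r - x₂ * s) (sum-roots h) (roots-square g)))
          where
          rearrange : ∀ r s x₀ x₁ x₂ τ → x₀ + x₁ * r - x₂ * (τ + s) ≡ x₀ - x₂ * τ + x₁ * r - x₂ * s
          rearrange = solve-∀

      private
        K : ℤ
        K = x₀ + x₁ * ρ

        u : Fin n → ℤ
        u c = K - x₂ * (δ (g ²) (c ²) + δ (h ²) (c ²))

        -- The degenerate values of c are g, h and the square roots of gh, for which c = d. As g ≠
        -- h, these cases exclude each other. Moreover c² = gh is incompatible with c² = g² and with
        -- c² = h², so both brackets vanish at such a root and its weight is `K`.
        same-term : ∀ c → valid g h c (c \\ (g ∙ h)) * weight g h c (c \\ (g ∙ h)) ≡
                          u c - K * δ (g ∙ h) (c ²) - δ g c * u c - δ h c * u c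
        same-term c = begin
          valid g h c d * weight g h c d
            ≡⟨ cong₂ _*_
                 (cong₂ _*_ (cong (λ x → 1ℤ - x) (δ-≢ g≢h)) (cong₂ _*_
                   (cong (λ x → 1ℤ - x) (δ-iff {i = c} {d} {g ∙ h} {c ²}
                     (λ c≡d → trans (sym cd≡gh) (cong (c ∙_) (sym c≡d)))
                     (λ gh≡c² → ∙-cancelˡ c c d (trans (sym gh≡c²) (sym cd≡gh)))))
                   (cong (λ x → (1ℤ - δ g c) * (1ℤ - x)) (δ-iff {i = g} {d} {h} {c}
                     (a≡d⇒b≡c gh≡cd) (b≡c⇒a≡d gh≡cd)))))
                 (cong (λ s → K - x₂ * (δ (g ²) (c ²) + s)) (δ-iff {i = g ²} {d ²} {h ²} {c ²}
                   (a≡d⇒b≡c (square-eq gh≡cd)) (b≡c⇒a≡d (square-eq gh≡cd)))) ⟩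
          (1ℤ - 0ℤ) * ((1ℤ - Q) * ((1ℤ - G) * (1ℤ - H))) * (K - x₂ * (S + T))
            ≡⟨ expand Q G H K x₂ S T ⟩
          (1ℤ - G - H + Q * G + Q * H * (1ℤ - G) + G * H) * (K - x₂ * (S + T)) - K * Q + x₂ * (S * Q + T * Q)
            ≡⟨ substitute QG QH GH SQ TQ ⟩
          (1ℤ - G - H + 0ℤ + 0ℤ * (1ℤ - G) + 0ℤ) * (K - x₂ * (S + T)) - K * Q + x₂ * (0ℤ + 0ℤ)
            ≡⟨ collect Q G H K x₂ (u c) ⟩
          u c - K * Q - G * u c - H * u c ∎
          where
          d = c \\ (g ∙ h)
          Q = δ (g ∙ h) (c ²)
          G = δ g c
          H = δ h c
          S = δ (g ²) (c ²)
          T = δ (h ²) (c ²)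
          cd≡gh : c ∙ d ≡ g ∙ h
          cd≡gh = \\-leftDividesˡ c (g ∙ h)
          gh≡cd : g ∙ h ≡ c ∙ d
          gh≡cd = sym cd≡gh
          QG : Q * G ≡ 0ℤ
          QG = δ*δ≡0 {i = g ∙ h} {c ²} {g} {c} λ { (gh≡c² , refl) → g≢h (sym (∙-cancelˡ g h g gh≡c²)) }
          QH : Q * H ≡ 0ℤ
          QH = δ*δ≡0 {i = g ∙ h} {c ²} {h} {c} λ { (gh≡c² , refl) → g≢h (∙-cancelʳ h g h gh≡c²) }
          GH : G * H ≡ 0ℤ
          GH = δ*δ≡0 {i = g} {c} {h} {c} λ { (g≡c , h≡c) → g≢h (trans g≡c (sym h≡c)) }
          SQ : S * Q ≡ 0ℤ
          SQ = δ*δ≡0 {i = g ²} {c ²} {g ∙ h} {c ²} λ { (g²≡c² , gh≡c²) →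
            g≢h (∙-cancelˡ g g h (trans g²≡c² (sym gh≡c²))) }
          TQ : T * Q ≡ 0ℤ
          TQ = δ*δ≡0 {i = h ²} {c ²} {g ∙ h} {c ²} λ { (h²≡c² , gh≡c²) →
            g≢h (∙-cancelʳ h g h (trans gh≡c² (sym h²≡c²))) }
          expand : ∀ Q G H K x₂ S T →
            (1ℤ - 0ℤ) * ((1ℤ - Q) * ((1ℤ - G) * (1ℤ - H))) * (K - x₂ * (S + T)) ≡
            (1ℤ - G - H + Q * G + Q * H * (1ℤ - G) + G * H) * (K - x₂ * (S + T)) - K * Q + x₂ * (S * Q + T * Q)
          expand = solve-∀
          substitute : ∀ {qg qh gh sq tq} → Q * G ≡ qg → Q * H ≡ qh → G * H ≡ gh → S * Q ≡ sq → T * Q ≡ tq →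
            (1ℤ - G - H + Q * G + Q * H * (1ℤ - G) + G * H) * (K - x₂ * (S + T)) - K * Q + x₂ * (S * Q + T * Q) ≡
            (1ℤ - G - H + qg + qh * (1ℤ - G) + gh) * (K - x₂ * (S + T)) - K * Q + x₂ * (sq + tq)
          substitute refl refl refl refl refl = refl
          collect : ∀ Q G H K x₂ u →
            (1ℤ - G - H + 0ℤ + 0ℤ * (1ℤ - G) + 0ℤ) * u - K * Q + x₂ * (0ℤ + 0ℤ) ≡ u - K * Q - G * u - H * u
          collect = solve-∀

      same-sum : sum (λ c → sum λ d → W g h c d) ≡
        + n * K - x₂ * (t + t) - K * ρ - (K - x₂ * (1ℤ + τ)) - (K - x₂ * (τ + 1ℤ))
      same-sum = begin
        sum (λ c → sum λ d → W g h c d)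
          ≡⟨ (sum-cong-≗ λ c → trans
               (sum-cong-≗ λ d → cong (_* (valid g h c d * weight g h c d))
                 (δ-iff {i = g ∙ h} {c ∙ d} {d} {c \\ (g ∙ h)}
                   (λ eq → ∙-cancelˡ c d _ (trans (sym eq) (sym (\\-leftDividesˡ c (g ∙ h)))))
                   (λ eq → sym (trans (cong (c ∙_) eq) (\\-leftDividesˡ c (g ∙ h))))))
               (sum-δ′ (c \\ (g ∙ h)) λ d → valid g h c d * weight g h c d)) ⟩
        sum (λ c → valid g h c (c \\ (g ∙ h)) * weight g h c (c \\ (g ∙ h)))
          ≡⟨ sum-cong-≗ same-term ⟩
        sum (λ c → u c - K * δ (g ∙ h) (c ²) - δ g c * u c - δ h c * u c)
          ≡⟨ trans (sum-- (λ c → u c - K * δ (g ∙ h) (c ²) - δ g c * u c) _)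
              (cong₂ _-_ (trans (sum-- (λ c → u c - K * δ (g ∙ h) (c ²)) _)
                (cong₂ _-_ (trans (sum-- u _) (cong₂ _-_ Σu (sym (*-distribˡ-sum K λ c → δ (g ∙ h) (c ²)))))
                  (sum-δ g u)))
                (sum-δ h u)) ⟩
        + n * K - x₂ * (t + t) - K * ρ - u g - u h
          ≡⟨ cong₂ (λ x y → + n * K - x₂ * (t + t) - K * ρ - (K - x₂ * x) - (K - x₂ * y))
               (cong₂ _+_ (δ-≡ {i = g ²} refl) (δ-sym (h ²) (g ²)))
               (cong₂ _+_ (refl {x = τ}) (δ-≡ {i = h ²} refl)) ⟩
        + n * K - x₂ * (t + t) - K * ρ - (K - x₂ * (1ℤ + τ)) - (K - x₂ * (τ + 1ℤ)) ∎
        where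
        Σu : sum u ≡ + n * K - x₂ * (t + t)
        Σu = begin
          sum u
            ≡⟨ sum-- (λ _ → K) (λ c → x₂ * (δ (g ²) (c ²) + δ (h ²) (c ²))) ⟩
          sum (λ (_ : Fin n) → K) - sum (λ c → x₂ * (δ (g ²) (c ²) + δ (h ²) (c ²)))
            ≡⟨ cong₂ _-_ (sum-const n K) (trans (sym (*-distribˡ-sum x₂ λ c → δ (g ²) (c ²) + δ (h ²) (c ²)))
                 (cong (x₂ *_) (trans (∑-distrib-+ (λ c → δ (g ²) (c ²)) _)
                   (cong₂ _+_ (roots-square g) (roots-square h))))) ⟩
          + n * K - x₂ * (t + t) ∎

      W-kernel : sum⁴ (λ a b c d → W a b c d * (quad a b c d g * quad a b c d h)) ≡
        + 4 * ((+ n * K - x₂ * (t + t) - K * ρ - (K - x₂ * (1ℤ + τ)) - (K - x₂ * (τ + 1ℤ)))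
             - + 2 * (+ n * (x₀ - x₂ * τ) + x₁ * + n - x₂ * t - wh - wg - we + τ * wh))
      W-kernel = trans (quad-kernel W W-swapˡ W-swapʳ W-rotate g≢h)
        (cong₂ (λ s o → + 4 * (s - + 2 * o)) same-sum opposite-sum)

0<* : ∀ {i j} → 0ℤ < i → 0ℤ < j → 0ℤ < i * j
0<* {i} {j} 0<i 0<j = subst (_< i * j) (ℤ.*-zeroʳ i) (ℤ.*-monoˡ-<-pos i {{positive 0<i}} 0<j)

0≤* : ∀ {i j} → 0ℤ ≤ i → 0ℤ ≤ j → 0ℤ ≤ i * j
0≤* {i} {j} 0≤i 0≤j = subst (_≤ i * j) (ℤ.*-zeroʳ i) (ℤ.*-monoˡ-≤-nonNeg i {{nonNegative 0≤i}} 0≤j)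

0<i+i⇒0<i : ∀ {i} → 0ℤ < i + i → 0ℤ < i
0<i+i⇒0<i {i} 0<i+i = ℤ.≰⇒> λ i≤0 → ℤ.<⇒≱ 0<i+i (ℤ.+-mono-≤ i≤0 i≤0)

i<j⇒0<j-i : ∀ {i j} → i < j → 0ℤ < j - i
i<j⇒0<j-i {i} {j} i<j = subst (_< j - i) (ℤ.+-inverseʳ i) (ℤ.+-monoˡ-< (- i) i<j)

-- Σ W s sᵀ is -C off the diagonal; since every s has sum zero, this makes it
-- the multiple nC of the orthogonal projection onto the vectors of sum zero.
record IsConfiguration (_∙_ : Fin n → Fin n → Fin n) (L : (Fin n → ℤ) → Set ℓ)
                       (W : Fin n → Fin n → Fin n → Fin n → ℤ) (N C : ℤ) : Set ℓ where
  field
    0<N       : 0ℤ < N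
    0<C       : 0ℤ < C
    W≥0       : ∀ a b c d → W a b c d ≡ 0ℤ ⊎ 0ℤ < W a b c d
    balanced  : ∀ {a b c d} → 0ℤ < W a b c d → a ∙ b ≡ c ∙ d
    norm      : ∀ {a b c d} → 0ℤ < W a b c d → normSq (quad a b c d) ≡ N
    kernel    : ∀ {g h} → ¬ g ≡ h →
                sum⁴ (λ a b c d → W a b c d * (quad a b c d g * quad a b c d h)) ≡ - C
    minimal   : ∀ k → sum k ≡ 0ℤ → L k → ¬ (∀ i → k i ≡ 0ℤ) → normSq k ≤ N →
                ∃ λ a → ∃ λ b → ∃ λ c → ∃ λ d → 0ℤ < W a b c d × k ≗ quad a b c d

-- Configurations made of parallelograms

module Configurations {n} {_∙_ : Fin n → Fin n → Fin n} {ε : Fin n} {_⁻¹ : Fin n → Fin n}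
  (isAbelianGroup : IsAbelianGroup _≡_ _∙_ ε _⁻¹)
  (L : (Fin n → ℤ) → Set ℓ)
  (L-quad : ∀ {k} a b c d → k ≗ quad a b c d → L k → a ∙ b ≡ c ∙ d) where

  open FinGroup isAbelianGroup

  -- The remaining inequalities b ≠ c and b ≠ d follow from a ≠ d and a ≠ c by cancellation in ab =
  -- cd.
  Parallelogram : (a b c d : Fin n) → Set
  Parallelogram a b c d = a ∙ b ≡ c ∙ d × (¬ a ≡ b) × (¬ c ≡ d) × (¬ a ≡ c) × (¬ a ≡ d)

  normSq-parallelogram : ∀ {a b c d} → Parallelogram a b c d → normSq (quad a b c d) ≡ + 4
  normSq-parallelogram (ab≡cd , a≢b , c≢d , a≢c , a≢d) =
    normSq-quad a≢b c≢d a≢c a≢d (a≢d ∘ b≡c⇒a≡d ab≡cd) (a≢c ∘ b≡d⇒a≡c ab≡cd)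

  -- Each descent step takes at least 2 off the squared norm, so two steps exhaust k. If one step
  -- sufficed, k would be the difference a - c; written as `quad a a c a` it falls under `L-quad`,
  -- which forces a = c. A repeated a or c would give an entry ±2 besides another nonzero one, hence
  -- squared norm at least 5.
  minimal-parallelogram : ∀ k → sum k ≡ 0ℤ → L k → ¬ (∀ i → k i ≡ 0ℤ) → normSq k ≤ + 4 →
    ∃ λ a → ∃ λ b → ∃ λ c → ∃ λ d → Parallelogram a b c d × k ≗ quad a b c d
  minimal-parallelogram k Σk≡0 Lk k≢0 k≤4 = cases (all? λ i → S.rest i ℤ.≟ 0ℤ)
    where
    module S = Step (step k Σk≡0 k≢0)
    a = S.a
    c = S.c
    cases : Dec (∀ i → S.rest i ≡ 0ℤ) → _
    cases (yes rest≡0) = contradiction a≡c S.a≢c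
      where
      add-zero : ∀ x y z r → r ≡ 0ℤ → r + (x - y) ≡ x + z - y - z
      add-zero x y z _ refl = cancel x y z
        where
        cancel : ∀ x y z → 0ℤ + (x - y) ≡ x + z - y - z
        cancel = solve-∀
      a≡c : a ≡ c
      a≡c = b≡d⇒a≡c (L-quad a a c a
        (λ i → trans (S.split i) (add-zero (δ a i) (δ c i) (δ a i) (S.rest i) (rest≡0 i))) Lk) refl
    cases (no rest≢0) = a , b , c , d , (ab≡cd , a≢b , c≢d , a≢c , a≢d) , k≗quad
      where
      module T = Step (step S.rest S.Σrest rest≢0)
      b = T.a
      d = T.c
      rest≡0 : ∀ i → T.rest i ≡ 0ℤ
      rest≡0 = normSq≤0⇒0 (subst (_≤ 0ℤ) (cancel (normSq T.rest)) (ℤ.+-monoˡ-≤ (- + 4)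
        (ℤ.≤-trans (ℤ.+-monoˡ-≤ (+ 2) T.drop) (ℤ.≤-trans S.drop k≤4))))
        where
        cancel : ∀ x → x + + 2 + + 2 - + 4 ≡ x
        cancel = solve-∀
      k≗quad : k ≗ quad a b c d
      k≗quad i = trans (S.split i) (trans (cong (_+ (δ a i - δ c i))
          (trans (T.split i) (cong (_+ (δ b i - δ d i)) (rest≡0 i))))
        (rearrange (δ a i) (δ b i) (δ c i) (δ d i)))
        where
        rearrange : ∀ a b c d → 0ℤ + (b - d) + (a - c) ≡ a + b - c - d
        rearrange = solve-∀
      ab≡cd : a ∙ b ≡ c ∙ d
      ab≡cd = L-quad a b c d k≗quad Lk
      a≢c : ¬ a ≡ c
      a≢c = S.a≢c
      a≢d : ¬ a ≡ d
      a≢d a≡d = k≢0 λ i → trans (k≗quad i) (trans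
        (cong₂ (λ x y → x + y - δ c i - δ d i) (cong (λ x → δ x i) a≡d) (cong (λ x → δ x i) (a≡d⇒b≡c ab≡cd a≡d)))
        (cancel (δ c i) (δ d i)))
        where
        cancel : ∀ c d → d + c - c - d ≡ 0ℤ
        cancel = solve-∀
      5≰k : ¬ (+ 5 ≤ normSq k)
      5≰k 5≤k = contradiction (ℤ.≤-trans 5≤k k≤4) λ { (+≤+ (ℕ.s≤s (ℕ.s≤s (ℕ.s≤s (ℕ.s≤s ()))))) }
      a≢b : ¬ a ≡ b
      a≢b a≡b = 5≰k (ℤ.≤-trans (ℤ.+-mono-≤
          (ℤ.≤-reflexive (cong₂ _*_ (sym ka≡2) (sym ka≡2)))
          (1≤k*k S.kc≤-1))
        (two-entries≤normSq k a≢c))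
        where
        ka≡2 : k a ≡ + 2
        ka≡2 = trans (k≗quad a) (cong₂ _-_ (cong₂ _-_ (cong₂ _+_ (δ-≡ {i = a} refl) (δ-≡ {i = b} (sym a≡b)))
          (δ-≢ (a≢c ∘ sym))) (δ-≢ (a≢d ∘ sym)))
        1≤k*k : ∀ {i} → i ≤ -1ℤ → 1ℤ ≤ i * i
        1≤k*k (-≤- _) = +≤+ (ℕ.s≤s ℕ.z≤n)
      c≢d : ¬ c ≡ d
      c≢d c≡d = 5≰k (ℤ.≤-trans (ℤ.+-mono-≤
          (ℤ.≤-reflexive (cong₂ _*_ (sym kc≡-2) (sym kc≡-2)))
          (1≤k*k S.1≤ka))
        (two-entries≤normSq k (a≢c ∘ sym)))
        where
        kc≡-2 : k c ≡ - + 2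
        kc≡-2 = trans (k≗quad c) (cong₂ _-_ (cong₂ _-_ (cong₂ _+_ (δ-≢ a≢c)
          (δ-≢ λ b≡c → a≢d (b≡c⇒a≡d ab≡cd b≡c))) (δ-≡ {i = c} refl)) (δ-≡ {i = d} (sym c≡d)))
        1≤k*k : ∀ {i} → 1ℤ ≤ i → 1ℤ ≤ i * i
        1≤k*k (+≤+ (ℕ.s≤s _)) = +≤+ (ℕ.s≤s ℕ.z≤n)

  module _ (x₀ x₁ x₂ : ℤ) where

    open Weights x₀ x₁ x₂

    W-cases : ∀ a b c d → W a b c d ≡ 0ℤ ⊎ (Parallelogram a b c d × W a b c d ≡ weight a b c d)
    W-cases a b c d with a ∙ b ≟ c ∙ d | a ≟ b | c ≟ d | a ≟ c | a ≟ d
    ... | no _  | _ | _ | _ | _ = inj₁ refl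
    ... | yes _ | yes _ | _ | _ | _ = inj₁ refl
    ... | yes _ | no _ | yes _ | _ | _ = inj₁ refl
    ... | yes _ | no _ | no _ | yes _ | _ = inj₁ refl
    ... | yes _ | no _ | no _ | no _ | yes _ = inj₁ refl
    ... | yes ab≡cd | no a≢b | no c≢d | no a≢c | no a≢d =
      inj₂ ((ab≡cd , a≢b , c≢d , a≢c , a≢d) ,
        trans (ℤ.*-identityˡ (1ℤ * weight a b c d)) (ℤ.*-identityˡ (weight a b c d)))

    W-parallelogram : ∀ {a b c d} → Parallelogram a b c d → W a b c d ≡ weight a b c d
    W-parallelogram {a} {b} {c} {d} (ab≡cd , a≢b , c≢d , a≢c , a≢d) =
      trans (cong₂ (λ x y → x * (y * weight a b c d)) (δ-≡ ab≡cd)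
          (cong₂ (λ x y → (1ℤ - x) * y) (δ-≢ a≢b) (cong₂ (λ x y → (1ℤ - x) * y) (δ-≢ c≢d)
            (cong₂ (λ x y → (1ℤ - x) * (1ℤ - y)) (δ-≢ a≢c) (δ-≢ a≢d)))))
        (trans (ℤ.*-identityˡ (1ℤ * weight a b c d)) (ℤ.*-identityˡ (weight a b c d)))

    parallelograms : ∀ {C} → 0ℤ < C →
      (∀ {a b c d} → Parallelogram a b c d → 0ℤ < weight a b c d) →
      (∀ {g h} → ¬ g ≡ h → sum⁴ (λ a b c d → W a b c d * (quad a b c d g * quad a b c d h)) ≡ - C) →
      IsConfiguration _∙_ L W (+ 4) C
    parallelograms 0<C 0<weight kernel = record
      { 0<N = +<+ (ℕ.s≤s ℕ.z≤n) ; 0<C = 0<C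
      ; W≥0 = W≥0
      ; balanced = λ 0<W → proj₁ (parallelogram 0<W)
      ; norm = λ 0<W → normSq-parallelogram (parallelogram 0<W)
      ; kernel = kernel
      ; minimal = λ k Σk≡0 Lk k≢0 k≤4 →
          let (a , b , c , d , p , k≗) = minimal-parallelogram k Σk≡0 Lk k≢0 k≤4
          in a , b , c , d , subst (0ℤ <_) (sym (W-parallelogram p)) (0<weight p) , k≗
      }
      where
      W≥0 : ∀ a b c d → W a b c d ≡ 0ℤ ⊎ 0ℤ < W a b c d
      W≥0 a b c d with W-cases a b c d
      ... | inj₁ eq       = inj₁ eq
      ... | inj₂ (p , eq) = inj₂ (subst (0ℤ <_) (sym eq) (0<weight p))
      parallelogram : ∀ {a b c d} → 0ℤ < W a b c d → Parallelogram a b c d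
      parallelogram {a} {b} {c} {d} 0<W with W-cases a b c d
      ... | inj₁ eq      = contradiction 0<W (ℤ.<-irrefl (sym eq))
      ... | inj₂ (p , _) = p

  elementary : 3 ℕ.≤ n → (∀ y → y ² ≡ ε) →
               ∃ λ W → IsConfiguration _∙_ L W (+ 4) (+ 4 * (+ n - + 2))
  elementary 3≤n y²≡ε = _ , parallelograms 1ℤ 0ℤ 0ℤ
    (0<* {+ 4} (+<+ (ℕ.s≤s ℕ.z≤n)) (i<j⇒0<j-i (+<+ 3≤n)))
    (λ {a} {b} {c} {d} _ → subst (0ℤ <_)
      (sym (one (roots (a ∙ b)) (δ (a ²) (c ²) + δ (a ²) (d ²)))) (+<+ (ℕ.s≤s ℕ.z≤n)))
    kernel
    where
    open Weights 1ℤ 0ℤ 0ℤ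
    one : ∀ r s → 1ℤ + 0ℤ * r - 0ℤ * s ≡ 1ℤ
    one = solve-∀
    kernel : ∀ {g h} → ¬ g ≡ h →
      sum⁴ (λ a b c d → W a b c d * (quad a b c d g * quad a b c d h)) ≡ - (+ 4 * (+ n - + 2))
    kernel {g} {h} g≢h = trans (W-kernel g≢h)
      (trans (evaluate (roots (g ∙ h)) (δ (g ²) (h ²)) ρ≡0 τ≡1) (collect (+ n) t))
      where
      evaluate : ∀ ρ τ {ρ′ τ′} → ρ ≡ ρ′ → τ ≡ τ′ → _
      evaluate ρ τ {ρ′} {τ′} ρ≡ τ≡ = cong₂ (λ ρ τ →
        + 4 * ((+ n * (1ℤ + 0ℤ * ρ) - 0ℤ * (t + t) - (1ℤ + 0ℤ * ρ) * ρ
               - (1ℤ + 0ℤ * ρ - 0ℤ * (1ℤ + τ)) - (1ℤ + 0ℤ * ρ - 0ℤ * (τ + 1ℤ)))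
             - + 2 * (+ n * (1ℤ - 0ℤ * τ) + 0ℤ * + n - 0ℤ * t - (1ℤ + 0ℤ * t - 0ℤ * (τ + τ))
                     - (1ℤ + 0ℤ * ρ - 0ℤ * (τ + 1ℤ)) - (1ℤ + 0ℤ * t - 0ℤ * (τ + τ))
                     + τ * (1ℤ + 0ℤ * t - 0ℤ * (τ + τ))))) ρ≡ τ≡
      τ≡1 : δ (g ²) (h ²) ≡ 1ℤ
      τ≡1 = δ-≡ (trans (y²≡ε g) (sym (y²≡ε h)))
      ρ≡0 : roots (g ∙ h) ≡ 0ℤ
      ρ≡0 = sum-0 λ x → δ-≢ λ gh≡x² → g≢h
        (sym (a≡c⇒b≡d (trans gh≡x² (trans (y²≡ε x) (sym (y²≡ε g)))) refl))
      collect : ∀ n t →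
        + 4 * ((n * (1ℤ + 0ℤ * 0ℤ) - 0ℤ * (t + t) - (1ℤ + 0ℤ * 0ℤ) * 0ℤ
               - (1ℤ + 0ℤ * 0ℤ - 0ℤ * (1ℤ + 1ℤ)) - (1ℤ + 0ℤ * 0ℤ - 0ℤ * (1ℤ + 1ℤ)))
             - + 2 * (n * (1ℤ - 0ℤ * 1ℤ) + 0ℤ * n - 0ℤ * t - (1ℤ + 0ℤ * t - 0ℤ * (1ℤ + 1ℤ))
                     - (1ℤ + 0ℤ * 0ℤ - 0ℤ * (1ℤ + 1ℤ)) - (1ℤ + 0ℤ * t - 0ℤ * (1ℤ + 1ℤ))
                     + 1ℤ * (1ℤ + 0ℤ * t - 0ℤ * (1ℤ + 1ℤ)))) ≡ - (+ 4 * (n - + 2))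
      collect = solve-∀

  module _ {y} (y²≢ε : ¬ y ² ≡ ε) where

    -- The square roots of ε and those of y² form disjoint sets of `t` elements each.
    2t≤n : t + t ≤ + n
    2t≤n = subst₂ _≤_
      (trans (∑-distrib-+ (λ x → δ ε (x ²)) _) (cong (λ s → t + s) (roots-square y)))
      (trans (sum-const n 1ℤ) (ℤ.*-identityʳ (+ n)))
      (sum-≤ le)
      where
      le : ∀ x → δ ε (x ²) + δ (y ²) (x ²) ≤ 1ℤ
      le x with ε ≟ x ² | y ² ≟ x ²
      ... | yes ε≡x² | yes y²≡x² = contradiction (trans y²≡x² (sym ε≡x²)) y²≢ε
      ... | yes _ | no _  = ℤ.≤-refl
      ... | no _  | yes _ = ℤ.≤-refl
      ... | no _  | no _  = +≤+ ℕ.z≤n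

    -- The coset {x : x² = a²} then contains a, b, c and d.
    4≤t : ∀ {a b c d} → Parallelogram a b c d → a ² ≡ c ² → a ² ≡ d ² → + 4 ≤ t
    4≤t {a} {b} {c} {d} (ab≡cd , a≢b , c≢d , a≢c , a≢d) a²≡c² a²≡d² =
      subst₂ _≤_ total (roots-square a) (sum-≤ le)
      where
      b≢c : ¬ b ≡ c
      b≢c = a≢d ∘ b≡c⇒a≡d ab≡cd
      b≢d : ¬ b ≡ d
      b≢d = a≢c ∘ b≡d⇒a≡c ab≡cd
      a²≡b² : a ² ≡ b ²
      a²≡b² = trans a²≡d² (sym (a≡c⇒b≡d (square-eq ab≡cd) a²≡c²))
      total : sum (λ x → δ a x + δ b x + (δ c x + δ d x)) ≡ + 4
      total = trans (∑-distrib-+ (λ x → δ a x + δ b x) _) (cong₂ _+_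
        (trans (∑-distrib-+ (δ a) (δ b)) (cong₂ _+_ (sum-δ-1 a) (sum-δ-1 b)))
        (trans (∑-distrib-+ (δ c) (δ d)) (cong₂ _+_ (sum-δ-1 c) (sum-δ-1 d))))
      hit : ∀ {x z} → a ² ≡ z ² → z ≡ x → 1ℤ ≤ δ (a ²) (x ²)
      hit a²≡z² refl = ℤ.≤-reflexive (sym (δ-≡ a²≡z²))
      le : ∀ x → δ a x + δ b x + (δ c x + δ d x) ≤ δ (a ²) (x ²)
      le x with a ≟ x | b ≟ x | c ≟ x | d ≟ x
      ... | yes p | yes q | _ | _ = contradiction (trans p (sym q)) a≢b
      ... | yes p | no _ | yes q | _ = contradiction (trans p (sym q)) a≢c
      ... | yes p | no _ | no _ | yes q = contradiction (trans p (sym q)) a≢d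
      ... | yes p | no _ | no _ | no _ = hit refl p
      ... | no _ | yes p | yes q | _ = contradiction (trans p (sym q)) b≢c
      ... | no _ | yes p | no _ | yes q = contradiction (trans p (sym q)) b≢d
      ... | no _ | yes p | no _ | no _ = hit a²≡b² p
      ... | no _ | no _ | yes p | yes q = contradiction (trans p (sym q)) c≢d
      ... | no _ | no _ | yes p | no _ = hit a²≡c² p
      ... | no _ | no _ | no _ | yes p = hit a²≡d² p
      ... | no _ | no _ | no _ | no _ = 0≤δ (a ²) (x ²)

    -- Positivity of n - 4 is decisive twice: for the constant, as 2(n - t - 2) = (n - 4) + (n -
    -- 2t), and for the weights of parallelograms with exactly one bracket equal to 1.
    nonelementary : 5 ℕ.≤ n →
      ∃ λ W → ∃ λ C → IsConfiguration _∙_ L W (+ 4) C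
    nonelementary 5≤n = _ , _ , parallelograms x₀ x₁ x₂ {+ 4 * (n′ * (n′ - + 2) * (n′ - t - + 2))}
      (0<* {+ 4} (+<+ (ℕ.s≤s ℕ.z≤n)) (0<* (0<* 0<n 0<n-2) (0<i+i⇒0<i
        (subst (0ℤ <_) (sym (double₁ n′ t)) (ℤ.+-mono-<-≤ 0<n-4 0≤r)))))
      0<weight kernel
      where
      n′ = + n
      r = n′ - (t + t)
      -- With these values the kernel depends neither on roots (g ∙ h) nor on δ (g ²) (h ²).
      x₀ = (n′ - + 2) * (n′ - t)
      x₁ = n′ - + 2
      x₂ = n′
      open Weights x₀ x₁ x₂
      0≤r : 0ℤ ≤ r
      0≤r = ℤ.i≤j⇒0≤j-i 2t≤n
      0<n-4 : 0ℤ < n′ - + 4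
      0<n-4 = i<j⇒0<j-i (+<+ 5≤n)
      0<n-2 : 0ℤ < n′ - + 2
      0<n-2 = i<j⇒0<j-i (+<+ (ℕ.≤-trans (ℕ.s≤s (ℕ.s≤s (ℕ.s≤s ℕ.z≤n))) 5≤n))
      0<n : 0ℤ < n′
      0<n = +<+ (ℕ.≤-trans (ℕ.s≤s ℕ.z≤n) 5≤n)
      double₁ : ∀ n t → (n - t - + 2) + (n - t - + 2) ≡ (n - + 4) + (n - (t + t))
      double₁ = solve-∀
      0≤x₁ρ : ∀ p → 0ℤ ≤ x₁ * roots p
      0≤x₁ρ p = 0≤* (ℤ.<⇒≤ 0<n-2) (0≤roots p)
      -- Here m is the number of brackets equal to 1. Doubling brings in the estimate 2t ≤ n: twice
      -- the left side is n(n - 2 - 2m) + (n - 2)(n - 2t).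
      0<base : ∀ m → 0ℤ < n′ - + 2 - m - m →
               0ℤ < x₀ - x₂ * m
      0<base m 0<n-2-2m = 0<i+i⇒0<i (subst (0ℤ <_) (sym (double n′ t m))
        (ℤ.+-mono-<-≤ (0<* 0<n 0<n-2-2m) (0≤* (ℤ.<⇒≤ 0<n-2) 0≤r)))
        where
        double : ∀ n t m → ((n - + 2) * (n - t) - n * m) + ((n - + 2) * (n - t) - n * m) ≡
                           n * (n - + 2 - m - m) + (n - + 2) * (n - (t + t))
        double = solve-∀
      rearrange : ∀ x y z → x + y - z ≡ x - z + y
      rearrange = solve-∀
      0<n-2-2m : ∀ {a b c d} → Parallelogram a b c d →
                 0ℤ < n′ - + 2 - (δ (a ²) (c ²) + δ (a ²) (d ²)) - (δ (a ²) (c ²) + δ (a ²) (d ²))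
      0<n-2-2m {a} {b} {c} {d} p with a ² ≟ c ² | a ² ≟ d ²
      ... | no _  | no _  = subst (0ℤ <_) (sym (shift n′)) 0<n-2
        where
        shift : ∀ n → n - + 2 - 0ℤ - 0ℤ ≡ n - + 2
        shift = solve-∀
      ... | yes _ | no _  = subst (0ℤ <_) (sym (shift n′)) 0<n-4
        where
        shift : ∀ n → n - + 2 - 1ℤ - 1ℤ ≡ n - + 4
        shift = solve-∀
      ... | no _  | yes _ = subst (0ℤ <_) (sym (shift n′)) 0<n-4
        where
        shift : ∀ n → n - + 2 - 1ℤ - 1ℤ ≡ n - + 4
        shift = solve-∀
      -- For m = 2 the quantity is n - 6, which is positive because n ≥ 2t ≥ 8.
      ... | yes a²≡c² | yes a²≡d² = subst (0ℤ <_) (sym (shift n′ t))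
          (ℤ.+-mono-<-≤ {0ℤ} {+ 2} (+<+ (ℕ.s≤s ℕ.z≤n)) (ℤ.+-mono-≤ (ℤ.+-mono-≤ 0≤t-4 0≤t-4) 0≤r))
        where
        0≤t-4 : 0ℤ ≤ t - + 4
        0≤t-4 = ℤ.i≤j⇒0≤j-i (4≤t p a²≡c² a²≡d²)
        shift : ∀ n t → n - + 2 - + 2 - + 2 ≡ + 2 + ((t - + 4) + (t - + 4) + (n - (t + t)))
        shift = solve-∀
      0<weight : ∀ {a b c d} → Parallelogram a b c d → 0ℤ < weight a b c d
      0<weight {a} {b} {c} {d} p = subst (0ℤ <_)
        (sym (rearrange x₀ (x₁ * roots (a ∙ b)) (x₂ * (δ (a ²) (c ²) + δ (a ²) (d ²)))))
        (ℤ.+-mono-<-≤ (0<base (δ (a ²) (c ²) + δ (a ²) (d ²)) (0<n-2-2m p)) (0≤x₁ρ (a ∙ b)))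
      kernel : ∀ {g h} → ¬ g ≡ h →
        sum⁴ (λ a b c d → W a b c d * (quad a b c d g * quad a b c d h)) ≡
        - (+ 4 * (n′ * (n′ - + 2) * (n′ - t - + 2)))
      kernel {g} {h} g≢h = trans (W-kernel g≢h) (trans (expand n′ t ρ τ) (trans
          (cong₂ (λ x y → - (+ 4 * (n′ * (n′ - + 2) * (n′ - t - + 2)))
                          - + 4 * (n′ - + 2) * x + + 16 * n′ * y)
            (ℤ.i≡j⇒i-j≡0 (roots-idem (g ∙ h))) (ℤ.i≡j⇒i-j≡0 τ²≡τ))
          (collect (- (+ 4 * (n′ * (n′ - + 2) * (n′ - t - + 2)))) (n′ - + 2) n′)))
        where
        ρ = roots (g ∙ h)
        τ = δ (g ²) (h ²)
        τ²≡τ : τ * τ ≡ τ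
        τ²≡τ with g ² ≟ h ²
        ... | yes _ = refl
        ... | no _  = refl
        expand : ∀ n t ρ τ →
          let x₀ = (n - + 2) * (n - t)
              x₁ = n - + 2
              K = x₀ + x₁ * ρ
              wh = x₀ + x₁ * t - n * (τ + τ)
              wg = x₀ + x₁ * ρ - n * (τ + 1ℤ)
          in
          + 4 * ((n * K - n * (t + t) - K * ρ - (K - n * (1ℤ + τ)) - (K - n * (τ + 1ℤ)))
               - + 2 * (n * (x₀ - n * τ) + x₁ * n - n * t - wh - wg - wh + τ * wh)) ≡
          - (+ 4 * (n * (n - + 2) * (n - t - + 2)))
            - + 4 * (n - + 2) * (ρ * ρ - t * ρ) + + 16 * n * (τ * τ - τ)
        expand = solve-∀
        collect : ∀ x y z → x - + 4 * y * 0ℤ + + 16 * z * 0ℤ ≡ x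
        collect = solve-∀

-- Groups of order at most 4

∀vec? : ∀ m n {P : Vec (Fin m) n → Set} → (∀ v → Dec (P v)) → Dec (∀ v → P v)
∀vec? m ℕ.zero    P? = map′ (λ { p [] → p }) (λ p → p []) (P? [])
∀vec? m (ℕ.suc n) P? = map′ (λ { p (x ∷ v) → p x v }) (λ p x v → p (x ∷ v))
  (all? λ x → ∀vec? m n (λ v → P? (x ∷ v)))

private
  centred : Fin 5 → ℤ
  centred x = + toℕ x - + 2

  -- The bound 8 is the largest of the minimal squared norms 1, 8, 6 chosen for n = 1, 2, 3, and it
  -- still excludes the entries ±3. The candidates thus have entries from -2 to 2 and can be
  -- enumerated.
  i*i≤8⇒centred : ∀ i → i * i ≤ + 8 → ∃ λ x → i ≡ centred x
  i*i≤8⇒centred (+ 0) _ = # 2 , refl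
  i*i≤8⇒centred (+ 1) _ = # 3 , refl
  i*i≤8⇒centred (+ 2) _ = # 4 , refl
  i*i≤8⇒centred -[1+ 0 ] _ = # 1 , refl
  i*i≤8⇒centred -[1+ 1 ] _ = # 0 , refl
  i*i≤8⇒centred (+ ℕ.suc (ℕ.suc (ℕ.suc i))) le = contradiction (ℤ.drop‿+≤+ le)
    (ℕ.<⇒≱ (ℕ.*-mono-≤ {3} {3 ℕ.+ i} {3} {3 ℕ.+ i} (ℕ.m≤m+n 3 i) (ℕ.m≤m+n 3 i)))
  i*i≤8⇒centred -[1+ ℕ.suc (ℕ.suc i) ] le = contradiction (ℤ.drop‿+≤+ le)
    (ℕ.<⇒≱ (ℕ.*-mono-≤ {3} {3 ℕ.+ i} {3} {3 ℕ.+ i} (ℕ.m≤m+n 3 i) (ℕ.m≤m+n 3 i)))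

  entries : (k : Fin n → ℤ) → (∀ i → k i * k i ≤ + 8) → ∃ λ v → k ≗ centred ∘ lookup {n = n} v
  entries k k≤8 = tabulate (λ i → proj₁ (i*i≤8⇒centred (k i) (k≤8 i))) ,
    λ i → trans (proj₂ (i*i≤8⇒centred (k i) (k≤8 i))) (cong centred (sym (lookup∘tabulate _ i)))

  -- This weight does not mention the group law, so its kernel can be computed once for each n. That
  -- every quadruple it selects is balanced is checked separately.
  short : (N : ℤ) → Fin n → Fin n → Fin n → Fin n → ℤ
  short N a b c d = if does (normSq (quad a b c d) ℤ.≟ N) then 1ℤ else 0ℤ

  Kernel : ∀ n → ℤ → ℤ → Set
  Kernel n N C = ∀ (g h : Fin n) → g ≡ h ⊎
    sum⁴ (λ a b c d → short N a b c d * (quad a b c d g * quad a b c d h)) ≡ - C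

  kernel? : ∀ n N C → Dec (Kernel n N C)
  kernel? n N C = all? λ g → all? λ h → (g ≟ h) ⊎-dec (_ ℤ.≟ - C)

  -- The vector `quad a a c a` is the difference a - c. It is singled out in this notation so that
  -- `L-quad` can rule it out.
  ShortVectors : ∀ n → ℤ → Set
  ShortVectors n N = ∀ (v : Vec (Fin 5) n) → let k = centred ∘ lookup v in
    sum k ≡ 0ℤ → normSq k ≤ N →
      (∀ i → k i ≡ 0ℤ) ⊎
      (∃ λ a → ∃ λ c → ¬ a ≡ c × ∀ i → k i ≡ quad a a c a i) ⊎
      (∃ λ a → ∃ λ b → ∃ λ c → ∃ λ d → normSq (quad a b c d) ≡ N × ∀ i → k i ≡ quad a b c d i)

  shortVectors? : ∀ n N → Dec (ShortVectors n N)
  shortVectors? n N = ∀vec? 5 n λ v → let k = centred ∘ lookup v in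
    (sum k ℤ.≟ 0ℤ) →-dec ((normSq k ℤ.≤? N) →-dec
      ((all? λ i → k i ℤ.≟ 0ℤ) ⊎-dec
      ((any? λ a → any? λ c → ¬? (a ≟ c) ×-dec all? λ i → k i ℤ.≟ quad a a c a i) ⊎-dec
      (any? λ a → any? λ b → any? λ c → any? λ d →
        (normSq (quad a b c d) ℤ.≟ N) ×-dec all? λ i → k i ℤ.≟ quad a b c d i))))

module SmallConfiguration {n} {_∙_ : Fin n → Fin n → Fin n} {ε : Fin n} {_⁻¹ : Fin n → Fin n}
  (isAbelianGroup : IsAbelianGroup _≡_ _∙_ ε _⁻¹)
  (L : (Fin n → ℤ) → Set ℓ)
  (L-quad : ∀ {k} a b c d → k ≗ quad a b c d → L k → a ∙ b ≡ c ∙ d) where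

  open FinGroup isAbelianGroup

  configuration : ∀ {N C} → 0ℤ < N → N ≤ + 8 → 0ℤ < C → Kernel n N C → ShortVectors n N →
    (∀ a b c d → normSq (quad a b c d) ≡ N → a ∙ b ≡ c ∙ d) →
    IsConfiguration _∙_ L (short N) N C
  configuration {N} {C} 0<N N≤8 0<C kernel shortVectors balanced = record
    { 0<N = 0<N ; 0<C = 0<C
    ; W≥0 = W≥0
    ; balanced = λ {a} {b} {c} {d} 0<W → balanced a b c d (norm a b c d 0<W)
    ; norm = λ {a} {b} {c} {d} → norm a b c d
    ; kernel = kernel′
    ; minimal = minimal
    }
    where
    W≥0 : ∀ a b c d → short N a b c d ≡ 0ℤ ⊎ 0ℤ < short N a b c d
    W≥0 a b c d with does (normSq (quad a b c d) ℤ.≟ N)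
    ... | false = inj₁ refl
    ... | true  = inj₂ (+<+ (ℕ.s≤s ℕ.z≤n))
    norm : ∀ a b c d → 0ℤ < short N a b c d → normSq (quad a b c d) ≡ N
    norm a b c d 0<W with normSq (quad a b c d) ℤ.≟ N
    ... | yes eq = eq
    ... | no _   = contradiction 0<W (ℤ.<-irrefl refl)
    kernel′ : ∀ {g h} → ¬ g ≡ h → _
    kernel′ {g} {h} g≢h with kernel g h
    ... | inj₁ g≡h = contradiction g≡h g≢h
    ... | inj₂ eq  = eq
    minimal : ∀ k → sum k ≡ 0ℤ → L k → ¬ (∀ i → k i ≡ 0ℤ) → normSq k ≤ N →
      ∃ λ a → ∃ λ b → ∃ λ c → ∃ λ d → 0ℤ < short N a b c d × k ≗ quad a b c d
    minimal k Σk≡0 Lk k≢0 k≤N with entries k (λ i →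
      ℤ.≤-trans (term≤sum {f = λ i → k i * k i} (λ i → 0≤i*i (k i)) i) (ℤ.≤-trans k≤N N≤8))
    ... | v , k≗ with shortVectors v (trans (sum-cong-≗ (sym ∘ k≗)) Σk≡0)
                       (subst (_≤ N) (normSq-cong k≗) k≤N)
    ... | inj₁ v≡0 = contradiction (λ i → trans (k≗ i) (v≡0 i)) k≢0
    ... | inj₂ (inj₁ (a , c , a≢c , eq)) = contradiction
            (b≡d⇒a≡c (L-quad a a c a (λ i → trans (k≗ i) (eq i)) Lk) refl) a≢c
    ... | inj₂ (inj₂ (a , b , c , d , norm≡N , eq)) = a , b , c , d ,
            subst (0ℤ <_) (sym (cong (if_then 1ℤ else 0ℤ) (dec-true (_ ℤ.≟ N) norm≡N))) (+<+ (ℕ.s≤s ℕ.z≤n)) ,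
            (λ i → trans (k≗ i) (eq i))

abstract
  private
    -- For n = 1 no `quad` has squared norm 1, so the family is empty and the off-diagonal condition
    -- vacuous. For n = 2 the vectors are ±(2a - 2c), each from one quadruple, and the entry is 2 ·
    -- (-4). For n = 3 they are ±(2a - c - d), with four quadruples for each a counting both signs,
    -- and the entry is 4 · (-2 - 2 + 1).
    kernel₁ : Kernel 1 (+ 1) (+ 1)
    kernel₁ = from-yes (kernel? 1 (+ 1) (+ 1))
    kernel₂ : Kernel 2 (+ 8) (+ 8)
    kernel₂ = from-yes (kernel? 2 (+ 8) (+ 8))
    kernel₃ : Kernel 3 (+ 6) (+ 12)
    kernel₃ = from-yes (kernel? 3 (+ 6) (+ 12))
    short₁ : ShortVectors 1 (+ 1)
    short₁ = from-yes (shortVectors? 1 (+ 1))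
    short₂ : ShortVectors 2 (+ 8)
    short₂ = from-yes (shortVectors? 2 (+ 8))
    short₃ : ShortVectors 3 (+ 6)
    short₃ = from-yes (shortVectors? 3 (+ 6))
    balanced₁ : ∀ (a b c d : Fin 1) → ¬ normSq (quad a b c d) ≡ + 1
    balanced₁ = from-yes (all? {1} λ a → all? λ b → all? λ c → all? λ d → ¬? (normSq (quad a b c d) ℤ.≟ + 1))
    balanced₂ : ∀ (a b c d : Fin 2) → normSq (quad a b c d) ≡ + 8 → a ≡ b × c ≡ d
    balanced₂ = from-yes (all? {2} λ a → all? λ b → all? λ c → all? λ d →
      (normSq (quad a b c d) ℤ.≟ + 8) →-dec (a ≟ b) ×-dec (c ≟ d))
    balanced₃ : ∀ (a b c d : Fin 3) → normSq (quad a b c d) ≡ + 6 →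
      (a ≡ b × ¬ a ≡ c × ¬ a ≡ d × ¬ c ≡ d) ⊎ (c ≡ d × ¬ c ≡ a × ¬ c ≡ b × ¬ a ≡ b)
    balanced₃ = from-yes (all? {3} λ a → all? λ b → all? λ c → all? λ d →
      (normSq (quad a b c d) ℤ.≟ + 6) →-dec
        (((a ≟ b) ×-dec ¬? (a ≟ c) ×-dec ¬? (a ≟ d) ×-dec ¬? (c ≟ d)) ⊎-dec
         ((c ≟ d) ×-dec ¬? (c ≟ a) ×-dec ¬? (c ≟ b) ×-dec ¬? (a ≟ b))))
    third : ∀ (a c d z : Fin 3) → ¬ a ≡ c → ¬ a ≡ d → ¬ c ≡ d → ¬ z ≡ c → ¬ z ≡ d → z ≡ a
    third = from-yes (all? {3} λ a → all? λ c → all? λ d → all? λ z →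
      ¬? (a ≟ c) →-dec ¬? (a ≟ d) →-dec ¬? (c ≟ d) →-dec ¬? (z ≟ c) →-dec ¬? (z ≟ d) →-dec (z ≟ a))

-- If y were missed, removing it from the codomain would embed `Fin (suc n)` into `Fin n`.
injective⇒strictlySurjective : ∀ {n} (f : Fin n → Fin n) → (∀ {i j} → f i ≡ f j → i ≡ j) →
                               ∀ y → ∃ λ i → f i ≡ y
injective⇒strictlySurjective {ℕ.suc n} f f-inj y with any? (λ i → f i ≟ y)
... | yes p = p
... | no ¬p = contradiction
  (injective⇒≤ {f = λ i → punchOut (λ y≡fi → ¬p (i , sym y≡fi))} λ {i} {j} eq →
    f-inj (punchOut-injective (λ y≡fi → ¬p (i , sym y≡fi)) (λ y≡fj → ¬p (j , sym y≡fj)) eq))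
  ℕ.1+n≰n

-- The map leads out of `C₄` because this is how a generator y provides it, as i ↦ yⁱ.
IsoFromC₄ : (Fin n → Fin n → Fin n) → Set
IsoFromC₄ {n} _∙_ = ∃ λ (p : Fin 4 → Fin n) → (∀ {i j} → p i ≡ p j → i ≡ j) ×
  (∀ z → ∃ λ i → p i ≡ z) × (∀ i j → p (AbelianGroup._∙_ C₄ i j) ≡ p i ∙ p j)

-- Since y⁴ = ε by `exponent`, the order of y divides 4, and y² ≠ ε leaves only 4. The four powers
-- of y are then distinct and fill the group.
cyclic-of-order-4 : {_∙_ : Fin 4 → Fin 4 → Fin 4} {ε : Fin 4} {_⁻¹ : Fin 4 → Fin 4}
  (G : IsAbelianGroup _≡_ _∙_ ε _⁻¹) → ∀ {y} → ¬ y ∙ y ≡ ε → IsoFromC₄ _∙_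
cyclic-of-order-4 {_∙_} {ε} G {y} y²≢ε = p , p-injective , injective⇒strictlySurjective p p-injective , p-homo
  where
  open FinGroup G
  open AbelianGroup group using (identityˡ; identityʳ; monoid)
  open Algebra.Properties.Monoid.Mult monoid using (×-homo-+; ×-assocˡ) renaming (_×_ to _times_)
  p : Fin 4 → Fin 4
  p i = toℕ i times y
  times-ε : ∀ m → m times ε ≡ ε
  times-ε ℕ.zero    = refl
  times-ε (ℕ.suc m) = trans (identityˡ _) (times-ε m)
  mod-4 : ∀ m → p (m mod 4) ≡ m times y
  mod-4 m = begin
    toℕ (m mod 4) times y                  ≡⟨ cong (_times y) (toℕ-fromℕ< (m%n<n m 4)) ⟩
    (m % 4) times y                        ≡⟨ identityʳ _ ⟨
    ((m % 4) times y) ∙ ε                    ≡⟨ cong (((m % 4) times y) ∙_) (trans (sym (×-assocˡ y (m / 4) 4))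
                                                (trans (cong ((m / 4) times_) (exponent y)) (times-ε (m / 4)))) ⟨
    ((m % 4) times y) ∙ ((m / 4 ℕ.* 4) times y)  ≡⟨ ×-homo-+ y (m % 4) (m / 4 ℕ.* 4) ⟨
    (m % 4 ℕ.+ m / 4 ℕ.* 4) times y        ≡⟨ cong (_times y) (m≡m%n+[m/n]*n m 4) ⟨
    m times y                              ∎
  p-homo : ∀ i j → p (AbelianGroup._∙_ C₄ i j) ≡ p i ∙ p j
  p-homo i j = trans (mod-4 (toℕ i ℕ.+ toℕ j)) (×-homo-+ y (toℕ i) (toℕ j))
  y≢ε : ¬ y ≡ ε
  y≢ε refl = y²≢ε (identityˡ ε)
  p-kernel : ∀ i → p i ≡ ε → i ≡ 0F
  p-kernel 0F _  = refl
  p-kernel 1F eq = contradiction (trans (sym (identityʳ y)) eq) y≢ε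
  p-kernel 2F eq = contradiction (trans (cong (y ∙_) (sym (identityʳ y))) eq) y²≢ε
  -- Here y = y ∙ y³ = y⁴ = ε.
  p-kernel 3F eq = contradiction (trans (sym (identityʳ y)) (trans (cong (y ∙_) (sym eq)) (exponent y))) y≢ε
  module C = AbelianGroup C₄
  p-injective : ∀ {i j} → p i ≡ p j → i ≡ j
  p-injective {i} {j} eq = Algebra.Properties.Group.x∙y⁻¹≈ε⇒x≈y C.group i j (p-kernel (i C.∙ (j C.⁻¹))
    (∙-cancelʳ′ (begin
      p (i C.∙ (j C.⁻¹)) ∙ p j      ≡⟨ p-homo (i C.∙ (j C.⁻¹)) j ⟨
      p ((i C.∙ (j C.⁻¹)) C.∙ j)    ≡⟨ cong p (Algebra.Properties.Group.//-rightDividesˡ C.group j i) ⟩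
      p i                           ≡⟨ trans eq (sym (identityˡ (p j))) ⟩
      ε ∙ p j                       ∎)))
    where
    ∙-cancelʳ′ : ∀ {x z w} → x ∙ z ≡ w ∙ z → x ≡ w
    ∙-cancelʳ′ {x} {z} {w} = Algebra.Properties.Group.∙-cancelʳ (AbelianGroup.group group) z x w

-- The kernel of ψ enters only as a predicate `L` whose members of the form a + b - c - d are
-- balanced. This is enough to recognise the short vectors.
configuration : ∀ n {_∙_ : Fin n → Fin n → Fin n} {ε : Fin n} {_⁻¹ : Fin n → Fin n}
  (G : IsAbelianGroup _≡_ _∙_ ε _⁻¹) (L : (Fin n → ℤ) → Set ℓ) →
  (∀ {k} a b c d → k ≗ quad a b c d → L k → a ∙ b ≡ c ∙ d) → ¬ IsoFromC₄ _∙_ →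
  ∃ λ W → ∃ λ N → ∃ λ C → IsConfiguration _∙_ L W N C
configuration 0 {ε = ()}
configuration 1 G L L-quad _ = _ , _ , _ , small (+<+ (ℕ.s≤s ℕ.z≤n)) (+≤+ (ℕ.s≤s ℕ.z≤n)) (+<+ (ℕ.s≤s ℕ.z≤n))
  kernel₁ short₁ (λ a b c d norm≡1 → contradiction norm≡1 (balanced₁ a b c d))
  where open SmallConfiguration G L L-quad renaming (configuration to small)
configuration 2 {_∙_} {ε} G L L-quad _ = _ , _ , _ , small (+<+ (ℕ.s≤s ℕ.z≤n)) ℤ.≤-refl (+<+ (ℕ.s≤s ℕ.z≤n))
  kernel₂ short₂ balanced
  where
  open SmallConfiguration G L L-quad renaming (configuration to small)
  open FinGroup G
  open AbelianGroup group using (identityʳ)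
  square : ∀ x → x ∙ x ≡ ε
  square x = trans (cong (x ∙_) (sym (identityʳ x))) (exponent x)
  balanced : ∀ a b c d → normSq (quad a b c d) ≡ + 8 → a ∙ b ≡ c ∙ d
  balanced a b c d norm≡8 with balanced₂ a b c d norm≡8
  ... | refl , refl = trans (square a) (sym (square c))
configuration 3 {_∙_} G L L-quad _ = _ , _ , _ ,
  small (+<+ (ℕ.s≤s ℕ.z≤n)) (+≤+ (ℕ.m≤m+n 6 2)) (+<+ (ℕ.s≤s ℕ.z≤n)) kernel₃ short₃ balanced
  where
  open SmallConfiguration G L L-quad renaming (configuration to small)
  open FinGroup G
  open Algebra.Properties.Group (AbelianGroup.group group) using (\\-leftDividesˡ)
  open Group (AbelianGroup.group group) using (_\\_)
  -- By cancellation the solution z of az = cd is neither c nor d, so among three elements it is a.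
  square : ∀ {a c d} → ¬ a ≡ c → ¬ a ≡ d → ¬ c ≡ d → a ∙ a ≡ c ∙ d
  square {a} {c} {d} a≢c a≢d c≢d = trans (cong (a ∙_) (sym z≡a)) az≡cd
    where
    z = a \\ (c ∙ d)
    az≡cd : a ∙ z ≡ c ∙ d
    az≡cd = \\-leftDividesˡ a (c ∙ d)
    z≡a : z ≡ a
    z≡a = third a c d z a≢c a≢d c≢d (λ z≡c → a≢d (b≡c⇒a≡d az≡cd z≡c)) (λ z≡d → a≢c (b≡d⇒a≡c az≡cd z≡d))
  balanced : ∀ a b c d → normSq (quad a b c d) ≡ + 6 → a ∙ b ≡ c ∙ d
  balanced a b c d norm≡6 with balanced₃ a b c d norm≡6
  ... | inj₁ (refl , a≢c , a≢d , c≢d) = square a≢c a≢d c≢d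
  ... | inj₂ (refl , c≢a , c≢b , a≢b) = sym (square c≢a c≢b a≢b)
configuration n@(ℕ.suc (ℕ.suc (ℕ.suc (ℕ.suc m)))) {_∙_} {ε} G L L-quad ¬C₄
  with all? (λ y → y ∙ y ≟ ε)
... | yes y²≡ε = let (W , config) = elementary (ℕ.s≤s (ℕ.s≤s (ℕ.s≤s ℕ.z≤n))) y²≡ε in W , _ , _ , config
  where open Configurations G L L-quad
... | no ¬y²≡ε with ¬∀⟶∃¬ n _ (λ y → y ∙ y ≟ ε) ¬y²≡ε
configuration 4 G L L-quad ¬C₄ | no _ | y , y²≢ε = contradiction (cyclic-of-order-4 G y²≢ε) ¬C₄
configuration n@(ℕ.suc (ℕ.suc (ℕ.suc (ℕ.suc (ℕ.suc m))))) G L L-quad _ | no _ | y , y²≢ε =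
  let (W , C , config) = nonelementary y²≢ε (ℕ.s≤s (ℕ.s≤s (ℕ.s≤s (ℕ.s≤s (ℕ.s≤s ℕ.z≤n))))) in W , _ , C , config
  where open Configurations G L L-quad

-- The expansion of a vector in the short vectors

-- Vanishing row sums determine the diagonal: it must be (n - 1)C = nC - C. In matrix form, K = nC·I
-- - C·J with J the all-ones matrix.
diagonal-kernel : ∀ (K : Fin n → Fin n → ℤ) C → (∀ {g a} → ¬ g ≡ a → K g a ≡ - C) →
                  (∀ a → sum (λ g → K g a) ≡ 0ℤ) → ∀ g a → K g a ≡ + n * C * δ a g + - C
diagonal-kernel {n} K C off-diagonal row-sum g a with a ≟ g
... | no a≢g   = trans (off-diagonal (a≢g ∘ sym)) (sym (trans (cong (_+ - C) (ℤ.*-zeroʳ (+ n * C)))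
                   (ℤ.+-identityˡ (- C))))
... | yes refl = begin
  K a a                                          ≡⟨ isolate (+ n) C (K a a) ⟩
  + n * - C + (K a a + C) + (+ n * C * 1ℤ + - C)  ≡⟨ cong (_+ (+ n * C * 1ℤ + - C)) total ⟩
  0ℤ + (+ n * C * 1ℤ + - C)                      ≡⟨ ℤ.+-identityˡ _ ⟩
  + n * C * 1ℤ + - C                             ∎
  where
  isolate : ∀ n C k → k ≡ n * - C + (k + C) + (n * C * 1ℤ + - C)
  isolate = solve-∀
  pointwise : ∀ g → K g a ≡ - C + δ a g * (K a a + C)
  pointwise g with a ≟ g
  ... | yes refl = cancel (K a a) C
    where
    cancel : ∀ k C → k ≡ - C + 1ℤ * (k + C)
    cancel = solve-∀
  ... | no a≢g   = trans (off-diagonal (a≢g ∘ sym)) (sym (trans (cong (λ s → - C + s) (ℤ.*-zeroˡ (K a a + C)))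
                     (ℤ.+-identityʳ (- C))))
  total : + n * - C + (K a a + C) ≡ 0ℤ
  total = begin
    + n * - C + (K a a + C)                 ≡⟨ cong₂ _+_ (sum-const n (- C)) (sum-δ a (λ _ → K a a + C)) ⟨
    sum {n} (λ _ → - C) + sum (λ g → δ a g * (K a a + C)) ≡⟨ ∑-distrib-+ {n} (λ _ → - C) (λ g → δ a g * (K a a + C)) ⟨
    sum (λ g → - C + δ a g * (K a a + C))   ≡⟨ sum-cong-≗ pointwise ⟨
    sum (λ g → K g a)                       ≡⟨ row-sum a ⟩
    0ℤ                                      ∎

-- Quadruples are numbered by a single `Fin`, the kind of index that `distinct-points` takes.
decode : Fin ((n ℕ.* n) ℕ.* (n ℕ.* n)) → (Fin n × Fin n) × (Fin n × Fin n)
decode {n} j = let (p , q) = remQuot {n ℕ.* n} (n ℕ.* n) j in remQuot {n} n p , remQuot {n} n q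

encode : (a b c d : Fin n) → Fin ((n ℕ.* n) ℕ.* (n ℕ.* n))
encode {n} a b c d = combine {n ℕ.* n} {n ℕ.* n} (combine {n} {n} a b) (combine {n} {n} c d)

decode-encode : ∀ (a b c d : Fin n) → decode (encode a b c d) ≡ ((a , b) , (c , d))
decode-encode {n} a b c d = trans
  (cong (λ (p , q) → remQuot {n} n p , remQuot {n} n q)
    (remQuot-combine {n ℕ.* n} {n ℕ.* n} (combine {n} {n} a b) (combine {n} {n} c d)))
  (cong₂ _,_ (remQuot-combine {n} {n} a b) (remQuot-combine {n} {n} c d))

sum-decode : ∀ (f : (Fin n × Fin n) × (Fin n × Fin n) → ℤ) →
             sum (f ∘ decode) ≡ sum⁴ (λ a b c d → f ((a , b) , (c , d)))
sum-decode {n} f = begin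
  sum (f ∘ decode)
    ≡⟨ sum-combine (n ℕ.* n) (f ∘ decode) ⟩
  sum (λ p → sum λ q → f (decode (combine {n ℕ.* n} {n ℕ.* n} p q)))
    ≡⟨ sum-combine n (λ p → sum λ q → f (decode (combine {n ℕ.* n} {n ℕ.* n} p q))) ⟩
  sum (λ a → sum λ b → sum λ q → f (decode (combine {n ℕ.* n} {n ℕ.* n} (combine {n} {n} a b) q)))
    ≡⟨ (sum-cong-≗ λ a → sum-cong-≗ λ b → trans
         (sum-combine n (λ q → f (decode (combine {n ℕ.* n} {n ℕ.* n} (combine {n} {n} a b) q))))
         (sum-cong-≗ λ c → sum-cong-≗ λ d → cong f (decode-encode a b c d))) ⟩
  sum⁴ (λ a b c d → f ((a , b) , (c , d))) ∎

quad′ : (Fin n × Fin n) × (Fin n × Fin n) → Fin n → ℤ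
quad′ ((a , b) , (c , d)) = quad a b c d

-- What eutaxy requires once the quadruples have been merged into distinct vectors. By `norm` and
-- `minimal` together, these are all the nonzero vectors of squared norm at most `N` in the lattice.
record ShortVectorSystem (_∙_ : Fin n → Fin n → Fin n) (L : (Fin n → ℤ) → Set ℓ) : Set ℓ where
  field
    N C      : ℤ
    0<N      : 0ℤ < N
    0<C      : 0ℤ < C
    size     : ℕ
    weight   : Fin size → ℤ
    point    : Fin size → Fin n → ℤ
    0<weight : ∀ i → 0ℤ < weight i
    distinct : ∀ i j → point i ≗ point j → i ≡ j
    balanced : ∀ i → ∃ λ a → ∃ λ b → ∃ λ c → ∃ λ d → a ∙ b ≡ c ∙ d × point i ≗ quad a b c d
    norm     : ∀ i → normSq (point i) ≡ N
    kernel   : ∀ g a → sum (λ i → weight i * (point i g * point i a)) ≡ + n * C * δ a g + - C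
    minimal  : ∀ k → sum k ≡ 0ℤ → L k → ¬ (∀ i → k i ≡ 0ℤ) → normSq k ≤ N → ∃ λ i → k ≗ point i
    nonempty : ∀ k → sum k ≡ 0ℤ → ¬ ((i : Fin n) → k i ≡ 0ℤ) → Fin size

shortVectorSystem : ∀ {_∙_ : Fin n → Fin n → Fin n} {L : (Fin n → ℤ) → Set ℓ} {W N C} →
                    IsConfiguration _∙_ L W N C → ShortVectorSystem _∙_ L
shortVectorSystem {n = n} {_∙_ = _∙_} {W = W} {N} {C} config = record
  { N = N ; C = C ; 0<N = 0<N ; 0<C = 0<C
  ; size = size ; weight = weight ; point = point ; 0<weight = 0<weight ; distinct = distinct
  ; balanced = λ i → let (j , 0<w , eq) = origin i
                         ((a , b) , (c , d)) = decode j
                     in a , b , c , d , Config.balanced 0<w , eq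
  ; norm = λ i → let (j , 0<w , eq) = origin i in trans (normSq-cong eq) (Config.norm 0<w)
  ; kernel = diagonal-kernel K C (λ {g} {a} g≢a → trans (K≡ g a) (Config.kernel g≢a)) row-sum
  ; minimal = λ k Σk≡0 Lk k≢0 k≤N →
      let (a , b , c , d , 0<W , eq) = Config.minimal k Σk≡0 Lk k≢0 k≤N
          (i , eq′) = covers (encode a b c d) (subst (λ q → 0ℤ < W′ q) (sym (decode-encode a b c d)) 0<W)
      in i , λ g → trans (eq g) (trans (cong (λ q → quad′ q g) (sym (decode-encode a b c d))) (eq′ g))
  ; nonempty = nonempty
  }
  where
  module Config = IsConfiguration config
  open Config using (0<N; 0<C)
  W′ : (Fin n × Fin n) × (Fin n × Fin n) → ℤ
  W′ ((a , b) , (c , d)) = W a b c d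
  W′≥0 : ∀ q → W′ q ≡ 0ℤ ⊎ 0ℤ < W′ q
  W′≥0 ((a , b) , (c , d)) = Config.W≥0 a b c d
  open Distinct (distinct-points {n} (W′ ∘ decode) (quad′ ∘ decode) (W′≥0 ∘ decode))
  K : Fin n → Fin n → ℤ
  K g a = sum λ i → weight i * (point i g * point i a)
  K≡ : ∀ g a → K g a ≡ sum⁴ (λ x y z w → W x y z w * (quad x y z w g * quad x y z w a))
  K≡ g a = trans (kernel g a) (sum-decode λ q → W′ q * (quad′ q g * quad′ q a))
  sum-point : ∀ i → sum (point i) ≡ 0ℤ
  sum-point i = let (j , _ , eq) = origin i
                    ((a , b) , (c , d)) = decode {n} j
                in trans (sum-cong-≗ eq) (sum-quad a b c d)
  row-sum : ∀ a → sum (λ g → K g a) ≡ 0ℤ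
  row-sum a = begin
    sum (λ g → sum λ i → weight i * (point i g * point i a))   ≡⟨ ∑-comm (λ g i → weight i * (point i g * point i a)) ⟩
    sum (λ i → sum λ g → weight i * (point i g * point i a))   ≡⟨ (sum-0 λ i → trans
      (sum-cong-≗ λ g → swap (weight i) (point i g) (point i a))
      (trans (sym (*-distribˡ-sum (weight i * point i a) (point i)))
        (trans (cong (weight i * point i a *_) (sum-point i)) (ℤ.*-zeroʳ (weight i * point i a))))) ⟩
    0ℤ                                                         ∎
    where
    swap : ∀ w x y → w * (x * y) ≡ w * y * x
    swap = solve-∀
  -- An empty family would make every entry 0, contrary to -C off the diagonal. A nonzero k of sum 0
  -- supplies the two distinct indices that an off-diagonal entry takes.
  nonempty : ∀ k → sum k ≡ 0ℤ → ¬ (∀ i → k i ≡ 0ℤ) → Fin size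
  nonempty k Σk≡0 k≢0 = inhabited size refl
    where
    module S = Step (step k Σk≡0 k≢0)
    sum-empty : ∀ {m} (f : Fin m → ℤ) → m ≡ 0 → sum f ≡ 0ℤ
    sum-empty f refl = refl
    inhabited : ∀ m → size ≡ m → Fin size
    inhabited (ℕ.suc m) eq = subst Fin (sym eq) zero
    inhabited ℕ.zero    eq = contradiction 0<C (ℤ.<-irrefl (sym (ℤ.neg-injective
      (trans (sym (trans (K≡ S.a S.c) (Config.kernel S.a≢c))) (sum-empty _ eq)))))

module RingIdentity {r ℓ} (R : CommutativeRing r ℓ) (φ : ℤ → CommutativeRing.Carrier R) where

  private module R = CommutativeRing R
  open Algebra.Properties.Semiring.Sum R.semiring
    using () renaming
    ( sum to ∑; sum-cong-≋ to ∑-cong; *-distribˡ-sum to *-distribˡ-∑; ∑-comm to ∑-swap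
    ; ∑-distrib-+ to ∑-+; sum-replicate-zero to ∑-replicate-zero)
  open import Relation.Binary.Reasoning.Setoid R.setoid
    using (step-≈-⟩; step-≈-⟨) renaming (begin_ to begin≈_; _∎ to _∎≈)

  module _ (φ-+ : ∀ i j → φ (i + j) R.≈ φ i R.+ φ j) (φ-* : ∀ i j → φ (i * j) R.≈ φ i R.* φ j)
           (φ-0 : φ 0ℤ R.≈ R.0#) (φ-1 : φ 1ℤ R.≈ R.1#) where

    φ-sum : ∀ {n} (f : Fin n → ℤ) → φ (sum f) R.≈ ∑ (φ ∘ f)
    φ-sum {ℕ.zero}  f = φ-0
    φ-sum {ℕ.suc n} f = R.trans (φ-+ (f zero) _) (R.+-congˡ (φ-sum (f ∘ suc)))

    private
      ∑-0 : ∀ {n} {f : Fin n → R.Carrier} → (∀ i → f i R.≈ R.0#) → ∑ f R.≈ R.0#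
      ∑-0 {n} eq = R.trans (∑-cong eq) (∑-replicate-zero n)

      ∑-δ : ∀ {n} a (f : Fin n → R.Carrier) → ∑ (λ i → φ (δ a i) R.* f i) R.≈ f a
      ∑-δ zero f = R.trans (R.+-cong (R.trans (R.*-congʳ φ-1) (R.*-identityˡ (f zero)))
          (∑-0 λ i → R.trans (R.*-congʳ φ-0) (R.zeroˡ (f (suc i)))))
        (R.+-identityʳ (f zero))
      ∑-δ (suc a) f = R.trans (R.+-cong (R.trans (R.*-congʳ φ-0) (R.zeroˡ (f zero))) (∑-δ a (f ∘ suc)))
        (R.+-identityˡ (f (suc a)))

    ∑-combination : ∀ {m n} (r : Fin m → R.Carrier) (k : Fin m → Fin n → ℤ) → (∀ i → sum (k i) ≡ 0ℤ) →
                    ∑ (λ g → ∑ λ i → r i R.* φ (k i g)) R.≈ R.0#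
    ∑-combination r k Σk≡0 = R.trans (∑-swap λ g i → r i R.* φ (k i g)) (∑-0 λ i →
      R.trans (R.sym (*-distribˡ-∑ (r i) (φ ∘ k i))) (R.trans (R.*-congˡ
        (R.trans (R.sym (φ-sum (k i))) (R.trans (R.reflexive (cong φ (Σk≡0 i))) φ-0))) (R.zeroʳ (r i))))

    -- The hypothesis `kernel` reads Σ w p pᵀ = M·I - C·J. The matrix J kills v because its
    -- coordinates sum to 0, and multiplication by c = 1/M recovers v.
    expansion : ∀ {m n} (w : Fin m → ℤ) (p : Fin m → Fin n → ℤ) M C c (v : Fin n → R.Carrier) →
                (∀ g a → sum (λ i → w i * (p i g * p i a)) ≡ M * δ a g + - C) →
                c R.* φ M R.≈ R.1# → ∑ v R.≈ R.0# → ∀ a →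
                v a R.≈ ∑ (λ i → (c R.* φ (w i)) R.* (∑ (λ g → v g R.* φ (p i g)) R.* φ (p i a)))
    expansion {m} {n} w p M C c v kernel cM≈1 Σv≈0 a = R.sym (begin≈
      ∑ (λ i → (c R.* φ (w i)) R.* (∑ (λ g → v g R.* φ (p i g)) R.* φ (p i a)))
        ≈⟨ ∑-cong (λ i → R.trans (regroup i) (R.trans
             (*-distribˡ-∑ ((c R.* φ (w i)) R.* φ (p i a)) λ g → v g R.* φ (p i g)) (∑-cong λ g → term i g))) ⟩
      ∑ (λ i → ∑ λ g → (c R.* v g) R.* φ (w i * (p i g * p i a)))
        ≈⟨ ∑-swap (λ i g → (c R.* v g) R.* φ (w i * (p i g * p i a))) ⟩
      ∑ (λ g → ∑ λ i → (c R.* v g) R.* φ (w i * (p i g * p i a)))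
        ≈⟨ ∑-cong (λ g → R.trans (R.sym (*-distribˡ-∑ (c R.* v g) λ i → φ (w i * (p i g * p i a)))) (R.trans
             (R.*-congˡ (R.trans (R.sym (φ-sum λ i → w i * (p i g * p i a))) (R.trans (R.reflexive (cong φ (kernel g a)))
               (R.trans (φ-+ (M * δ a g) (- C)) (R.+-congʳ (φ-* M (δ a g)))))))
             (R.trans (R.distribˡ (c R.* v g) (φ M R.* φ (δ a g)) (φ (- C))) (R.+-cong (diagonal g) (constant g))))) ⟩
      ∑ (λ g → φ (δ a g) R.* v g R.+ (c R.* φ (- C)) R.* v g)
        ≈⟨ ∑-+ (λ g → φ (δ a g) R.* v g) (λ g → (c R.* φ (- C)) R.* v g) ⟩
      ∑ (λ g → φ (δ a g) R.* v g) R.+ ∑ (λ g → (c R.* φ (- C)) R.* v g)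
        ≈⟨ R.+-cong (∑-δ a v) (R.trans (R.sym (*-distribˡ-∑ (c R.* φ (- C)) v))
             (R.trans (R.*-congˡ Σv≈0) (R.zeroʳ _))) ⟩
      v a R.+ R.0#
        ≈⟨ R.+-identityʳ (v a) ⟩
      v a ∎≈)
      where
      open Algebra.Solver.CommutativeMonoid R.*-commutativeMonoid
      regroup : ∀ i → (c R.* φ (w i)) R.* (∑ (λ g → v g R.* φ (p i g)) R.* φ (p i a)) R.≈
                      ((c R.* φ (w i)) R.* φ (p i a)) R.* ∑ (λ g → v g R.* φ (p i g))
      regroup i = solve 3 (λ x s q → x ⊕ (s ⊕ q) ⊜ (x ⊕ q) ⊕ s) R.refl
        (c R.* φ (w i)) (∑ λ g → v g R.* φ (p i g)) (φ (p i a))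
      term : ∀ i g → ((c R.* φ (w i)) R.* φ (p i a)) R.* (v g R.* φ (p i g)) R.≈
                     (c R.* v g) R.* φ (w i * (p i g * p i a))
      term i g = R.trans
        (solve 5 (λ q c w v p → ((c ⊕ w) ⊕ q) ⊕ (v ⊕ p) ⊜ (c ⊕ v) ⊕ (w ⊕ (p ⊕ q))) R.refl
          (φ (p i a)) c (φ (w i)) (v g) (φ (p i g)))
        (R.*-congˡ (R.sym (R.trans (φ-* (w i) (p i g * p i a)) (R.*-congˡ (φ-* (p i g) (p i a))))))
      diagonal : ∀ g → (c R.* v g) R.* (φ M R.* φ (δ a g)) R.≈ φ (δ a g) R.* v g
      diagonal g = R.trans
        (solve 4 (λ c v m d → (c ⊕ v) ⊕ (m ⊕ d) ⊜ (c ⊕ m) ⊕ (d ⊕ v)) R.refl c (v g) (φ M) (φ (δ a g)))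
        (R.trans (R.*-congʳ cM≈1) (R.*-identityˡ (φ (δ a g) R.* v g)))
      constant : ∀ g → (c R.* v g) R.* φ (- C) R.≈ (c R.* φ (- C)) R.* v g
      constant g = solve 3 (λ c v d → (c ⊕ v) ⊕ d ⊜ (c ⊕ d) ⊕ v) R.refl c (v g) (φ (- C))

-- Real numbers

/1-+ : ∀ i j → (i + j) ℚ./ 1 ≡ i ℚ./ 1 ℚ.+ j ℚ./ 1
/1-+ i j = ℚ.toℚᵘ-injective
  (ℚᵘ.≃-trans (toℚᵘ-/ (i + j) 1)
  (ℚᵘ.≃-trans (ℚᵘ.*≡* (clear i j))
  (ℚᵘ.≃-trans (ℚᵘ.≃-sym (ℚᵘ.+-cong (toℚᵘ-/ i 1) (toℚᵘ-/ j 1)))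
  (ℚᵘ.≃-sym (ℚ.toℚᵘ-homo-+ (i ℚ./ 1) (j ℚ./ 1))))))
  where
  clear : ∀ i j → (i + j) * 1ℤ ≡ (i * 1ℤ + j * 1ℤ) * 1ℤ
  clear = solve-∀

/1-* : ∀ i j → (i * j) ℚ./ 1 ≡ i ℚ./ 1 ℚ.* (j ℚ./ 1)
/1-* i j = ℚ.toℚᵘ-injective
  (ℚᵘ.≃-trans (toℚᵘ-/ (i * j) 1)
  (ℚᵘ.≃-trans (ℚᵘ.*≡* refl)
  (ℚᵘ.≃-trans (ℚᵘ.≃-sym (ℚᵘ.*-cong (toℚᵘ-/ i 1) (toℚᵘ-/ j 1)))
  (ℚᵘ.≃-sym (ℚ.toℚᵘ-homo-* (i ℚ./ 1) (j ℚ./ 1))))))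

/1-mono-≤ : ∀ {i j} → i ≤ j → i ℚ./ 1 ℚ.≤ j ℚ./ 1
/1-mono-≤ {i} {j} i≤j = ℚ.toℚᵘ-cancel-≤
  (ℚᵘ.≤-respˡ-≃ (ℚᵘ.≃-sym (toℚᵘ-/ i 1)) (ℚᵘ.≤-respʳ-≃ (ℚᵘ.≃-sym (toℚᵘ-/ j 1))
    (ℚᵘ.*≤* (ℤ.*-monoʳ-≤-nonNeg 1ℤ i≤j))))

/1-positive : ∀ {i} → 0ℤ < i → 0ℚ ℚ.< i ℚ./ 1
/1-positive {i} 0<i = ℚ.<-≤-trans (from-yes (0ℚ ℚ.<? 1ℚ)) (/1-mono-≤ (ℤ.i<j⇒suc[i]≤j 0<i))

fromℤ-+ : ∀ i j → fromℤ (i + j) ≃ fromℤ i +ᴿ fromℤ j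
fromℤ-+ i j = ≃-pointwise {fromℤ (i + j)} {fromℤ i +ᴿ fromℤ j} λ _ → /1-+ i j

fromℤ-* : ∀ i j → fromℤ (i * j) ≃ fromℤ i *ᴿ fromℤ j
fromℤ-* i j = ≃-pointwise {fromℤ (i * j)} {fromℤ i *ᴿ fromℤ j} λ _ → /1-* i j

≃⇒≤ᴿ : ∀ x y → x ≃ y → x ≤ᴿ y
≃⇒≤ᴿ x y x≃y ε 0<ε = let (N , p) = x≃y ε 0<ε in
  N , λ n h → ∣p-q∣≤r⇒p≤q+r (seq x n) (seq y n) (p n h)

≤ᴿ-trans : ∀ x y z → x ≤ᴿ y → y ≤ᴿ z → x ≤ᴿ z
≤ᴿ-trans x y z x≤y y≤z ε 0<ε = both
  (λ n h k → ℚ.≤-trans h (subst (seq y n ℚ.+ ½ ℚ.* ε ℚ.≤_)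
    (trans (ℚ.+-assoc (seq z n) (½ ℚ.* ε) (½ ℚ.* ε)) (cong (seq z n ℚ.+_) (halves ε)))
    (ℚ.+-monoˡ-≤ (½ ℚ.* ε) k)))
  (x≤y (½ ℚ.* ε) (half-pos 0<ε)) (y≤z (½ ℚ.* ε) (half-pos 0<ε))

fromℤ-mono-≤ : ∀ {i j} → i ≤ j → fromℤ i ≤ᴿ fromℤ j
fromℤ-mono-≤ {i} {j} i≤j ε 0<ε = always λ _ →
  ℚ.≤-trans (/1-mono-≤ i≤j) (subst (ℚ._≤ j ℚ./ 1 ℚ.+ ε) (ℚ.+-identityʳ (j ℚ./ 1))
    (ℚ.+-monoʳ-≤ (j ℚ./ 1) (ℚ.<⇒≤ 0<ε)))

fromℤ-cancel-≤ : ∀ {i j} → fromℤ i ≤ᴿ fromℤ j → i ≤ j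
fromℤ-cancel-≤ {i} {j} φi≤φj = ℤ.≮⇒≥ λ j<i →
  -- Integers j < i are at least 1 apart, so the tolerance ½ already refutes i ≤ j.
  let (N , p) = φi≤φj ½ 0<½
      j+1≤i = subst (ℚ._≤ i ℚ./ 1) (trans (/1-+ 1ℤ j) (ℚ.+-comm 1ℚ (j ℚ./ 1)))
                (/1-mono-≤ (ℤ.i<j⇒suc[i]≤j j<i))
  in ℚ.<-irrefl refl (ℚ.<-≤-trans (ℚ.+-monoʳ-< (j ℚ./ 1) (from-yes (½ ℚ.<? 1ℚ)))
       (ℚ.≤-trans j+1≤i (p N ℕ.≤-refl)))

fromℤ-injective : ∀ {i j} → fromℤ i ≃ fromℤ j → i ≡ j
fromℤ-injective {i} {j} eq = ℤ.≤-antisym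
  (fromℤ-cancel-≤ (≃⇒≤ᴿ (fromℤ i) (fromℤ j) eq))
  (fromℤ-cancel-≤ (≃⇒≤ᴿ (fromℤ j) (fromℤ i) (≃-sym {fromℤ i} {fromℤ j} eq)))

√-mono-≤ : ∀ x y → x ≤ᴿ y → √ x ≤ᴿ √ y
√-mono-≤ x y x≤y ε 0<ε = both
  (λ n h k → ℚ-sqrt-close n n (seq x n) (seq y n) ε 0<ε h k)
  (x≤y (½ ℚ.* ε ℚ.* (½ ℚ.* ε)) (RationalLemmas.*-pos (half-pos 0<ε) (half-pos 0<ε)))
  (archimedean (½ ℚ.* ε) (half-pos 0<ε))

-- Nonnegativity is asked of every approximation of z. Square roots meet this condition, and it lets
-- each rational inequality be multiplied directly.
*ᴿ-monoʳ-≤ : ∀ x y z → (∀ n → 0ℚ ℚ.≤ seq z n) → x ≤ᴿ y → x *ᴿ z ≤ᴿ y *ᴿ z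
*ᴿ-monoʳ-≤ x y z 0≤z x≤y ε 0<ε =
  let (B , 0<B , z≤B) = bounded z
      (δ , 0<δ , Bδ) = scale B ε 0<B 0<ε
  in both (λ n h k → close n B δ (ℚ.<⇒≤ 0<δ) Bδ h k) z≤B (x≤y δ 0<δ)
  where
  ½ε≤ε : ½ ℚ.* ε ℚ.≤ ε
  ½ε≤ε = subst₂ ℚ._≤_ (ℚ.+-identityʳ (½ ℚ.* ε)) (halves ε)
    (ℚ.+-monoʳ-≤ (½ ℚ.* ε) (ℚ.<⇒≤ (half-pos 0<ε)))
  close : ∀ n B δ → 0ℚ ℚ.≤ δ → B ℚ.* δ ≡ ½ ℚ.* ε → ℚ.∣ seq z n ∣ ℚ.≤ B → seq x n ℚ.≤ seq y n ℚ.+ δ →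
          seq x n ℚ.* seq z n ℚ.≤ seq y n ℚ.* seq z n ℚ.+ ε
  close n B δ 0≤δ Bδ z≤B h =
    ℚ.≤-trans (ℚ.*-monoʳ-≤-nonNeg (seq z n) {{ℚ.nonNegative (0≤z n)}} h)
    (ℚ.≤-trans (ℚ.≤-reflexive (ℚ.*-distribʳ-+ (seq z n) (seq y n) δ))
    (ℚ.+-monoʳ-≤ (seq y n ℚ.* seq z n)
      (ℚ.≤-trans (ℚ.*-monoˡ-≤-nonNeg δ {{ℚ.nonNegative 0≤δ}} (ℚ.≤-trans (p≤∣p∣ (seq z n)) z≤B))
      (ℚ.≤-trans (ℚ.≤-reflexive (trans (ℚ.*-comm δ B) Bδ)) ½ε≤ε))))

√-cancel-≤ : ∀ x y → 0ᴿ ≤ᴿ x → 0ᴿ ≤ᴿ y → √ x ≤ᴿ √ y → x ≤ᴿ y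
√-cancel-≤ x y 0≤x 0≤y √x≤√y =
  ≤ᴿ-trans x (√ x *ᴿ √ x) y (≃⇒≤ᴿ x (√ x *ᴿ √ x) (≃-sym {√ x *ᴿ √ x} {x} (√-square x 0≤x)))
  (≤ᴿ-trans (√ x *ᴿ √ x) (√ y *ᴿ √ x) y (*ᴿ-monoʳ-≤ (√ x) (√ y) (√ x) (√-seq x) √x≤√y)
  (≤ᴿ-trans (√ y *ᴿ √ x) (√ x *ᴿ √ y) y (≃⇒≤ᴿ (√ y *ᴿ √ x) (√ x *ᴿ √ y) (ℝ-Ring.*-comm (√ y) (√ x)))
  (≤ᴿ-trans (√ x *ᴿ √ y) (√ y *ᴿ √ y) y (*ᴿ-monoʳ-≤ (√ x) (√ y) (√ y) (√-seq y) √x≤√y)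
  (≃⇒≤ᴿ (√ y *ᴿ √ y) y (√-square y 0≤y)))))
  where
  √-seq : ∀ x n → 0ℚ ℚ.≤ seq (√ x) n
  √-seq x n = ℚ-sqrt-nonNeg n (seq x n)

reciprocal : ∀ {m} → 0ℤ < m → ∃ λ q → 0ℚ ℚ.< q × fromℚ q *ᴿ fromℤ m ≃ 1ᴿ
reciprocal {m} 0<m = ℚ.1/ (m ℚ./ 1) , ℚ.positive⁻¹ (ℚ.1/ (m ℚ./ 1)) {{ℚ.1/pos⇒pos (m ℚ./ 1)}} ,
  ≃-pointwise {fromℚ (ℚ.1/ (m ℚ./ 1)) *ᴿ fromℤ m} {1ᴿ} λ _ → ℚ.*-inverseˡ (m ℚ./ 1)
  where instance
    m-positive = ℚ.positive (/1-positive 0<m)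
    m-nonZero = ℚ.pos⇒nonZero (m ℚ./ 1) {{m-positive}}

fromℚ-positive : ∀ {q} → 0ℚ ℚ.< q → 0ᴿ <ᴿ fromℚ q
fromℚ-positive {q} 0<q = q , 0<q , always λ _ → ℚ.≤-reflexive (ℚ.+-identityˡ q)

-- The lattice of a finite abelian group

module Powers (A : FiniteAbelianGroup ℓ′ ℓ) where

  open FiniteAbelianGroup A
  open GroupRing A using (_^_; element)
  open AbelianGroup abelianGroup hiding (_-_; isEquivalence) renaming (refl to ≈-refl; sym to ≈-sym; trans to ≈-trans)
  open Algebra.Properties.AbelianGroup abelianGroup using (⁻¹-∙-comm; ε⁻¹≈ε)
  open Algebra.Properties.Monoid.Mult monoid using (×-homo-+) renaming (_×_ to _times_)
  open Algebra.Properties.CommutativeMonoid.Sum commutativeMonoid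
    using () renaming (sum to ∏; sum-cong-≋ to ∏-cong; ∑-distrib-+ to ∏-distrib; sum-replicate-zero to ∏-ε)
  open import Relation.Binary.Reasoning.Setoid setoid
    using (step-≈-⟩; step-≈-⟨) renaming (begin_ to begin≈_; _∎ to _∎≈)

  -- The sum of a nonnegative and a negative integer computes to `_⊖_`, so this covers both mixed
  -- cases of `^-+`.
  ^-⊖ : ∀ x m n → x ^ (m ⊖ n) ≈ (m times x) ∙ (n times x) ⁻¹
  ^-⊖ x ℕ.zero    ℕ.zero    = ≈-sym (inverseʳ ε)
  ^-⊖ x ℕ.zero    (ℕ.suc n) = ≈-sym (identityˡ _)
  ^-⊖ x (ℕ.suc m) ℕ.zero    = ≈-sym (≈-trans (∙-congˡ ε⁻¹≈ε) (identityʳ _))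
  ^-⊖ x (ℕ.suc m) (ℕ.suc n) = begin≈
    x ^ (ℕ.suc m ⊖ ℕ.suc n)           ≈⟨ reflexive (cong (x ^_) (ℤ.[1+m]⊖[1+n]≡m⊖n m n)) ⟩
    x ^ (m ⊖ n)                       ≈⟨ ^-⊖ x m n ⟩
    X ∙ Y ⁻¹                          ≈⟨ ∙-congˡ (identityˡ (Y ⁻¹)) ⟨
    X ∙ (ε ∙ Y ⁻¹)                    ≈⟨ ∙-congˡ (∙-congʳ (inverseʳ x)) ⟨
    X ∙ ((x ∙ x ⁻¹) ∙ Y ⁻¹)           ≈⟨ ∙-congˡ (assoc x (x ⁻¹) (Y ⁻¹)) ⟩
    X ∙ (x ∙ (x ⁻¹ ∙ Y ⁻¹))           ≈⟨ assoc X x _ ⟨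
    (X ∙ x) ∙ (x ⁻¹ ∙ Y ⁻¹)           ≈⟨ ∙-cong (comm X x) (⁻¹-∙-comm x Y) ⟩
    (x ∙ X) ∙ (x ∙ Y) ⁻¹              ∎≈
    where
    X = m times x
    Y = n times x

  ^-+ : ∀ x i j → x ^ (i + j) ≈ x ^ i ∙ x ^ j
  ^-+ x (+ m)    (+ n)    = ×-homo-+ x m n
  ^-+ x (+ m)    -[1+ n ] = ^-⊖ x m (ℕ.suc n)
  ^-+ x -[1+ m ] (+ n)    = ≈-trans (^-⊖ x n (ℕ.suc m)) (comm _ _)
  ^-+ x -[1+ m ] -[1+ n ] = ≈-trans
    (⁻¹-cong (≈-trans (reflexive (cong (_times x) (cong ℕ.suc (sym (ℕ.+-suc m n)))))
      (×-homo-+ x (ℕ.suc m) (ℕ.suc n))))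
    (≈-sym (⁻¹-∙-comm (ℕ.suc m times x) (ℕ.suc n times x)))

  Ψ : (Fin order → ℤ) → Carrier
  Ψ k = ∏ λ i → element i ^ k i

  Ψ-cong : ∀ {k l} → k ≗ l → Ψ k ≈ Ψ l
  Ψ-cong k≗l = ∏-cong λ i → reflexive (cong (element i ^_) (k≗l i))

  Ψ-+ : ∀ k l → Ψ (λ i → k i + l i) ≈ Ψ k ∙ Ψ l
  Ψ-+ k l = ≈-trans (∏-cong λ i → ^-+ (element i) (k i) (l i))
    (∏-distrib (λ i → element i ^ k i) (λ i → element i ^ l i))

  ∏-δ : ∀ {m} (a : Fin m) (f : Fin m → Carrier) → ∏ (λ i → f i ^ δ a i) ≈ f a
  ∏-δ {ℕ.suc m} zero    f = ≈-trans (∙-cong (identityʳ (f zero)) (∏-ε m)) (identityʳ (f zero))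
  ∏-δ           (suc a) f = ≈-trans (∙-congˡ (∏-δ a (f ∘ suc))) (identityˡ (f (suc a)))

  -- Adding c + d to k before taking products avoids inverses. Cancelling cd then shows that Ψ k = ε
  -- is equivalent to ab = cd.
  Ψ-quad : ∀ {k} a b c d → k ≗ quad a b c d → Ψ k ∙ (element c ∙ element d) ≈ element a ∙ element b
  Ψ-quad {k} a b c d k≗ = begin≈
    Ψ k ∙ (element c ∙ element d)     ≈⟨ ∙-congˡ (∙-cong (∏-δ c element) (∏-δ d element)) ⟨
    Ψ k ∙ (Ψ (δ c) ∙ Ψ (δ d))         ≈⟨ ∙-congˡ (Ψ-+ (δ c) (δ d)) ⟨
    Ψ k ∙ Ψ (λ i → δ c i + δ d i)     ≈⟨ Ψ-+ k (λ i → δ c i + δ d i) ⟨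
    Ψ (λ i → k i + (δ c i + δ d i))   ≈⟨ Ψ-cong (λ i → trans (cong (_+ (δ c i + δ d i)) (k≗ i))
                                           (cancel (δ a i) (δ b i) (δ c i) (δ d i))) ⟩
    Ψ (λ i → δ a i + δ b i)           ≈⟨ Ψ-+ (δ a) (δ b) ⟩
    Ψ (δ a) ∙ Ψ (δ b)                 ≈⟨ ∙-cong (∏-δ a element) (∏-δ b element) ⟩
    element a ∙ element b             ∎≈
    where
    cancel : ∀ a b c d → a + b - c - d + (c + d) ≡ a + b
    cancel = solve-∀

-- Transport of the group to its enumeration

module Transport (A : FiniteAbelianGroup ℓ′ ℓ) where

  open FiniteAbelianGroup A
  open AbelianGroup abelianGroup hiding (_-_; isEquivalence) renaming (refl to ≈-refl; sym to ≈-sym; trans to ≈-trans)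
  open Powers A
  open Algebra.Properties.Group group using (∙-cancelʳ)

  element : Fin order → Carrier
  element = Inverse.to enumeration

  index : Carrier → Fin order
  index = Inverse.from enumeration

  index-cong : ∀ {x y} → x ≈ y → index x ≡ index y
  index-cong = Inverse.from-cong enumeration

  element-index : ∀ x → element (index x) ≈ x
  element-index = Inverse.strictlyInverseˡ enumeration

  index-element : ∀ i → index (element i) ≡ i
  index-element = Inverse.strictlyInverseʳ enumeration

  infixl 7 _⊙_

  -- On the index set the group's equality becomes decidable propositional equality, over which the
  -- sums with δ are formed.
  _⊙_ : Fin order → Fin order → Fin order
  i ⊙ j = index (element i ∙ element j)

  element-⊙ : ∀ i j → element (i ⊙ j) ≈ element i ∙ element j
  element-⊙ i j = element-index (element i ∙ element j)

  ⊙-isAbelianGroup : IsAbelianGroup _≡_ _⊙_ (index ε) (λ i → index (element i ⁻¹))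
  ⊙-isAbelianGroup = record
    { isGroup = record
      { isMonoid = record
        { isSemigroup = record
          { isMagma = record { isEquivalence = ≡.isEquivalence ; ∙-cong = cong₂ _⊙_ }
          ; assoc = λ i j k → index-cong (≈-trans (∙-congʳ (element-⊙ i j))
              (≈-trans (assoc (element i) (element j) (element k)) (∙-congˡ (≈-sym (element-⊙ j k)))))
          }
        ; identity = (λ i → trans (index-cong (≈-trans (∙-congʳ (element-index ε)) (identityˡ (element i)))) (index-element i))
                   , (λ i → trans (index-cong (≈-trans (∙-congˡ (element-index ε)) (identityʳ (element i)))) (index-element i))
        }
      ; inverse = (λ i → index-cong (≈-trans (∙-congʳ (element-index (element i ⁻¹))) (inverseˡ (element i))))
                , (λ i → index-cong (≈-trans (∙-congˡ (element-index (element i ⁻¹))) (inverseʳ (element i))))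
      ; ⁻¹-cong = cong λ i → index (element i ⁻¹)
      }
    ; comm = λ i j → index-cong (comm (element i) (element j))
    }

  L : (Fin order → ℤ) → Set ℓ
  L k = Ψ k ≈ ε

  L-quad : ∀ {k} a b c d → k ≗ quad a b c d → L k → a ⊙ b ≡ c ⊙ d
  L-quad a b c d k≗ Lk = index-cong (≈-trans (≈-sym (Ψ-quad a b c d k≗))
    (≈-trans (∙-congʳ Lk) (identityˡ (element c ∙ element d))))

  quad-L : ∀ {k} a b c d → k ≗ quad a b c d → a ⊙ b ≡ c ⊙ d → L k
  quad-L {k} a b c d k≗ ab≡cd = ∙-cancelʳ (element c ∙ element d) (Ψ k) ε
    (≈-trans (Ψ-quad a b c d k≗) (≈-trans (≈-sym (element-⊙ a b))
      (≈-trans (reflexive (cong element ab≡cd)) (≈-trans (element-⊙ c d) (≈-sym (identityˡ _))))))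

  -- The isomorphism asked for is the inverse of p, preceded by `index`.
  isoFromC₄⇒≅ : IsoFromC₄ _⊙_ → rawGroup ≅ AbelianGroup.rawGroup C₄
  isoFromC₄⇒≅ (p , p-injective , p-surjective , p-homo) = f , record
    { isGroupMonomorphism = record
      { isGroupHomomorphism = record
        { isMonoidHomomorphism = record
          { isMagmaHomomorphism = record
            { isRelHomomorphism = record { cong = f-cong }
            ; homo = f-homo
            }
          ; ε-homo = f-ε
          }
        ; ⁻¹-homo = λ x → C.inverseʳ-unique (f x) (f (x ⁻¹))
            (trans (sym (f-homo x (x ⁻¹))) (trans (f-cong (inverseʳ x)) f-ε))
        }
      ; injective = λ {x} {y} fx≡fy → ≈-trans (≈-sym (element-index x))
          (≈-trans (reflexive (cong element (trans (sym (p-f x)) (trans (cong p fx≡fy) (p-f y))))) (element-index y))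
      }
    ; surjective = λ i → element (p i) , λ z≈ → p-injective
        (trans (p-f _) (trans (index-cong z≈) (index-element (p i))))
    }
    where
    module C₄ = AbelianGroup C₄
    module C = Algebra.Properties.Group C₄.group
    f : Carrier → Fin 4
    f x = proj₁ (p-surjective (index x))
    p-f : ∀ x → p (f x) ≡ index x
    p-f x = proj₂ (p-surjective (index x))
    f-cong : ∀ {x y} → x ≈ y → f x ≡ f y
    f-cong x≈y = cong (proj₁ ∘ p-surjective) (index-cong x≈y)
    f-homo : ∀ x y → f (x ∙ y) ≡ f x C₄.∙ f y
    f-homo x y = p-injective (begin
      p (f (x ∙ y))         ≡⟨ p-f (x ∙ y) ⟩
      index (x ∙ y)         ≡⟨ index-cong (∙-cong (≈-sym (element-index x)) (≈-sym (element-index y))) ⟩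
      index x ⊙ index y     ≡⟨ cong₂ _⊙_ (p-f x) (p-f y) ⟨
      p (f x) ⊙ p (f y)     ≡⟨ p-homo (f x) (f y) ⟨
      p (f x C₄.∙ f y)      ∎)
    f-ε : f ε ≡ C₄.ε
    f-ε = C.identityʳ-unique (f ε) (f ε) (trans (sym (f-homo ε ε)) (f-cong (identityˡ ε)))

-- Eutaxy of the lattice from a short vector system

module Eutaxy (A : FiniteAbelianGroup ℓ′ ℓ)
  (system : ShortVectorSystem (Transport._⊙_ A) (Transport.L A)) where

  open FiniteAbelianGroup A
  open Transport A
  open GroupRing A hiding (element)
  open AbelianGroup abelianGroup using (ε) renaming (sym to ≈-sym)
  open ShortVectorSystem system
  open Algebra.Properties.Semiring.Sum ℝ-Ring.semiring
    using () renaming (sum to ∑; sum-cong-≋ to ∑-cong)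
  private module ℤ→ℝ = RingIdentity ℝ-commutativeRing fromℤ

  private
    φ-sum : ∀ {m} (f : Fin m → ℤ) → fromℤ (sum f) ≃ ∑ (fromℤ ∘ f)
    φ-sum = ℤ→ℝ.φ-sum fromℤ-+ fromℤ-* (≃-refl {0ᴿ}) (≃-refl {1ᴿ})

  vector : (Fin order → ℤ) → ℤA
  vector k = record { to = k ∘ index ; cong = cong k ∘ index-cong }

  coordinates : ℤA → Fin order → ℤ
  coordinates k i = k ⟨$⟩ element i

  coordinates-vector : ∀ k → coordinates (vector k) ≗ k
  coordinates-vector k i = cong k (index-element i)

  infix 4 _represents_
  -- Order and equality of real numbers are not decidable here. Lattice vectors are therefore
  -- compared through integer coordinates, and only the results are carried back to real norms.
  _represents_ : (Fin order → ℤ) → ℝA → Set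
  k represents x = ∀ i → x ⟨$⟩ element i ≃ fromℤ (k i)

  represents-≈ᵛ : ∀ {k l x y} → k represents x → l represents y → k ≗ l → x ≈ᵛ y
  represents-≈ᵛ {k} {l} {x} {y} kx ly k≗l a =
    ℝ-Ring.trans {x ⟨$⟩ a} {x ⟨$⟩ element i} {y ⟨$⟩ a} (Func.cong x (≈-sym (element-index a)))
    (ℝ-Ring.trans {x ⟨$⟩ element i} {fromℤ (k i)} {y ⟨$⟩ a} (kx i)
    (ℝ-Ring.trans {fromℤ (k i)} {fromℤ (l i)} {y ⟨$⟩ a} (ℝ-Ring.reflexive (cong fromℤ (k≗l i)))
    (ℝ-Ring.trans {fromℤ (l i)} {y ⟨$⟩ element i} {y ⟨$⟩ a} (ℝ-Ring.sym {y ⟨$⟩ element i} {fromℤ (l i)} (ly i))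
      (Func.cong y (element-index a)))))
    where i = index a

  represents-injective : ∀ {k l x y} → k represents x → l represents y → x ≈ᵛ y → k ≗ l
  represents-injective {k} {l} {x} {y} kx ly x≈y i = fromℤ-injective
    (ℝ-Ring.trans {fromℤ (k i)} {x ⟨$⟩ element i} {fromℤ (l i)} (ℝ-Ring.sym {x ⟨$⟩ element i} {fromℤ (k i)} (kx i))
    (ℝ-Ring.trans {x ⟨$⟩ element i} {y ⟨$⟩ element i} {fromℤ (l i)} (x≈y (element i)) (ly i)))

  0-represents-0ᵛ : (λ _ → 0ℤ) represents 0ᵛ
  0-represents-0ᵛ i = ≃-refl {0ᴿ}

  ι-vector : ∀ k → k represents ι (vector k)
  ι-vector k i = ℝ-Ring.reflexive (cong fromℤ (coordinates-vector k i))

  record InLattice (x : ℝA) : Set (ℓ′ ⊔ ℓ) where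
    field
      k     : Fin order → ℤ
      Σk≡0  : sum k ≡ 0ℤ
      Lk    : L k
      k-x   : k represents x

    nonzero : ¬ x ≈ᵛ 0ᵛ → ¬ (∀ i → k i ≡ 0ℤ)
    nonzero x≉0 k≡0 = x≉0 (represents-≈ᵛ {k} {λ _ → 0ℤ} {x} {0ᵛ} k-x 0-represents-0ᵛ k≡0)

  inLattice : ∀ {x} → x ∈ 𝕃 → InLattice x
  inLattice (k , Lk , Σk≡0 , x≈ιk) = record { k = coordinates k ; Σk≡0 = Σk≡0 ; Lk = Lk ; k-x = λ i → x≈ιk (element i) }

  norm² : ∀ {k x} → k represents x → ⟨ x , x ⟩ ≃ fromℤ (normSq k)
  norm² {k} {x} kx = ℝ-Ring.trans {⟨ x , x ⟩} {∑ λ i → fromℤ (k i * k i)} {fromℤ (normSq k)}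
    (∑-cong {_} {λ i → (x ⟨$⟩ element i) *ᴿ (x ⟨$⟩ element i)} {λ i → fromℤ (k i * k i)} λ i →
      ℝ-Ring.trans {(x ⟨$⟩ element i) *ᴿ (x ⟨$⟩ element i)} {fromℤ (k i) *ᴿ fromℤ (k i)} {fromℤ (k i * k i)}
        (*ᴿ-cong {x ⟨$⟩ element i} {fromℤ (k i)} {x ⟨$⟩ element i} {fromℤ (k i)} (kx i) (kx i))
        (ℝ-Ring.sym {fromℤ (k i * k i)} {fromℤ (k i) *ᴿ fromℤ (k i)} (fromℤ-* (k i) (k i))))
    (ℝ-Ring.sym {fromℤ (normSq k)} {∑ λ i → fromℤ (k i * k i)} (φ-sum λ i → k i * k i))

  module _ {k l x y} (kx : k represents x) (ly : l represents y) where

    normSq-≤⇒∥∥-≤ : normSq k ≤ normSq l → ∥ x ∥ ≤ᴿ ∥ y ∥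
    normSq-≤⇒∥∥-≤ k≤l = √-mono-≤ ⟨ x , x ⟩ ⟨ y , y ⟩
      (≤ᴿ-trans ⟨ x , x ⟩ (fromℤ (normSq k)) ⟨ y , y ⟩ (≃⇒≤ᴿ ⟨ x , x ⟩ (fromℤ (normSq k)) (norm² {k} {x} kx))
      (≤ᴿ-trans (fromℤ (normSq k)) (fromℤ (normSq l)) ⟨ y , y ⟩ (fromℤ-mono-≤ k≤l)
        (≃⇒≤ᴿ (fromℤ (normSq l)) ⟨ y , y ⟩ (ℝ-Ring.sym {⟨ y , y ⟩} {fromℤ (normSq l)} (norm² {l} {y} ly)))))

    ∥∥-≤⇒normSq-≤ : ∥ x ∥ ≤ᴿ ∥ y ∥ → normSq k ≤ normSq l
    ∥∥-≤⇒normSq-≤ x≤y = fromℤ-cancel-≤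
      (≤ᴿ-trans (fromℤ (normSq k)) ⟨ x , x ⟩ (fromℤ (normSq l))
        (≃⇒≤ᴿ (fromℤ (normSq k)) ⟨ x , x ⟩ (ℝ-Ring.sym {⟨ x , x ⟩} {fromℤ (normSq k)} (norm² {k} {x} kx)))
      (≤ᴿ-trans ⟨ x , x ⟩ ⟨ y , y ⟩ (fromℤ (normSq l))
        (√-cancel-≤ ⟨ x , x ⟩ ⟨ y , y ⟩ (0≤ {k} {x} kx) (0≤ {l} {y} ly) x≤y)
        (≃⇒≤ᴿ ⟨ y , y ⟩ (fromℤ (normSq l)) (norm² {l} {y} ly))))
      where
      0≤ : ∀ {k x} → k represents x → 0ᴿ ≤ᴿ ⟨ x , x ⟩
      0≤ {k} {x} kx = ≤ᴿ-trans 0ᴿ (fromℤ (normSq k)) ⟨ x , x ⟩ (fromℤ-mono-≤ (0≤normSq k))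
        (≃⇒≤ᴿ (fromℤ (normSq k)) ⟨ x , x ⟩ (ℝ-Ring.sym {⟨ x , x ⟩} {fromℤ (normSq k)} (norm² {k} {x} kx)))

  -- By `minimal` a shorter vector would be one of the points, but those all have squared norm
  -- exactly `N`.
  N≤normSq : ∀ k → sum k ≡ 0ℤ → L k → ¬ (∀ i → k i ≡ 0ℤ) → N ≤ normSq k
  N≤normSq k Σk≡0 Lk k≢0 = ℤ.≮⇒≥ λ k<N →
    let (i , k≗p) = minimal k Σk≡0 Lk k≢0 (ℤ.<⇒≤ k<N)
    in ℤ.<-irrefl (trans (normSq-cong k≗p) (norm i)) k<N

  minVec : Fin size → ℝA
  minVec i = ι (vector (point i))

  minVec-represents : ∀ i → point i represents minVec i
  minVec-represents i = ι-vector (point i)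

  minVec∈𝕃 : ∀ i → minVec i ∈ 𝕃
  minVec∈𝕃 i = let (a , b , c , d , ab≡cd , p≗) = balanced i
                   p≗′ = λ j → trans (coordinates-vector (point i) j) (p≗ j)
    in vector (point i) , quad-L a b c d p≗′ ab≡cd , trans (sum-cong-≗ p≗′) (sum-quad a b c d) ,
       (λ a → ≃-refl {minVec i ⟨$⟩ a})

  minVec≉0 : ∀ i → ¬ minVec i ≈ᵛ 0ᵛ
  minVec≉0 i s≈0 = ℤ.<-irrefl (trans (sym (trans (normSq-cong p≗0) (sum-0 {order} λ _ → refl))) (norm i)) 0<N
    where
    p≗0 : point i ≗ λ _ → 0ℤ
    p≗0 = represents-injective {point i} {λ _ → 0ℤ} {minVec i} {0ᵛ} (minVec-represents i) 0-represents-0ᵛ s≈0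

  minVec-isMinDist : ∀ i → IsMinDist 𝕃 ∥ minVec i ∥
  minVec-isMinDist i = (minVec i , minVec∈𝕃 i , minVec≉0 i , ≃-refl {∥ minVec i ∥}) , λ {x} x∈𝕃 x≉0 →
    let module X = InLattice (inLattice {x} x∈𝕃)
    in normSq-≤⇒∥∥-≤ {point i} {X.k} {minVec i} {x} (minVec-represents i) X.k-x
         (subst (_≤ normSq X.k) (sym (norm i)) (N≤normSq X.k X.Σk≡0 X.Lk (X.nonzero x≉0)))

  minVec∈MinVecs : ∀ i → minVec i ∈ MinVecs 𝕃
  minVec∈MinVecs i = minVec∈𝕃 i , ∥ minVec i ∥ , minVec-isMinDist i , ≃-refl {∥ minVec i ∥}

  -- The witness x for the minimal distance d bounds the norm of s from below, which also shows s ≠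
  -- 0. For the upper bound, d is compared with some `minVec j`, which exists because x is nonzero.
  -- For the trivial group there is no such x, and the set of minimal vectors is empty.
  minVec-exhausts : ∀ {s} → s ∈ MinVecs 𝕃 → ∃ λ i → s ≈ᵛ minVec i
  minVec-exhausts {s} (s∈𝕃 , d , ((x , x∈𝕃 , x≉0 , ∥x∥≃d) , d≤) , ∥s∥≃d) =
    let (i , k≗p) = minimal S.k S.Σk≡0 S.Lk S≢0 S≤N
    in i , represents-≈ᵛ {S.k} {point i} {s} {minVec i} S.k-x (minVec-represents i) k≗p
    where
    module S = InLattice (inLattice {s} s∈𝕃)
    module X = InLattice (inLattice {x} x∈𝕃)
    X≢0 : ¬ (∀ i → X.k i ≡ 0ℤ)
    X≢0 = X.nonzero x≉0
    x≤s : ∥ x ∥ ≤ᴿ ∥ s ∥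
    x≤s = ≤ᴿ-trans (∥ x ∥) d (∥ s ∥) (≃⇒≤ᴿ (∥ x ∥) d ∥x∥≃d) (≃⇒≤ᴿ d (∥ s ∥) (≃-sym {∥ s ∥} {d} ∥s∥≃d))
    N≤S : N ≤ normSq S.k
    N≤S = ℤ.≤-trans (N≤normSq X.k X.Σk≡0 X.Lk X≢0) (∥∥-≤⇒normSq-≤ {X.k} {S.k} {x} {s} X.k-x S.k-x x≤s)
    S≢0 : ¬ (∀ i → S.k i ≡ 0ℤ)
    S≢0 S≡0 = ℤ.<⇒≱ 0<N (subst (N ≤_) (sum-0 λ i → cong₂ _*_ (S≡0 i) (S≡0 i)) N≤S)
    j : Fin size
    j = nonempty X.k X.Σk≡0 X≢0
    S≤N : normSq S.k ≤ N
    S≤N = subst (normSq S.k ≤_) (norm j) (∥∥-≤⇒normSq-≤ {S.k} {point j} {s} {minVec j} S.k-x (minVec-represents j)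
      (≤ᴿ-trans (∥ s ∥) d (∥ minVec j ∥) (≃⇒≤ᴿ (∥ s ∥) d ∥s∥≃d) (d≤ {minVec j} (minVec∈𝕃 j) (minVec≉0 j))))

  coordinate-sum : ∀ {v} → v ∈ Span 𝕃 → ∑ (λ i → v ⟨$⟩ element i) ≃ 0ᴿ
  coordinate-sum {v} (m , r , l , l∈𝕃 , v≈) =
    ℝ-Ring.trans {∑ λ g → v ⟨$⟩ element g} {∑ λ g → ∑ λ i → r i *ᴿ fromℤ (k i g)} {0ᴿ}
      (∑-cong {_} {λ g → v ⟨$⟩ element g} {λ g → ∑ λ i → r i *ᴿ fromℤ (k i g)} λ g →
        ℝ-Ring.trans {v ⟨$⟩ element g} {∑ λ i → r i *ᴿ (l i ⟨$⟩ element g)} {∑ λ i → r i *ᴿ fromℤ (k i g)} (v≈ (element g))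
        (∑-cong {_} {λ i → r i *ᴿ (l i ⟨$⟩ element g)} {λ i → r i *ᴿ fromℤ (k i g)} λ i →
          *ᴿ-cong {r i} {r i} {l i ⟨$⟩ element g} {fromℤ (k i g)} (≃-refl {r i}) (InLattice.k-x (inLattice {l i} (l∈𝕃 i)) g)))
      (ℤ→ℝ.∑-combination fromℤ-+ fromℤ-* (≃-refl {0ᴿ}) (≃-refl {1ᴿ}) r k λ i → InLattice.Σk≡0 (inLattice {l i} (l∈𝕃 i)))
    where
    k : Fin m → Fin order → ℤ
    k i = InLattice.k (inLattice {l i} (l∈𝕃 i))

  isEutacticLattice : IsEutacticLattice (Span 𝕃) 𝕃
  isEutacticLattice = record
    { S⊆V = λ {s} (s∈𝕃 , _) → 1 , (λ _ → 1ᴿ) , (λ _ → s) , (λ _ → s∈𝕃) , λ a →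
        ≃-pointwise {s ⟨$⟩ a} {1ᴿ *ᴿ (s ⟨$⟩ a) +ᴿ 0ᴿ} λ m →
          sym (trans (ℚ.+-identityʳ _) (ℚ.*-identityˡ (seq (s ⟨$⟩ a) m)))
    ; finiteSubset = record
      { size = size
      ; point = minVec
      ; point∈S = minVec∈MinVecs
      ; distinct = λ i j si≈sj → distinct i j (represents-injective {point i} {point j} {minVec i} {minVec j}
          (minVec-represents i) (minVec-represents j) si≈sj)
      ; exhausted = λ {s} → minVec-exhausts {s}
      }
    ; r = r
    ; positive = λ i → fromℚ-positive (RationalLemmas.*-pos 0<q (/1-positive (0<weight i)))
    ; identity = λ {v} v∈V → identity v (coordinate-sum {v} v∈V)
    }
    where
    0<order : 0ℤ < + order
    0<order = +<+ (nonZero (index ε))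
      where
      nonZero : ∀ {m} → Fin m → 0 ℕ.< m
      nonZero {ℕ.suc m} _ = ℕ.s≤s ℕ.z≤n
    -- On vectors of coordinate sum 0 the operator Σ w p pᵀ is multiplication by `M`, so the weights
    -- divided by `M` are the eutaxy coefficients.
    M : ℤ
    M = + order * C
    inverse : ∃ λ q → 0ℚ ℚ.< q × fromℚ q *ᴿ fromℤ M ≃ 1ᴿ
    inverse = reciprocal (0<* 0<order 0<C)
    q = proj₁ inverse
    0<q = proj₁ (proj₂ inverse)
    r : Fin size → ℝ
    r i = fromℚ q *ᴿ fromℤ (weight i)
    identity : ∀ v → ∑ (λ i → v ⟨$⟩ element i) ≃ 0ᴿ → v ≈ᵛ ∑ᵛ (λ i → r i • π (minVec i) v)
    identity v Σv≃0 a =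
      ℝ-Ring.trans {v ⟨$⟩ a} {v ⟨$⟩ element j} {∑ λ i → r i *ᴿ (⟨ v , minVec i ⟩ *ᴿ φ (point i j))}
        (Func.cong v (≈-sym (element-index a)))
      (ℝ-Ring.trans {v ⟨$⟩ element j} {∑ λ i → r i *ᴿ (inner i *ᴿ φ (point i j))}
                    {∑ λ i → r i *ᴿ (⟨ v , minVec i ⟩ *ᴿ φ (point i j))}
        (ℤ→ℝ.expansion fromℤ-+ fromℤ-* (≃-refl {0ᴿ}) (≃-refl {1ᴿ}) weight point M C (fromℚ q)
          (λ g → v ⟨$⟩ element g) kernel (proj₂ (proj₂ inverse)) Σv≃0 j)
        (∑-cong {_} {λ i → r i *ᴿ (inner i *ᴿ φ (point i j))} {λ i → r i *ᴿ (⟨ v , minVec i ⟩ *ᴿ φ (point i j))} λ i →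
          *ᴿ-cong {r i} {r i} {inner i *ᴿ φ (point i j)} {⟨ v , minVec i ⟩ *ᴿ φ (point i j)} (≃-refl {r i})
            (*ᴿ-cong {inner i} {⟨ v , minVec i ⟩} {φ (point i j)} {φ (point i j)} (inner≃ i) (≃-refl {φ (point i j)}))))
      where
      φ = fromℤ
      j = index a
      inner : Fin size → ℝ
      inner i = ∑ λ g → (v ⟨$⟩ element g) *ᴿ φ (point i g)
      inner≃ : ∀ i → inner i ≃ ⟨ v , minVec i ⟩
      inner≃ i = ∑-cong {_} {λ g → (v ⟨$⟩ element g) *ᴿ φ (point i g)}
          {λ g → (v ⟨$⟩ element g) *ᴿ (minVec i ⟨$⟩ element g)} λ g →
        *ᴿ-cong {v ⟨$⟩ element g} {v ⟨$⟩ element g} {φ (point i g)} {minVec i ⟨$⟩ element g}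
          (≃-refl {v ⟨$⟩ element g})
          (ℝ-Ring.sym {minVec i ⟨$⟩ element g} {φ (point i g)} (minVec-represents i g))

theorem5p10 : ∀ {c ℓ : Level} (A : FiniteAbelianGroup c ℓ) →
    let open FiniteAbelianGroup A
        open GroupRing A
    in ¬ (AbelianGroup.rawGroup abelianGroup ≅ AbelianGroup.rawGroup C₄) →
       IsEutacticLattice (Span 𝕃) 𝕃
theorem5p10 A A≇C₄ =
  let (_ , _ , _ , config) = configuration _ ⊙-isAbelianGroup L L-quad (A≇C₄ ∘ isoFromC₄⇒≅)
  in Eutaxy.isEutacticLattice A (shortVectorSystem config)
  where open Transport A
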